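{- For $i\in\{1,2\}$ let $G_i$ be a finite graph on $n_i$ vertices with no universal vertex, and let $k_i$ be a natural number with $k_i\le n_i-2$. If $\mathcal{B}_{\geq k_1}(G_1)\cong\mathcal{B}_{\geq k_2}(G_2)$, then $G_1\cong G_2$. (That is, a graph $G$ with no universal vertices is uniquely determined by $\mathcal{B}_{\geq k}(G)$ whenever $k\le |V(G)|-2$.)
   Context: All graphs are finite and simple. A vertex of $G$ is universal if it has degree $|V(G)|-1$. An independent set partition of $G$ is a partition of $V(G)$ into nonempty independent sets (parts). For such a partition $P$ and $v\in V(G)$, let $P-v$ be the partition of $V(G)\setminus\{v\}$ obtained by deleting $v$ from its part (discarding that part if it becomes empty). The Bell colouring graph $\mathcal{B}(G)$ has as vertices the independent set partitions of $G$, with $P\neq Q$ adjacent iff $P-v=Q-v$ for some $v\in V(G)$. For a natural number $k$, the upper-Bell $k$-colouring graph $\mathcal{B}_{\geq k}(G)$ is the induced subgraph of $\mathcal{B}(G)$ on the partitions with at least $k$ parts. -}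

module Defs where

open import Data.Nat using (ℕ; _≤_; _<ᵇ_; _∸_)
open import Data.Bool using (Bool; true; false; T; not; _∧_; _∨_)
open import Data.Fin using (Fin; toℕ)
open import Data.List using (List; allFin; filterᵇ; length)
open import Data.Bool.ListAction using (all; any)
open import Data.Vec using (Vec; lookup)
open import Data.Product using (Σ; ∃; _×_; proj₁)
open import Relation.Binary.PropositionalEquality using (_≡_; _≢_)
open import Function.Bundles using (_↔_; _⇔_; Inverse)

record Graph (n : ℕ) : Set where
  field
    adj  : Fin n → Fin n → Bool
    sym  : ∀ x y → adj x y ≡ adj y x
    irr  : ∀ x → adj x x ≡ false
open Graph public

Adjacent : ∀ {n} → Graph n → Fin n → Fin n → Set
Adjacent G x y = adj G x y ≡ true

degree : ∀ {n} → Graph n → Fin n → ℕ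
degree {n} G x = length (filterᵇ (adj G x) (allFin n))

Universal : ∀ {n} → Graph n → Fin n → Set
Universal {n} G x = degree G x ≡ n ∸ 1

NoUniversalVertex : ∀ {n} → Graph n → Set
NoUniversalVertex G = ∀ x → Universal G x → ⊥'
  where open import Data.Empty renaming (⊥ to ⊥')

record _≅ᴳ_ {V W : Set} (A : V → V → Set) (B : W → W → Set) : Set where
  field
    bij      : V ↔ W
    adj-pres : ∀ x y → A x y ⇔ B (Inverse.to bij x) (Inverse.to bij y)

_≅_ : ∀ {n₁ n₂} → Graph n₁ → Graph n₂ → Set
G₁ ≅ G₂ = Adjacent G₁ ≅ᴳ Adjacent G₂

-- A partition of Fin n is encoded by its "same part" relation, stored as an
-- n × n Boolean matrix (so partitions have canonical, decidable equality).
-- The parts are exactly the equivalence classes of this relation.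
Rel : ℕ → Set
Rel n = Vec (Vec Bool n) n

same : ∀ {n} → Rel n → Fin n → Fin n → Bool
same M x y = lookup (lookup M x) y

_⇒ᵇ_ : Bool → Bool → Bool
a ⇒ᵇ b = not a ∨ b

isIndPartitionᵇ : ∀ {n} → Graph n → Rel n → Bool
isIndPartitionᵇ {n} G M =
  all (λ x → same M x x ∧
    all (λ y → (same M x y ⇒ᵇ same M y x) ∧
               (same M x y ⇒ᵇ not (adj G x y)) ∧
      all (λ z → (same M x y ∧ same M y z) ⇒ᵇ same M x z) (allFin n))
    (allFin n)) (allFin n)

IndPartition : ∀ {n} → Graph n → Set
IndPartition {n} G = Σ (Rel n) (λ M → T (isIndPartitionᵇ G M))

-- number of parts = number of equivalence classes, counted via their
-- least element (x is least in its class iff no y with toℕ y < toℕ x is in it)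
numParts : ∀ {n} → Rel n → ℕ
numParts {n} M =
  length (filterᵇ (λ x → not (any (λ y → (toℕ y <ᵇ toℕ x) ∧ same M x y) (allFin n)))
                  (allFin n))

-- P - v = Q - v : the same-part relations agree on V(G) \ {v}
-- (deleting v from its part restricts the relation to the other vertices).
EqOffVertex : ∀ {n} → Rel n → Rel n → Fin n → Set
EqOffVertex M N v = ∀ x y → x ≢ v → y ≢ v → same M x y ≡ same N x y

BellAdj : ∀ {n} (G : Graph n) → IndPartition G → IndPartition G → Set
BellAdj G P Q = (P ≢ Q) × ∃ (λ v → EqOffVertex (proj₁ P) (proj₁ Q) v)

UpperBellVertex : ∀ {n} → Graph n → ℕ → Set
UpperBellVertex G k = Σ (IndPartition G) (λ P → k ≤ numParts (proj₁ P))

UpperBellAdj : ∀ {n} (G : Graph n) (k : ℕ) →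
               UpperBellVertex G k → UpperBellVertex G k → Set
UpperBellAdj G k P Q = BellAdj G (proj₁ P) (proj₁ Q)

module Submission where

-- Let H be the complement of G. The neighbours of the discrete partition D are the edges of H, two of
-- them being adjacent when they share a vertex, and three pairwise adjacent ones form a triangle rather
-- than a star exactly when they have a common neighbour at distance two from D (the partition whose only
-- nontrivial part is the triangle). Since k ≤ n - 2, all these vertices survive in the upper graph.
--
-- An isomorphism need not fix discrete partitions, but the image p of D inherits a few properties of the
-- ball of radius two around D. They force the parts of p to have at most three elements, those of size
-- three to be components of H, and no singleton part to be joined in H to both elements of a part of size
-- two. Hence each neighbour of p still determines an edge of the other complement, which
-- gives an injection of edges preserving sharing and triangles. Using both directions and finiteness this
-- is a bijection that also reflects them, and as H has no isolated vertices it comes, as in Whitney's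
-- theorem on line graphs, from an isomorphism of the complements.

open import Axiom.UniquenessOfIdentityProofs using (module Decidable⇒UIP)
open import Defs hiding (sym)
open import Data.Nat as ℕ using (ℕ; zero; suc; _+_; _*_; _∸_; _≤_; z≤n; s≤s; _<ᵇ_)
import Data.Nat.Properties as ℕₚ
open import Data.Bool using (Bool; true; false; T; not; _∧_; T?)
import Data.Bool.Properties as Boolₚ
open import Data.Bool.ListAction using (all; any)
open import Data.Fin as Fin using (Fin; toℕ; combine)
import Data.Fin.Properties as Finₚ
open import Data.Fin.Properties using (_≟_)
open import Data.Fin.Induction using (<-wellFounded)
open import Data.Vec using (tabulate; lookup)
import Data.Vec.Properties as Vecₚ
open import Data.List using (List; []; _∷_; _++_; length; filter; filterᵇ; allFin)
import Data.List.Properties as Listₚ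
open import Data.List.Membership.Propositional using (_∈_; lose; find)
open import Data.List.Membership.Propositional.Properties
  using (∈-∃++; ∈-++⁺ˡ; ∈-++⁺ʳ; ∈-++⁻; ∈-filter⁺; ∈-filter⁻; ∈-allFin)
open import Data.List.Relation.Unary.Any using (here; there)
open import Data.List.Relation.Unary.Any.Properties using (any⁺; any⁻)
open import Data.List.Relation.Unary.All as All using (All; []; _∷_)
open import Data.List.Relation.Unary.All.Properties using (all⁺; all⁻)
open import Data.List.Relation.Unary.AllPairs using ([]; _∷_)
open import Data.List.Relation.Unary.Unique.Propositional using (Unique)
import Data.List.Relation.Unary.Unique.Propositional.Properties as Uniqueₚ
open import Data.Product using (∃; ∃₂; _×_; _,_; proj₁; proj₂)
open import Data.Sum using (_⊎_; inj₁; inj₂)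
open import Data.Empty using (⊥; ⊥-elim)
open import Function using (_∘_; id; mk⇔)
open import Function.Bundles using (Inverse; Equivalence; mk↔ₛ′)
open import Induction.WellFounded using (Acc; acc)
open import Relation.Nullary using (¬_; Dec; yes; no; ¬?; _×-dec_)
open import Relation.Binary.Definitions using (tri<; tri≈; tri>)
open import Relation.Binary.PropositionalEquality
  using (_≡_; _≢_; refl; sym; trans; cong; cong₂; subst; subst₂; ≢-sym)
open Equivalence using (to; from)

-- Counting the parts of a partition

-- The bound `k` is the obstacle. Moving a vertex out of a nontrivial part never lowers the number
-- of parts, so the result is again a vertex of the upper graph. Absorbing a singleton part costs
-- one part and may leave the graph, and about p nothing is known beyond its having at least `k`
-- parts. Around p, a merge is therefore paired with a split elsewhere, or, in `merge`, its
-- existence is forced by the local properties or by k ≤ n - 2.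
--
-- The parts of p need not be singletons, so p is never identified with a discrete partition. Only
-- an injection on edges is extracted from it, and this is why both directions of the isomorphism
-- are used.
--
-- Sharing of endpoints alone would not determine H: three pairwise adjacent vertices of a line
-- graph may come from a triangle or from a star, the source of the exceptions to Whitney's theorem.
-- Carrying triangles along as a separate relation removes these exceptions.

true≢false : ∀ {b} → b ≡ true → b ≡ false → ⊥
true≢false refl ()

T⇒≡ : ∀ {b} → T b → b ≡ true
T⇒≡ = to Boolₚ.T-≡

≡⇒T : ∀ {b} → b ≡ true → T b
≡⇒T = from Boolₚ.T-≡

bool-≡ : ∀ {b c} → (b ≡ true → c ≡ true) → (c ≡ true → b ≡ true) → b ≡ c
bool-≡ {true}  {true}  f g = refl
bool-≡ {true}  {false} f g = sym (f refl)
bool-≡ {false} {true}  f g = g refl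
bool-≡ {false} {false} f g = refl

length-≤-injection : ∀ {A B : Set} (h : A → B) (xs : List A) (ys : List B) → Unique xs →
  (∀ {x y} → x ∈ xs → y ∈ xs → h x ≡ h y → x ≡ y) → (∀ {x} → x ∈ xs → h x ∈ ys) →
  length xs ≤ length ys
length-≤-injection h []       ys _          inj sub = z≤n
length-≤-injection h (x ∷ xs) ys (x∉ ∷ uxs) inj sub with ∈-∃++ (sub (here refl))
... | as , bs , refl = subst (suc (length xs) ≤_) (sym (Listₚ.length-++-sucʳ as (h x) bs))
  (s≤s (length-≤-injection h xs (as ++ bs) uxs (λ p q → inj (there p) (there q)) avoid))
  where
  avoid : ∀ {y} → y ∈ xs → h y ∈ as ++ bs
  avoid {y} y∈ with ∈-++⁻ as (sub (there y∈))
  ... | inj₁ p           = ∈-++⁺ˡ p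
  ... | inj₂ (there p)   = ∈-++⁺ʳ as p
  ... | inj₂ (here hy≡) = ⊥-elim (All.lookup x∉ y∈ (inj (here refl) (there y∈) (sym hy≡)))

length-filter-≢ : ∀ {n} (a : Fin n) (xs : List (Fin n)) → Unique xs →
  length xs ≤ suc (length (filter (λ x → ¬? (x ≟ a)) xs))
length-filter-≢ a [] _ = z≤n
length-filter-≢ a (x ∷ xs) (x∉ ∷ uxs) with x ≟ a
... | yes refl = s≤s (ℕₚ.≤-reflexive (cong length (sym (Listₚ.filter-all _ (All.map ≢-sym x∉)))))
... | no  _    = s≤s (length-filter-≢ a xs uxs)

record IsEq {n} (r : Fin n → Fin n → Bool) : Set where
  field
    reflᵉ  : ∀ x → r x x ≡ true
    symᵉ   : ∀ {x y} → r x y ≡ true → r y x ≡ true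
    transᵉ : ∀ {x y z} → r x y ≡ true → r y z ≡ true → r x z ≡ true

module _ {n} (M : Rel n) (E : IsEq (same M)) where
  open IsEq E

  private
    isLeast : Fin n → Bool
    isLeast x = not (any (λ y → (toℕ y <ᵇ toℕ x) ∧ same M x y) (allFin n))

    leasts : List (Fin n)
    leasts = filterᵇ isLeast (allFin n)

    least : ∀ x → ∃ λ y → same M x y ≡ true × y ∈ leasts
    least x = go x (<-wellFounded x)
      where
      go : ∀ x → Acc Fin._<_ x → ∃ λ y → same M x y ≡ true × y ∈ leasts
      go x (acc rs) with any (λ y → (toℕ y <ᵇ toℕ x) ∧ same M x y) (allFin n) in eq
      ... | false = x , reflᵉ x , ∈-filter⁺ (T? ∘ isLeast) (∈-allFin x) (≡⇒T (cong not eq))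
      ... | true with find (any⁻ _ (allFin n) (≡⇒T eq))
      ... | y , _ , t with to Boolₚ.T-∧ t
      ... | y<x , xy with go y (rs (ℕₚ.<ᵇ⇒< _ _ y<x))
      ... | z , yz , z∈ = z , transᵉ (T⇒≡ xy) yz , z∈

  -- Sending x to the least element of the class of `g x` is injective on `xs`, and least elements
  -- are what `numParts` counts.
  separated-≤-numParts : (g : Fin n → Fin n) (xs : List (Fin n)) → Unique xs →
    (∀ {x y} → x ∈ xs → y ∈ xs → x ≢ y → same M (g x) (g y) ≡ false) →
    length xs ≤ numParts M
  separated-≤-numParts g xs uxs sep =
    length-≤-injection (proj₁ ∘ least ∘ g) xs leasts uxs inj (λ {x} _ → proj₂ (proj₂ (least (g x))))
    where
    inj : ∀ {x y} → x ∈ xs → y ∈ xs → proj₁ (least (g x)) ≡ proj₁ (least (g y)) → x ≡ y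
    inj {x} {y} x∈ y∈ eq with x ≟ y
    ... | yes p = p
    ... | no  ¬p = ⊥-elim (true≢false
      (transᵉ (proj₁ (proj₂ (least (g x))))
              (subst (λ z → same M z (g y) ≡ true) (sym eq) (symᵉ (proj₁ (proj₂ (least (g y)))))))
      (sep x∈ y∈ ¬p))

  -- The least elements of the classes of `N` are pairwise separated in `N`, hence their images in
  -- `M`. The freedom in `g` allows representatives to be chosen away from a vertex whose class is
  -- changing.
  numParts-≤ : (N : Rel n) → IsEq (same N) → (g : Fin n → Fin n) →
    (∀ x y → same N x y ≡ false → same M (g x) (g y) ≡ false) → numParts N ≤ numParts M
  numParts-≤ N F g sep = separated-≤-numParts g _ (Uniqueₚ.filter⁺ _ (Uniqueₚ.allFin⁺ n)) sep′
    where
    isLeastᴺ : Fin n → Bool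
    isLeastᴺ x = not (any (λ y → (toℕ y <ᵇ toℕ x) ∧ same N x y) (allFin n))
    noSmaller : ∀ {x y} → x ∈ filterᵇ isLeastᴺ (allFin n) → same N x y ≡ true → ¬ (toℕ y ℕ.< toℕ x)
    noSmaller {x} {y} x∈ xy y<x = true≢false
      (T⇒≡ (any⁺ (λ y → (toℕ y <ᵇ toℕ x) ∧ same N x y)
        (lose (∈-allFin y) (from Boolₚ.T-∧ (ℕₚ.<⇒<ᵇ y<x , ≡⇒T xy)))))
      (to Boolₚ.T-not-≡ (proj₂ (∈-filter⁻ (T? ∘ isLeastᴺ) {xs = allFin n} x∈)))
    sep′ : ∀ {x y} → x ∈ filterᵇ isLeastᴺ (allFin n) → y ∈ filterᵇ isLeastᴺ (allFin n) →
      x ≢ y → same M (g x) (g y) ≡ false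
    sep′ {x} {y} x∈ y∈ x≢y with same N x y in eq
    ... | false = sep x y eq
    ... | true = ⊥-elim (x≢y (Finₚ.toℕ-injective (ℕₚ.≤-antisym
      (ℕₚ.≮⇒≥ (noSmaller x∈ eq)) (ℕₚ.≮⇒≥ (noSmaller y∈ (IsEq.symᵉ F eq))))))

  -- This turns k ≤ n - 2 into a usable bound: besides the discrete partition it covers one whose
  -- only nontrivial parts are a single triple or two disjoint pairs.
  numParts-≥-2 : (a c : Fin n) →
    (∀ x y → x ≢ a → x ≢ c → y ≢ a → y ≢ c → x ≢ y → same M x y ≡ false) → n ≤ 2 + numParts M
  numParts-≥-2 a c sep = begin
    n                     ≡⟨ Listₚ.length-tabulate id ⟨
    length (allFin n)     ≤⟨ length-filter-≢ a _ (Uniqueₚ.allFin⁺ n) ⟩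
    1 + length xs         ≤⟨ s≤s (length-filter-≢ c xs uxs) ⟩
    2 + length ys         ≤⟨ s≤s (s≤s (separated-≤-numParts id ys (Uniqueₚ.filter⁺ _ uxs) sep′)) ⟩
    2 + numParts M        ∎
    where
    open ℕₚ.≤-Reasoning
    xs = filter (λ x → ¬? (x ≟ a)) (allFin n)
    uxs = Uniqueₚ.filter⁺ (λ x → ¬? (x ≟ a)) (Uniqueₚ.allFin⁺ n)
    ys = filter (λ x → ¬? (x ≟ c)) xs
    bounds : ∀ {x} → x ∈ ys → x ≢ a × x ≢ c
    bounds x∈ with ∈-filter⁻ (λ x → ¬? (x ≟ c)) {xs = xs} x∈
    ... | x∈′ , x≢c = proj₂ (∈-filter⁻ (λ x → ¬? (x ≟ a)) {xs = allFin n} x∈′) , x≢c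
    sep′ : ∀ {x y} → x ∈ ys → y ∈ ys → x ≢ y → same M x y ≡ false
    sep′ x∈ y∈ with bounds x∈ | bounds y∈
    ... | p , q | r , s = sep _ _ p q r s

length-filterᵇ-not : ∀ {A : Set} (f : A → Bool) (xs : List A) →
  length (filterᵇ f xs) + length (filterᵇ (not ∘ f) xs) ≡ length xs
length-filterᵇ-not f [] = refl
length-filterᵇ-not f (x ∷ xs) with f x
... | true  = cong suc (length-filterᵇ-not f xs)
... | false = trans (ℕₚ.+-suc _ _) (cong suc (length-filterᵇ-not f xs))

-- The vertex x counts among its own non-neighbours; if it were the only one, its degree would be n
-- - 1. So the complement has no isolated vertex.
nonNeighbour : ∀ {n} (G : Graph n) → NoUniversalVertex G → ∀ x → ∃ λ y → x ≢ y × adj G x y ≡ false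
nonNeighbour {n} G nouni x with Finₚ.any? (λ y → ¬? (x ≟ y) ×-dec (adj G x y Boolₚ.≟ false))
... | yes p = p
... | no ¬p = ⊥-elim (nouni x (trans (sym (ℕₚ.m+n∸n≡m (degree G x) 1)) (cong (_∸ 1) total)))
  where
  only : ∀ {y} → y ∈ filterᵇ (not ∘ adj G x) (allFin n) → y ≡ x
  only {y} y∈ with y ≟ x
  ... | yes q = q
  ... | no q  = ⊥-elim (¬p (y , ≢-sym q , to Boolₚ.T-not-≡ (proj₂ (∈-filter⁻ (T? ∘ not ∘ adj G x) {xs = allFin n} y∈))))
  single : ∀ (xs : List (Fin n)) → Unique xs → x ∈ xs → (∀ {y} → y ∈ xs → y ≡ x) → length xs ≡ 1
  single (y ∷ [])     _ _ _ = refl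
  single (y ∷ z ∷ xs) ((y≢z ∷ _) ∷ _) _ h = ⊥-elim (y≢z (trans (h (here refl)) (sym (h (there (here refl))))))
  one : length (filterᵇ (not ∘ adj G x) (allFin n)) ≡ 1
  one = single _ (Uniqueₚ.filter⁺ _ (Uniqueₚ.allFin⁺ n))
    (∈-filter⁺ (T? ∘ not ∘ adj G x) (∈-allFin x) (≡⇒T (cong not (irr G x)))) only
  total : degree G x + 1 ≡ n
  total = trans (cong (degree G x +_) (sym one))
    (trans (length-filterᵇ-not (adj G x) (allFin n)) (Listₚ.length-tabulate id))

-- Periodicity of injections of a finite set

iterate : {A : Set} → (A → A) → ℕ → A → A
iterate s zero    x = x
iterate s (suc m) x = s (iterate s m x)

iterate-+ : {A : Set} (s : A → A) (i j : ℕ) (x : A) → iterate s (i + j) x ≡ iterate s i (iterate s j x)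
iterate-+ s zero    j x = refl
iterate-+ s (suc i) j x = cong s (iterate-+ s i j x)

module _ {A : Set} {N : ℕ} (code : A → Fin N) (code-inj : ∀ {x y} → code x ≡ code y → x ≡ y)
         (s : A → A) (s-inj : ∀ {x y} → s x ≡ s y → x ≡ y) where

  private
    iterate-inj : ∀ m {x y} → iterate s m x ≡ iterate s m y → x ≡ y
    iterate-inj zero    eq = eq
    iterate-inj (suc m) eq = iterate-inj m (s-inj eq)

  -- Two iterates coincide by the pigeonhole principle, and injectivity cancels the shorter one.
  periodic : ∀ x → ∃ λ m → iterate s (suc m) x ≡ x
  periodic x with Finₚ.pigeonhole (ℕₚ.n<1+n N) (λ i → code (iterate s (toℕ i) x))
  ... | i , j , i<j , eq = toℕ j ∸ suc (toℕ i) , sym (iterate-inj (toℕ i)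
    (trans (code-inj eq) (trans (cong (λ k → iterate s k x) (sym shift)) (iterate-+ s (toℕ i) _ x))))
    where
    shift : toℕ i + suc (toℕ j ∸ suc (toℕ i)) ≡ toℕ j
    shift = trans (ℕₚ.+-suc (toℕ i) _) (ℕₚ.m+[n∸m]≡n i<j)

module _ {n} (d t : Fin n) where

  opaque
    -- Used in two ways. Pulling a partition back along it puts d into the part of t. As a choice of
    -- representatives, with t taken from the part of d, it lets all parts be counted without using
    -- d.
    redirect : Fin n → Fin n
    redirect x with x ≟ d
    ... | yes _ = t
    ... | no  _ = x

    redirect-at : redirect d ≡ t
    redirect-at with d ≟ d
    ... | yes _ = refl
    ... | no ¬p = ⊥-elim (¬p refl)

    redirect-off : ∀ {x} → x ≢ d → redirect x ≡ x
    redirect-off {x} x≢d with x ≟ d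
    ... | yes p = ⊥-elim (x≢d p)
    ... | no  _ = refl

    redirect-≢ : t ≢ d → ∀ x → redirect x ≢ d
    redirect-≢ t≢d x with x ≟ d
    ... | yes _ = t≢d
    ... | no  p = p

-- Partitions as Boolean matrices

matrix : ∀ {n} → (Fin n → Fin n → Bool) → Rel n
matrix r = tabulate (λ x → tabulate (r x))

same-matrix : ∀ {n} (r : Fin n → Fin n → Bool) x y → same (matrix r) x y ≡ r x y
same-matrix r x y = trans (cong (λ v → lookup v y) (Vecₚ.lookup∘tabulate _ x)) (Vecₚ.lookup∘tabulate _ y)

IsEq-resp : ∀ {n} {r s : Fin n → Fin n → Bool} → (∀ x y → r x y ≡ s x y) → IsEq s → IsEq r
IsEq-resp eq E = record
  { reflᵉ  = λ x → trans (eq x x) (reflᵉ x)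
  ; symᵉ   = λ p → trans (eq _ _) (symᵉ (trans (sym (eq _ _)) p))
  ; transᵉ = λ p q → trans (eq _ _) (transᵉ (trans (sym (eq _ _)) p) (trans (sym (eq _ _)) q)) }
  where open IsEq E

same-ext : ∀ {n} {M N : Rel n} → (∀ x y → same M x y ≡ same N x y) → M ≡ N
same-ext {M = M} {N} eq = trans (sym (Vecₚ.tabulate∘lookup M)) (trans (Vecₚ.tabulate-cong rows) (Vecₚ.tabulate∘lookup N))
  where
  rows : ∀ x → lookup M x ≡ lookup N x
  rows x = trans (sym (Vecₚ.tabulate∘lookup _)) (trans (Vecₚ.tabulate-cong (eq x)) (Vecₚ.tabulate∘lookup _))

⇒ᵇ-elim : ∀ {a b} → (a ⇒ᵇ b) ≡ true → a ≡ true → b ≡ true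
⇒ᵇ-elim t refl = t

⇒ᵇ-intro : ∀ {a b} → (a ≡ true → b ≡ true) → (a ⇒ᵇ b) ≡ true
⇒ᵇ-intro {true}  f = f refl
⇒ᵇ-intro {false} f = refl

∧-elim : ∀ {a b} → a ∧ b ≡ true → a ≡ true × b ≡ true
∧-elim {true} {true} _ = refl , refl

∧-intro : ∀ {a b} → a ≡ true → b ≡ true → a ∧ b ≡ true
∧-intro refl refl = refl

all-elim : ∀ {n} (p : Fin n → Bool) → all p (allFin n) ≡ true → ∀ x → p x ≡ true
all-elim p t x = T⇒≡ (All.lookup (all⁺ p _ (≡⇒T t)) (∈-allFin x))

all-intro : ∀ {n} (p : Fin n → Bool) → (∀ x → p x ≡ true) → all p (allFin n) ≡ true
all-intro {n} p f = T⇒≡ (all⁻ p {allFin n} (All.tabulate (λ {x} _ → ≡⇒T (f x))))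

module _ {n} (G : Graph n) (M : Rel n) where

  IsClique : Set
  IsClique = ∀ {x y} → same M x y ≡ true → adj G x y ≡ false

  indPartition-elim : T (isIndPartitionᵇ G M) → IsEq (same M) × IsClique
  indPartition-elim t = record
      { reflᵉ  = λ x → proj₁ (at x)
      ; symᵉ   = λ {x} {y} → ⇒ᵇ-elim (proj₁ (at₂ x y))
      ; transᵉ = λ {x} {y} {z} p q → ⇒ᵇ-elim (all-elim _ (proj₂ (proj₂ (at₂ x y))) z) (∧-intro p q) }
    , λ {x} {y} p → to Boolₚ.T-not-≡ (≡⇒T (⇒ᵇ-elim (proj₁ (proj₂ (at₂ x y))) p))
    where
    at : ∀ x → same M x x ≡ true × _
    at x = ∧-elim (all-elim _ (T⇒≡ t) x)
    at₂ : ∀ x y → (same M x y ⇒ᵇ same M y x) ≡ true × (same M x y ⇒ᵇ not (adj G x y)) ≡ true ×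
                  all (λ z → (same M x y ∧ same M y z) ⇒ᵇ same M x z) (allFin n) ≡ true
    at₂ x y with ∧-elim (all-elim _ (proj₂ (at x)) y)
    ... | a , b = a , ∧-elim b

  indPartition-intro : IsEq (same M) → IsClique → T (isIndPartitionᵇ G M)
  indPartition-intro E C = ≡⇒T (all-intro _ (λ x → ∧-intro (reflᵉ x) (all-intro _ (λ y →
      ∧-intro (⇒ᵇ-intro symᵉ) (∧-intro (⇒ᵇ-intro (λ p → cong not (C p))) (all-intro {n} _ (λ z →
        ⇒ᵇ-intro (λ p → transᵉ (proj₁ (∧-elim p)) (proj₂ (∧-elim {same M x y} p))))))))))
    where open IsEq E

-- Partitions as vertices of the upper Bell colouring graph

module Bell {n} (G : Graph n) (k : ℕ) where

  V : Set
  V = UpperBellVertex G k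

  -- Opaque so that unification recovers p from ⟦ p ⟧ x y, and p and q from A p q.
  opaque
    A : V → V → Set
    A = UpperBellAdj G k

    ⟦_⟧ : V → Fin n → Fin n → Bool
    ⟦ p ⟧ = same (proj₁ (proj₁ p))

    isEq : ∀ p → IsEq ⟦ p ⟧
    isEq ((M , t) , _) = proj₁ (indPartition-elim G M t)

    clique : ∀ p {x y} → ⟦ p ⟧ x y ≡ true → adj G x y ≡ false
    clique ((M , t) , _) = proj₂ (indPartition-elim G M t)

    proj₁-ext : ∀ {p q : V} → proj₁ p ≡ proj₁ q → p ≡ q
    proj₁-ext {_ , l} {_ , m} refl = cong (_ ,_) (ℕₚ.≤-irrelevant l m)

    ext : ∀ {p q} → (∀ x y → ⟦ p ⟧ x y ≡ ⟦ q ⟧ x y) → p ≡ q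
    ext {(M , t) , _} {(N , u) , _} eq = proj₁-ext (go (same-ext eq) t u)
      where
      go : ∀ {M N : Rel n} → M ≡ N → (t : T (isIndPartitionᵇ G M)) (u : T (isIndPartitionᵇ G N)) → (M , t) ≡ (N , u)
      go refl t u = cong (_ ,_) (Boolₚ.T-irrelevant t u)

    build : (r : Fin n → Fin n → Bool) → IsEq r → (∀ x y → r x y ≡ true → adj G x y ≡ false) →
      (IsEq (same (matrix r)) → k ≤ numParts (matrix r)) → ∃ λ p → ∀ x y → ⟦ p ⟧ x y ≡ r x y
    build r E C l = ((M , indPartition-intro G M E′ (λ {x} {y} e → C x y (trans (sym (same-matrix r x y)) e))) , l E′)
                  , same-matrix r
      where
      M : Rel n
      M = matrix r
      E′ : IsEq (same M)
      E′ = IsEq-resp (same-matrix r) E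

    level : ∀ p (M : Rel n) → IsEq (same M) → (g : Fin n → Fin n) →
      (∀ x y → ⟦ p ⟧ x y ≡ false → same M (g x) (g y) ≡ false) → k ≤ numParts M
    level p M E g sep = ℕₚ.≤-trans (proj₂ p) (numParts-≤ M E (proj₁ (proj₁ p)) (isEq p) g sep)

  Off : Fin n → V → V → Set
  Off v p q = ∀ x y → x ≢ v → y ≢ v → ⟦ p ⟧ x y ≡ ⟦ q ⟧ x y

  opaque
    unfolding ⟦_⟧ A

    A-intro : ∀ {p q} → UpperBellAdj G k p q → A p q
    A-intro a = a

    A-elim : ∀ {p q} → A p q → UpperBellAdj G k p q
    A-elim a = a

    A⇒≢ : ∀ {p q} → A p q → p ≢ q
    A⇒≢ a refl = proj₁ a refl

    A⇒Off : ∀ {p q} → A p q → ∃ λ v → Off v p q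
    A⇒Off = proj₂

    Off⇒A : ∀ {p q v} → p ≢ q → Off v p q → A p q
    Off⇒A p≢q o = (λ e → p≢q (proj₁-ext e)) , _ , o

  rfl : ∀ p x → ⟦ p ⟧ x x ≡ true
  rfl p = IsEq.reflᵉ (isEq p)

  sy : ∀ p {x y} → ⟦ p ⟧ x y ≡ true → ⟦ p ⟧ y x ≡ true
  sy p = IsEq.symᵉ (isEq p)

  tr : ∀ p {x y z} → ⟦ p ⟧ x y ≡ true → ⟦ p ⟧ y z ≡ true → ⟦ p ⟧ x z ≡ true
  tr p = IsEq.transᵉ (isEq p)

  sy≡ : ∀ p x y → ⟦ p ⟧ x y ≡ ⟦ p ⟧ y x
  sy≡ p x y = bool-≡ (sy p) (sy p)

  tr≡ : ∀ p {x y} z → ⟦ p ⟧ x y ≡ true → ⟦ p ⟧ x z ≡ ⟦ p ⟧ y z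
  tr≡ p z xy = bool-≡ (tr p (sy p xy)) (tr p xy)

  irreflexive : ∀ p {x y} → ⟦ p ⟧ x y ≡ false → x ≢ y
  irreflexive p f refl = true≢false (rfl p _) f

  -- x and y are joined in the complement of G
  H : Fin n → Fin n → Set
  H x y = x ≢ y × adj G x y ≡ false

  H-sym : ∀ {x y} → H x y → H y x
  H-sym (p , q) = ≢-sym p , trans (Graph.sym G _ _) q

  same⇒H : ∀ p {x y} → x ≢ y → ⟦ p ⟧ x y ≡ true → H x y
  same⇒H p x≢y e = x≢y , clique p e

  Off-sym : ∀ {v p q} → Off v p q → Off v q p
  Off-sym o x y a b = sym (o x y a b)

  Off-trans : ∀ {v p q r} → Off v p q → Off v q r → Off v p r
  Off-trans o o′ x y a b = trans (o x y a b) (o′ x y a b)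

  Differ : V → V → Fin n → Fin n → Set
  Differ p q x y = ⟦ p ⟧ x y ≢ ⟦ q ⟧ x y

  Differ⇒≢ : ∀ {p q x y} → Differ p q x y → p ≢ q
  Differ⇒≢ d refl = d refl

  t≢f : ∀ {p q x y} → ⟦ p ⟧ x y ≡ true → ⟦ q ⟧ x y ≡ false → Differ p q x y
  t≢f a b e = true≢false a (trans e b)

  f≢t : ∀ {p q x y} → ⟦ p ⟧ x y ≡ false → ⟦ q ⟧ x y ≡ true → Differ p q x y
  f≢t a b e = true≢false b (trans (sym e) a)

  Off-ext : ∀ {v p q} → Off v p q → (∀ y → y ≢ v → ⟦ p ⟧ v y ≡ ⟦ q ⟧ v y) → p ≡ q
  Off-ext {v} {p} {q} o row = ext go
    where
    go : ∀ x y → ⟦ p ⟧ x y ≡ ⟦ q ⟧ x y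
    go x y with x ≟ v | y ≟ v
    ... | yes refl | yes refl = trans (rfl p x) (sym (rfl q x))
    ... | yes refl | no b     = row y b
    ... | no a     | yes refl = trans (sy≡ p x y) (trans (row x a) (sy≡ q y x))
    ... | no a     | no b     = o x y a b

  differ : ∀ {p q} → p ≢ q → ∃₂ λ x y → Differ p q x y
  differ {p} {q} p≢q with Finₚ.any? (λ x → Finₚ.any? (λ y → ¬? (⟦ p ⟧ x y Boolₚ.≟ ⟦ q ⟧ x y)))
  ... | yes d = d
  ... | no ¬d = ⊥-elim (p≢q (ext go))
    where
    go : ∀ x y → ⟦ p ⟧ x y ≡ ⟦ q ⟧ x y
    go x y with ⟦ p ⟧ x y Boolₚ.≟ ⟦ q ⟧ x y
    ... | yes e = e
    ... | no ¬e = ⊥-elim (¬d (x , y , ¬e))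

  Off-differ : ∀ {v p q} → p ≢ q → Off v p q → ∃ λ y → y ≢ v × Differ p q v y
  Off-differ {v} {p} {q} p≢q o with differ p≢q
  ... | x , y , d with x ≟ v | y ≟ v
  ... | yes refl | yes refl = ⊥-elim (d (trans (rfl p x) (sym (rfl q x))))
  ... | yes refl | no b     = y , b , d
  ... | no a     | yes refl = x , a , λ e → d (trans (sy≡ p x y) (trans e (sy≡ q y x)))
  ... | no a     | no b     = ⊥-elim (d (o x y a b))

  hit : ∀ {v p q x y} → Off v p q → Differ p q x y → v ≡ x ⊎ v ≡ y
  hit {v} {p} {q} {x} {y} o d with x ≟ v | y ≟ v
  ... | yes refl | _ = inj₁ refl
  ... | no _  | yes refl = inj₂ refl
  ... | no a  | no b     = ⊥-elim (d (o x y a b))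

  -- One moved vertex would have to lie in both pairs. Together with `hit-triangle` this is the test
  -- by which nonadjacency is established throughout.
  hit-disjoint : ∀ {v p q x y z w} → Off v p q → Differ p q x y → Differ p q z w →
    x ≢ z → x ≢ w → y ≢ z → y ≢ w → ⊥
  hit-disjoint o d e a b c f with hit o d | hit o e
  ... | inj₁ refl | inj₁ refl = a refl
  ... | inj₁ refl | inj₂ refl = b refl
  ... | inj₂ refl | inj₁ refl = c refl
  ... | inj₂ refl | inj₂ refl = f refl

  hit-triangle : ∀ {v p q x y z} → Off v p q → Differ p q x y → Differ p q x z → Differ p q y z →
    x ≢ y → x ≢ z → y ≢ z → ⊥
  hit-triangle o d e f xy xz yz with hit o d
  ... | inj₂ refl with hit o e
  ...   | inj₁ v≡x = xy (sym v≡x)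
  ...   | inj₂ v≡z = yz v≡z
  hit-triangle o d e f xy xz yz | inj₁ refl with hit o f
  ...   | inj₁ v≡y = xy v≡y
  ...   | inj₂ v≡z = xz v≡z

  hit-star : ∀ {v p q x y z} → Off v p q → Differ p q x y → Differ p q x z → y ≢ z → v ≡ x
  hit-star o d e yz with hit o d | hit o e
  ... | inj₁ a    | _         = a
  ... | _         | inj₁ b    = b
  ... | inj₂ refl | inj₂ refl = ⊥-elim (yz refl)

  Single : V → Fin n → Set
  Single p a = ∀ y → y ≢ a → ⟦ p ⟧ a y ≡ false

  opaque
    -- Splitting refines p, so the identity already keeps separated vertices separated and the level
    -- is preserved.
    isolate : ∀ p d → ∃ λ q → Off d p q × Single q d
    isolate p d with build r E C l
      where
      r : Fin n → Fin n → Bool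
      r x y with x ≟ d | y ≟ d
      ... | yes _ | yes _ = true
      ... | yes _ | no _  = false
      ... | no _  | yes _ = false
      ... | no _  | no _  = ⟦ p ⟧ x y
      r⇒p : ∀ x y → r x y ≡ true → ⟦ p ⟧ x y ≡ true
      r⇒p x y e with x ≟ d | y ≟ d
      ... | yes refl | yes refl = rfl p x
      ... | no _  | no _  = e
      E : IsEq r
      IsEq.reflᵉ E x with x ≟ d
      ... | yes _ = refl
      ... | no _  = rfl p x
      IsEq.symᵉ E {x} {y} e with x ≟ d | y ≟ d
      ... | yes _ | yes _ = refl
      ... | no _  | no _  = sy p e
      IsEq.transᵉ E {x} {y} {z} e f with x ≟ d | y ≟ d | z ≟ d
      ... | yes _ | yes _ | yes _ = refl
      ... | no _  | no _  | no _ = tr p e f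
      C : ∀ x y → r x y ≡ true → adj G x y ≡ false
      C x y e = clique p (r⇒p x y e)
      l : IsEq (same (matrix r)) → k ≤ numParts (matrix r)
      l E′ = level p (matrix r) E′ id
        (λ x y f → trans (same-matrix r x y) (Boolₚ.¬-not (λ t → true≢false (r⇒p x y t) f)))
    ... | q , eq = q , off , row
      where
      off : Off d p q
      off x y a b with x ≟ d | y ≟ d | eq x y
      ... | yes p | _     | _ = ⊥-elim (a p)
      ... | no _  | yes p | _ = ⊥-elim (b p)
      ... | no _  | no _  | e = sym e
      row : Single q d
      row y b with d ≟ d | y ≟ d | eq d y
      ... | yes _ | yes p | _ = ⊥-elim (b p)
      ... | yes _ | no _  | e = e
      ... | no ¬p | _     | _ = ⊥-elim (¬p refl)

  opaque
    -- The new relation is the pullback of p along `redirect d t`, hence an equivalence at once. The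
    -- move may lose a part, so the bound on the number of parts is left to the caller, for any
    -- relation that agrees with p off d.
    attach-with : ∀ p d t → t ≢ d → (∀ z → z ≢ d → ⟦ p ⟧ t z ≡ true → adj G d z ≡ false) →
      (∀ (M : Rel n) → IsEq (same M) → (∀ x y → x ≢ d → y ≢ d → same M x y ≡ ⟦ p ⟧ x y) → k ≤ numParts M) →
      ∃ λ q → Off d p q × ⟦ q ⟧ d t ≡ true
    attach-with p d t t≢d cl l = q , off , dt
      where
      σ : Fin n → Fin n
      σ = redirect d t
      r : Fin n → Fin n → Bool
      r x y = ⟦ p ⟧ (σ x) (σ y)
      E : IsEq r
      E = record { reflᵉ = λ x → rfl p (σ x) ; symᵉ = sy p ; transᵉ = tr p }
      r-off : ∀ x y → x ≢ d → y ≢ d → r x y ≡ ⟦ p ⟧ x y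
      r-off x y a b = cong₂ ⟦ p ⟧ (redirect-off d t a) (redirect-off d t b)
      r-row : ∀ y → y ≢ d → r d y ≡ ⟦ p ⟧ t y
      r-row y b = cong₂ ⟦ p ⟧ (redirect-at d t) (redirect-off d t b)
      C : ∀ x y → r x y ≡ true → adj G x y ≡ false
      C x y e = go (x ≟ d) (y ≟ d)
        where
        go : Dec (x ≡ d) → Dec (y ≡ d) → adj G x y ≡ false
        go (yes refl) (yes refl) = irr G x
        go (yes refl) (no b)     = cl y b (trans (sym (r-row y b)) e)
        go (no a)     (yes refl) = trans (Graph.sym G x y) (cl x a (trans (sym (r-row x a)) (sy p e)))
        go (no a)     (no b)     = clique p (trans (sym (r-off x y a b)) e)
      b : ∃ λ q → ∀ x y → ⟦ q ⟧ x y ≡ r x y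
      b = build r E C (λ E′ → l (matrix r) E′ (λ x y u v → trans (same-matrix r x y) (r-off x y u v)))
      q : V
      q = proj₁ b
      off : Off d p q
      off x y u v = sym (trans (proj₂ b x y) (r-off x y u v))
      dt : ⟦ q ⟧ d t ≡ true
      dt = trans (proj₂ b d t) (trans (r-row t t≢d) (rfl p t))

    -- The bound is borrowed from a partition `p₀` already in the upper graph: g gives its parts
    -- representatives that avoid d and are still separated in p.
    attach : ∀ p d t → t ≢ d → (∀ z → z ≢ d → ⟦ p ⟧ t z ≡ true → adj G d z ≡ false) →
      ∀ p₀ (g : Fin n → Fin n) → (∀ x → g x ≢ d) →
      (∀ x y → ⟦ p₀ ⟧ x y ≡ false → ⟦ p ⟧ (g x) (g y) ≡ false) →
      ∃ λ q → Off d p q × ⟦ q ⟧ d t ≡ true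
    attach p d t t≢d cl p₀ g g≢ sep = attach-with p d t t≢d cl (λ M E′ eq →
      level p₀ M E′ g (λ x y f → trans (eq _ _ (g≢ x) (g≢ y)) (sep x y f)))

    attach-≥-2 : k + 2 ≤ n → ∀ p d t → t ≢ d → (∀ z → z ≢ d → ⟦ p ⟧ t z ≡ true → adj G d z ≡ false) →
      ∀ c → (∀ x y → x ≢ d → x ≢ c → y ≢ d → y ≢ c → x ≢ y → ⟦ p ⟧ x y ≡ false) →
      ∃ λ q → Off d p q × ⟦ q ⟧ d t ≡ true
    attach-≥-2 k+2≤n p d t t≢d cl c sep = attach-with p d t t≢d cl (λ M E′ eq →
      ℕₚ.+-cancelˡ-≤ 2 _ _ (ℕₚ.≤-trans (subst (_≤ n) (ℕₚ.+-comm k 2) k+2≤n)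
        (numParts-≥-2 M E′ d c (λ x y a b a′ b′ x≢y → trans (eq x y a a′) (sep x y a b a′ b′ x≢y)))))

  attach-row : ∀ {p q d t} → Off d p q → ⟦ q ⟧ d t ≡ true → t ≢ d → ∀ z → z ≢ d → ⟦ q ⟧ d z ≡ ⟦ p ⟧ t z
  attach-row {p} {q} o dt t≢d z z≢d = trans (tr≡ q z dt) (sym (o _ z t≢d z≢d))

  opaque
    discrete : k + 2 ≤ n → ∃ λ p → ∀ x → Single p x
    discrete k+2≤n = proj₁ b , single
      where
      r : Fin n → Fin n → Bool
      r x y with x ≟ y
      ... | yes _ = true
      ... | no _  = false
      r⇒≡ : ∀ x y → r x y ≡ true → x ≡ y
      r⇒≡ x y e with x ≟ y
      ... | yes q = q
      r-refl : ∀ x → r x x ≡ true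
      r-refl x with x ≟ x
      ... | yes _ = refl
      ... | no ¬q = ⊥-elim (¬q refl)
      E : IsEq r
      IsEq.reflᵉ E = r-refl
      IsEq.symᵉ E {x} {y} e with r⇒≡ x y e
      ... | refl = e
      IsEq.transᵉ E {x} {y} e f with r⇒≡ x y e
      ... | refl = f
      r≢ : ∀ x y → x ≢ y → r x y ≡ false
      r≢ x y x≢y = Boolₚ.¬-not (λ e → x≢y (r⇒≡ x y e))
      o : Fin n
      o = Fin.fromℕ< (ℕₚ.<-≤-trans (subst (ℕ._< k + 2) refl (subst (0 ℕ.<_) (ℕₚ.+-comm 2 k) (s≤s z≤n))) k+2≤n)
      b : ∃ λ p → ∀ x y → ⟦ p ⟧ x y ≡ r x y
      b = build r E (λ x y e → subst (λ z → adj G x z ≡ false) (r⇒≡ x y e) (irr G x))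
        (λ E′ → ℕₚ.+-cancelˡ-≤ 2 _ _ (ℕₚ.≤-trans (subst (_≤ n) (ℕₚ.+-comm k 2) k+2≤n)
          (numParts-≥-2 (matrix r) E′ o o (λ x y _ _ _ _ x≢y → trans (same-matrix r x y) (r≢ x y x≢y)))))
      single : ∀ x → Single (proj₁ b) x
      single x y y≢x = trans (proj₂ b x y) (r≢ x y (≢-sym y≢x))


-- The discrete partition

module _ {V : Set} (A : V → V → Set) where

  Outer : V → V → Set
  Outer p x = x ≢ p × ¬ A p x

  -- The properties of the discrete partition, in terms of the Bell colouring graph alone,
  -- that any vertex corresponding to it under an isomorphism inherits.
  record Local (p : V) : Set where
    field
      outer-exists  : ∀ {q r} → A p q → A p r → q ≢ r → ¬ A q r → ∃ λ x → Outer p x × A x q × A x r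
      outer-unique  : ∀ {q r x y} → A p q → A p r → q ≢ r → Outer p x → A x q → A x r →
                      Outer p y → A y q → A y r → x ≡ y
      outer-second  : ∀ {q x} → A p q → Outer p x → A x q → ∃ λ r → r ≢ q × A p r × A x r
      outer-clique  : ∀ {q r s x} → A p q → A p r → A p s → Outer p x → A x q → A x r → A x s →
                      A q r → s ≢ r → ¬ A s r → ⊥

module _ {V W : Set} {A : V → V → Set} {B : W → W → Set} (I : A ≅ᴳ B) where
  private
    module I = _≅ᴳ_ I
    φ = Inverse.to I.bij
    ψ = Inverse.from I.bij

    φψ : ∀ w → φ (ψ w) ≡ w
    φψ = Inverse.strictlyInverseˡ I.bij

    ψφ : ∀ v → ψ (φ v) ≡ v
    ψφ = Inverse.strictlyInverseʳ I.bij

    push : ∀ {x y} → A (ψ x) (ψ y) → B x y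
    push {x} {y} a = subst₂ B (φψ x) (φψ y) (to (I.adj-pres (ψ x) (ψ y)) a)

    pull : ∀ {x y} → B x y → A (ψ x) (ψ y)
    pull {x} {y} b = from (I.adj-pres (ψ x) (ψ y)) (subst₂ B (sym (φψ x)) (sym (φψ y)) b)

    ψ-inj : ∀ {x y} → ψ x ≡ ψ y → x ≡ y
    ψ-inj {x} {y} e = trans (sym (φψ x)) (trans (cong φ e) (φψ y))

    pull′ : ∀ {p x} → B (φ p) x → A p (ψ x)
    pull′ {p} b = subst (λ z → A z _) (ψφ p) (pull b)

    push′ : ∀ {p x} → A p (ψ x) → B (φ p) x
    push′ {p} a = push (subst (λ z → A z _) (sym (ψφ p)) a)

    pullO : ∀ {p x} → Outer B (φ p) x → Outer A p (ψ x)
    pullO {p} {x} (ne , na) = (λ e → ne (trans (sym (φψ x)) (cong φ e))) , (λ a → na (push′ a))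

  Local-transport : ∀ {p} → Local A p → Local B (φ p)
  Local-transport {p} L = record
    { outer-exists = λ q r q≢r ¬qr → exists (outer-exists (pull′ q) (pull′ r) (λ e → q≢r (ψ-inj e)) (λ a → ¬qr (push a)))
    ; outer-unique = λ q r q≢r ox xq xr oy yq yr → ψ-inj (outer-unique (pull′ q) (pull′ r) (λ e → q≢r (ψ-inj e))
        (pullO ox) (pull xq) (pull xr) (pullO oy) (pull yq) (pull yr))
    ; outer-second = λ q ox xq → second (outer-second (pull′ q) (pullO ox) (pull xq))
    ; outer-clique = λ q r s ox xq xr xs qr s≢r ¬sr → outer-clique (pull′ q) (pull′ r) (pull′ s) (pullO ox)
        (pull xq) (pull xr) (pull xs) (pull qr) (λ e → s≢r (ψ-inj e)) (λ a → ¬sr (push a)) }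
    where
    open Local L
    φ-inj : ∀ {x y} → φ x ≡ φ y → x ≡ y
    φ-inj {x} {y} e = trans (sym (ψφ x)) (trans (cong ψ e) (ψφ y))
    pushO : ∀ {x} → Outer A p x → Outer B (φ p) (φ x)
    pushO (ne , na) = (λ e → ne (φ-inj e)) , (λ b → na (from (I.adj-pres _ _) b))
    exists : ∀ {q r} → (∃ λ x → Outer A p x × A x (ψ q) × A x (ψ r)) → ∃ λ x → Outer B (φ p) x × B x q × B x r
    exists (x , o , a , b) = φ x , pushO o , push′ a , push′ b
    second : ∀ {q x} → (∃ λ r → r ≢ ψ q × A p r × A (ψ x) r) → ∃ λ r → r ≢ q × B (φ p) r × B x r
    second {q} {x} (r , ne , a , b) = φ r , (λ e → ne (trans (sym (ψφ r)) (cong ψ e)))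
      , to (I.adj-pres _ _) a , subst (λ z → B z _) (φψ x) (to (I.adj-pres _ _) b)

module Basics {n} (G : Graph n) (k : ℕ) where
  open Bell G k

  -- When v changes its relation to w alone, the change can equally be ascribed to w.
  Off-row : ∀ {v w q r} → Off v q r → (∀ y → y ≢ v → y ≢ w → ⟦ q ⟧ v y ≡ ⟦ r ⟧ v y) → Off w q r
  Off-row {v} {w} {q} {r} o row x y x≢w y≢w = go (x ≟ v) (y ≟ v)
    where
    go : Dec (x ≡ v) → Dec (y ≡ v) → ⟦ q ⟧ x y ≡ ⟦ r ⟧ x y
    go (yes refl) (yes refl) = trans (rfl q x) (sym (rfl r x))
    go (yes refl) (no y≢v)   = row y y≢v y≢w
    go (no x≢v)   (yes refl) = trans (sy≡ q x y) (trans (row x x≢v x≢w) (sy≡ r y x))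
    go (no x≢v)   (no y≢v)   = o x y x≢v y≢v

  Off-flip : ∀ {p q a b} → a ≢ b → Off a p q → ⟦ q ⟧ a b ≡ true → Single p a → Single p b → Off b p q
  Off-flip {p} {q} {a} {b} a≢b o ab sa sb = Off-row o
    (λ y y≢a y≢b → trans (sa y y≢a) (sym (trans (attach-row o ab (≢-sym a≢b) y y≢a) (sb y y≢b))))

  -- Moves of a and c commute: this is the fourth side of the square p, q, x, r.
  Off-square : ∀ {a c p q r x} → Off a p q → Off c p r → Off c q x →
    (∀ w → w ≢ a → w ≢ c → ⟦ r ⟧ c w ≡ ⟦ x ⟧ c w) → Off a r x
  Off-square {a} {c} {p} {q} {r} {x} pq pr qx row u w u≢a w≢a = go (u ≟ c) (w ≟ c)
    where
    go : Dec (u ≡ c) → Dec (w ≡ c) → ⟦ r ⟧ u w ≡ ⟦ x ⟧ u w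
    go (yes refl) (yes refl) = trans (rfl r u) (sym (rfl x u))
    go (yes refl) (no w≢c)   = row w w≢a w≢c
    go (no u≢c)   (yes refl) = trans (sy≡ r u w) (trans (row u u≢a u≢c) (sy≡ x w u))
    go (no u≢c)   (no w≢c)   = trans (sym (pr u w u≢c w≢c)) (trans (pq u w u≢a w≢a) (qx u w u≢c w≢c))

  Single-sym : ∀ {p a y} → Single p a → y ≢ a → ⟦ p ⟧ y a ≡ false
  Single-sym {p} {a} {y} s y≢a = trans (sy≡ p y a) (s y y≢a)

  Single-Off : ∀ {v p q a} → Single p a → Off v p q → ⟦ q ⟧ a v ≡ false → a ≢ v → Single q a
  Single-Off {v} s o av a≢v y y≢a with y ≟ v
  ... | yes refl = av
  ... | no y≢v   = trans (sym (o _ y a≢v y≢v)) (s y y≢a)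

module AtDiscrete {n} (G : Graph n) (k : ℕ) (k+2≤n : k + 2 ≤ n) where
  open Bell G k
  open Basics G k

  D : V
  D = proj₁ (discrete k+2≤n)

  D-single : ∀ x → Single D x
  D-single = proj₂ (discrete k+2≤n)

  -- The partition with {a, b} as its only nontrivial part, presented as a move of a onto b;
  -- `IsPair-sym` restores the symmetry.
  IsPair : V → Fin n → Fin n → Set
  IsPair q a b = a ≢ b × Off a D q × ⟦ q ⟧ a b ≡ true

  IsPair-sym : ∀ {q a b} → IsPair q a b → IsPair q b a
  IsPair-sym {q} (a≢b , o , ab) = ≢-sym a≢b , Off-flip a≢b o ab (D-single _) (D-single _) , sy q ab

  pair-row : ∀ {q a b} → IsPair q a b → ∀ {u} → u ≢ a → ⟦ q ⟧ a u ≡ true → u ≡ b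
  pair-row {q} {a} {b} (a≢b , o , ab) {u} u≢a au with u ≟ b
  ... | yes e = e
  ... | no u≢b = ⊥-elim (true≢false au (trans (attach-row o ab (≢-sym a≢b) u u≢a) (D-single b u u≢b)))

  pair-only : ∀ {q a b} → IsPair q a b → ∀ {u w} → u ≢ w → ⟦ q ⟧ u w ≡ true → (u ≡ a × w ≡ b) ⊎ (u ≡ b × w ≡ a)
  pair-only {q} {a} {b} Q@(a≢b , o , ab) {u} {w} u≢w uw with u ≟ a | w ≟ a
  ... | yes refl | _        = inj₁ (refl , pair-row Q (≢-sym u≢w) uw)
  ... | no u≢a   | yes refl = inj₂ (pair-row Q u≢a (sy q uw) , refl)
  ... | no u≢a   | no w≢a   = ⊥-elim (true≢false uw (trans (sym (o u w u≢a w≢a)) (D-single u w (≢-sym u≢w))))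

  pair-mem : ∀ {q a b} → IsPair q a b → ∀ {u w} → u ≢ w → ⟦ q ⟧ u w ≡ true → u ≡ a ⊎ u ≡ b
  pair-mem Q u≢w uw with pair-only Q u≢w uw
  ... | inj₁ (e , _) = inj₁ e
  ... | inj₂ (e , _) = inj₂ e

  A⇒pair : ∀ {q} → A D q → ∃₂ λ a b → IsPair q a b
  A⇒pair {q} a with A⇒Off a
  ... | v , o with Off-differ (A⇒≢ a) o
  ... | y , y≢v , d = v , y , ≢-sym y≢v , o , Boolₚ.¬-not (λ e → d (trans (D-single v y y≢v) (sym e)))

  pair⇒A : ∀ {q a b} → IsPair q a b → A D q
  pair⇒A (a≢b , o , ab) = Off⇒A (Differ⇒≢ (f≢t (D-single _ _ (≢-sym a≢b)) ab)) o

  pair : ∀ a b → H a b → ∃ λ q → IsPair q a b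
  pair a b (a≢b , h) with attach-≥-2 k+2≤n D a b (≢-sym a≢b) cl a (λ x y _ _ _ _ x≢y → D-single x y (≢-sym x≢y))
    where
    cl : ∀ z → z ≢ a → ⟦ D ⟧ b z ≡ true → adj G a z ≡ false
    cl z _ bz with z ≟ b
    ... | yes refl = h
    ... | no z≢b   = ⊥-elim (true≢false bz (D-single b z z≢b))
  ... | q , o , ab = q , a≢b , o , ab

  pair-unique : ∀ {q r a b} → IsPair q a b → IsPair r a b → q ≡ r
  pair-unique (a≢b , o , ab) (_ , o′ , ab′) = Off-ext (Off-trans (Off-sym o) o′)
    (λ y y≢a → trans (attach-row o ab (≢-sym a≢b) y y≢a) (sym (attach-row o′ ab′ (≢-sym a≢b) y y≢a)))

  pair-unique′ : ∀ {q r a b c d} → IsPair q a b → IsPair r c d → c ≡ a ⊎ c ≡ b → d ≡ a ⊎ d ≡ b → q ≡ r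
  pair-unique′ Q R (inj₁ refl) (inj₂ refl) = pair-unique Q R
  pair-unique′ Q R (inj₂ refl) (inj₁ refl) = pair-unique (IsPair-sym Q) R
  pair-unique′ Q R (inj₁ refl) (inj₁ refl) = ⊥-elim (proj₁ R refl)
  pair-unique′ Q R (inj₂ refl) (inj₂ refl) = ⊥-elim (proj₁ R refl)

  shared⇒A : ∀ {q r a b c} → q ≢ r → IsPair q a b → IsPair r a c → A q r
  shared⇒A q≢r (_ , o , _) (_ , o′ , _) = Off⇒A q≢r (Off-trans (Off-sym o) o′)

  Disjoint : Fin n → Fin n → Fin n → Fin n → Set
  Disjoint a b c d = (a ≢ c × a ≢ d) × (b ≢ c × b ≢ d)

  ¬A⇒disjoint : ∀ {q r a b c d} → IsPair q a b → IsPair r c d → q ≢ r → ¬ A q r → Disjoint a b c d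
  ¬A⇒disjoint Q R q≢r ¬a =
      ((λ { refl → ¬a (shared⇒A q≢r Q R) }) , (λ { refl → ¬a (shared⇒A q≢r Q (IsPair-sym R)) }))
    , ((λ { refl → ¬a (shared⇒A q≢r (IsPair-sym Q) R) }) , (λ { refl → ¬a (shared⇒A q≢r (IsPair-sym Q) (IsPair-sym R)) }))

  disjoint⇒differ : ∀ {q r a b c d} → IsPair q a b → IsPair r c d → Disjoint a b c d → ⟦ r ⟧ a b ≡ false
  disjoint⇒differ {r = r} Q R ((ac , ad) , _) = Boolₚ.¬-not (λ e → go (pair-mem R (proj₁ Q) e))
    where
    go : _ → ⊥
    go (inj₁ e) = ac e
    go (inj₂ e) = ad e

  A⇒¬disjoint : ∀ {q r a b c d} → IsPair q a b → IsPair r c d → A q r → Disjoint a b c d → ⊥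
  A⇒¬disjoint {q} {r} Q R a dis@((ac , ad) , (bc , bd)) = hit-disjoint (proj₂ (A⇒Off a))
    (t≢f (proj₂ (proj₂ Q)) (disjoint⇒differ Q R dis))
    (f≢t (disjoint⇒differ R Q ((≢-sym ac , ≢-sym bc) , (≢-sym ad , ≢-sym bd))) (proj₂ (proj₂ R)))
    ac ad bc bd

  Triple : V → Fin n → Fin n → Fin n → Set
  Triple x a b v = ⟦ x ⟧ a v ≡ true × (∀ {w u} → w ≢ u → ⟦ x ⟧ w u ≡ true → w ≡ v ⊎ (w ≡ a ⊎ w ≡ b))

  Double : V → Fin n → Fin n → Fin n → Fin n → Set
  Double x a b v z = ⟦ x ⟧ v z ≡ true × v ≢ z × Disjoint a b v z ×
    (∀ {w u} → w ≢ u → ⟦ x ⟧ w u ≡ true → ((w ≡ a ⊎ w ≡ b) × (u ≡ a ⊎ u ≡ b)) ⊎ ((w ≡ v ⊎ w ≡ z) × (u ≡ v ⊎ u ≡ z)))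

  -- A move of a or b would leave x within one move of D, so a third vertex v moves from q to x.
  -- Being a singleton of q, it can only join {a, b} or another singleton z.
  outer-form : ∀ {x q a b} → Outer A D x → A x q → IsPair q a b → ⟦ x ⟧ a b ≡ true ×
    ∃ λ v → a ≢ v × b ≢ v × (Triple x a b v ⊎ ∃ (Double x a b v))
  outer-form {x} {q} {a} {b} (x≢D , ¬A) xq Q@(a≢b , o , ab) with A⇒Off xq
  ... | v , xq-off with v ≟ a | v ≟ b
  ... | yes refl | _ = ⊥-elim (¬A (Off⇒A (≢-sym x≢D) (Off-trans o (Off-sym xq-off))))
  ... | no _ | yes refl = ⊥-elim (¬A (Off⇒A (≢-sym x≢D) (Off-trans (proj₁ (proj₂ (IsPair-sym Q))) (Off-sym xq-off))))
  ... | no v≢a | no v≢b with Off-differ (A⇒≢ xq) xq-off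
  ... | z , z≢v , d = xab , v , ≢-sym v≢a , ≢-sym v≢b , form (z ≟ a) (z ≟ b)
    where
    xab : ⟦ x ⟧ a b ≡ true
    xab = trans (xq-off a b (≢-sym v≢a) (≢-sym v≢b)) ab
    qvz : ⟦ q ⟧ v z ≡ false
    qvz = Boolₚ.¬-not (λ e → case₂ (pair-mem Q (≢-sym z≢v) e))
      where
      case₂ : _ → ⊥
      case₂ (inj₁ e) = v≢a e
      case₂ (inj₂ e) = v≢b e
    vz : ⟦ x ⟧ v z ≡ true
    vz = Boolₚ.¬-not (λ e → d (trans e (sym qvz)))
    off-v : ∀ {w u} → w ≢ v → u ≢ v → w ≢ u → ⟦ x ⟧ w u ≡ true → w ≡ a ⊎ w ≡ b
    off-v w≢v u≢v w≢u e = pair-mem Q w≢u (trans (sym (xq-off _ _ w≢v u≢v)) e)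
    triple : ⟦ x ⟧ v a ≡ true → Triple x a b v
    triple va = sy x va , only
      where
      only : ∀ {w u} → w ≢ u → ⟦ x ⟧ w u ≡ true → w ≡ v ⊎ (w ≡ a ⊎ w ≡ b)
      only {w} {u} w≢u wu with w ≟ v | u ≟ v | w ≟ a
      ... | yes e | _ | _ = inj₁ e
      ... | _ | _ | yes e = inj₂ (inj₁ e)
      ... | no w≢v | no u≢v | _ = inj₂ (off-v w≢v u≢v w≢u wu)
      ... | no w≢v | yes refl | no w≢a = inj₂ (off-v w≢v (≢-sym v≢a) w≢a (tr x wu va))
    form : Dec (z ≡ a) → Dec (z ≡ b) → Triple x a b v ⊎ ∃ (Double x a b v)
    form (yes refl) _ = inj₁ (triple vz)
    form (no _) (yes refl) = inj₁ (triple (tr x vz (sy x xab)))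
    form (no z≢a) (no z≢b) = inj₂ (z , vz , ≢-sym z≢v , ((≢-sym v≢a , ≢-sym z≢a) , (≢-sym v≢b , ≢-sym z≢b)) , only)
      where
      v-row : ∀ {u} → u ≢ v → ⟦ x ⟧ v u ≡ true → u ≡ z
      v-row {u} u≢v vu with u ≟ z
      ... | yes e = e
      ... | no u≢z with off-v z≢v u≢v (≢-sym u≢z) (tr x (sy x vz) vu)
      ... | inj₁ e = ⊥-elim (z≢a e)
      ... | inj₂ e = ⊥-elim (z≢b e)
      only : ∀ {w u} → w ≢ u → ⟦ x ⟧ w u ≡ true → ((w ≡ a ⊎ w ≡ b) × (u ≡ a ⊎ u ≡ b)) ⊎ ((w ≡ v ⊎ w ≡ z) × (u ≡ v ⊎ u ≡ z))
      only {w} {u} w≢u wu with w ≟ v | u ≟ v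
      ... | yes refl | yes refl = ⊥-elim (w≢u refl)
      ... | yes refl | no u≢v = inj₂ (inj₁ refl , inj₂ (v-row u≢v wu))
      ... | no w≢v | yes refl = inj₂ (inj₂ (v-row w≢v (sy x wu)) , inj₁ refl)
      ... | no w≢v | no u≢v = inj₁ (off-v w≢v u≢v w≢u wu , off-v u≢v w≢v (≢-sym w≢u) (sy x wu))

  -- Two distinct edges inside a triple or a double already generate it, so x is the finest
  -- partition that joins both pairs. Applied in both directions, this gives uniqueness.
  outer-minimal : ∀ {x q r a b c d} → Outer A D x → A x q → A x r → q ≢ r → IsPair q a b → IsPair r c d →
    ∀ y → ⟦ y ⟧ a b ≡ true → ⟦ y ⟧ c d ≡ true → ∀ {w u} → ⟦ x ⟧ w u ≡ true → ⟦ y ⟧ w u ≡ true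
  outer-minimal {x} {q} {r} {a} {b} {c} {d} ox xq xr q≢r Q R y yab ycd {w} {u} wu with w ≟ u
  ... | yes refl = rfl y w
  ... | no w≢u with outer-form ox xq Q | proj₁ (outer-form ox xr R)
  ... | _ , v , a≢v , b≢v , inj₁ (_ , only) | xcd =
        tr y (toa (only w≢u wu)) (sy y (toa (only (≢-sym w≢u) (sy x wu))))
    where
    ab⇒ : ∀ {w} → w ≡ a ⊎ w ≡ b → ⟦ y ⟧ w a ≡ true
    ab⇒ (inj₁ refl) = rfl y a
    ab⇒ (inj₂ refl) = sy y yab
    v⇒ : ⟦ y ⟧ v a ≡ true
    v⇒ with only (proj₁ R) xcd | only (≢-sym (proj₁ R)) (sy x xcd)
    ... | inj₁ refl | inj₁ refl = ⊥-elim (proj₁ R refl)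
    ... | inj₁ refl | inj₂ m = tr y ycd (ab⇒ m)
    ... | inj₂ m | inj₁ refl = tr y (sy y ycd) (ab⇒ m)
    ... | inj₂ m | inj₂ m′ = ⊥-elim (q≢r (pair-unique′ Q R m m′))
    toa : ∀ {w} → w ≡ v ⊎ (w ≡ a ⊎ w ≡ b) → ⟦ y ⟧ w a ≡ true
    toa (inj₁ refl) = v⇒
    toa (inj₂ m)    = ab⇒ m
  ... | _ , v , a≢v , b≢v , inj₂ (z , _ , _ , _ , only) | xcd with only w≢u wu
  ...   | inj₁ (inj₁ refl , inj₂ refl) = yab
  ...   | inj₁ (inj₂ refl , inj₁ refl) = sy y yab
  ...   | inj₁ (inj₁ refl , inj₁ refl) = rfl y w
  ...   | inj₁ (inj₂ refl , inj₂ refl) = rfl y w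
  ...   | inj₂ (m , m′) = tr y (tov m) (sy y (tov m′))
    where
    vz : ⟦ y ⟧ z v ≡ true
    vz with only (proj₁ R) xcd
    ... | inj₁ (m , m′) = ⊥-elim (q≢r (pair-unique′ Q R m m′))
    ... | inj₂ (inj₁ refl , inj₂ refl) = sy y ycd
    ... | inj₂ (inj₂ refl , inj₁ refl) = ycd
    ... | inj₂ (inj₁ refl , inj₁ refl) = ⊥-elim (proj₁ R refl)
    ... | inj₂ (inj₂ refl , inj₂ refl) = ⊥-elim (proj₁ R refl)
    tov : ∀ {w} → w ≡ v ⊎ w ≡ z → ⟦ y ⟧ w v ≡ true
    tov (inj₁ refl) = rfl y v
    tov (inj₂ refl) = vz

  pair-Off : ∀ {r x c d e} → IsPair r c d → ⟦ x ⟧ c d ≡ true →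
    (∀ {w u} → w ≢ e → u ≢ e → w ≢ u → ⟦ x ⟧ w u ≡ true → (w ≡ c ⊎ w ≡ d) × (u ≡ c ⊎ u ≡ d)) → Off e x r
  pair-Off {r} {x} {c} {d} {e} R xcd only w u w≢e u≢e with w ≟ u
  ... | yes refl = trans (rfl x w) (sym (rfl r w))
  ... | no w≢u = bool-≡ fwd bwd
    where
    fwd : ⟦ x ⟧ w u ≡ true → ⟦ r ⟧ w u ≡ true
    fwd wu with only w≢e u≢e w≢u wu
    ... | inj₁ refl , inj₁ refl = rfl r w
    ... | inj₂ refl , inj₂ refl = rfl r w
    ... | inj₁ refl , inj₂ refl = proj₂ (proj₂ R)
    ... | inj₂ refl , inj₁ refl = sy r (proj₂ (proj₂ R))
    bwd : ⟦ r ⟧ w u ≡ true → ⟦ x ⟧ w u ≡ true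
    bwd wu with pair-only R w≢u wu
    ... | inj₁ (refl , refl) = xcd
    ... | inj₂ (refl , refl) = sy x xcd

  either : ∀ {X Y : Set} → ¬ X → ¬ Y → ¬ (X ⊎ Y)
  either f g (inj₁ x) = f x
  either f g (inj₂ y) = g y

  -- All four properties are read off from `outer-form`. Two disjoint edges span a double. A triple
  -- contains three edges and a double two, so there is always a second one. The edges in a triple
  -- pairwise meet and those in a double are disjoint, so adjacent and nonadjacent pairs never occur
  -- together below one x.
  D-local : Local A D
  D-local = record { outer-exists = exists ; outer-unique = unique ; outer-second = second ; outer-clique = outclq }
    where
    exists : ∀ {q r} → A D q → A D r → q ≢ r → ¬ A q r → ∃ λ x → Outer A D x × A x q × A x r
    exists {q} {r} aq ar q≢r ¬qr with A⇒pair aq | A⇒pair ar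
    ... | a , b , Q@(a≢b , oq , ab) | c , d , R@(c≢d , or , cd) with ¬A⇒disjoint Q R q≢r ¬qr
    ... | (a≢c , a≢d) , (b≢c , b≢d) with attach-≥-2 k+2≤n q c d (≢-sym c≢d) cl a sep
      where
      cl : ∀ z → z ≢ c → ⟦ q ⟧ d z ≡ true → adj G c z ≡ false
      cl z _ dz with d ≟ z
      ... | yes refl = clique r cd
      ... | no d≢z   = ⊥-elim (either (≢-sym a≢d) (≢-sym b≢d) (pair-mem Q d≢z dz))
      sep : ∀ x y → x ≢ c → x ≢ a → y ≢ c → y ≢ a → x ≢ y → ⟦ q ⟧ x y ≡ false
      sep x y _ x≢a _ y≢a x≢y = trans (sym (oq x y x≢a y≢a)) (D-single x y (≢-sym x≢y))
    ... | x , o , xcd = x , (≢-sym (Differ⇒≢ Dab) , λ e → hit-disjoint (proj₂ (A⇒Off e)) Dab Dcd a≢c a≢d b≢c b≢d)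
        , Off⇒A (Differ⇒≢ (t≢f xcd qcd)) (Off-sym o)
        , Off⇒A (Differ⇒≢ (t≢f xab rab)) (Off-sym (Off-square oq or o row))
      where
      xab : ⟦ x ⟧ a b ≡ true
      xab = trans (sym (o a b a≢c b≢c)) ab
      Dab : Differ D x a b
      Dab = f≢t (D-single a b (≢-sym a≢b)) xab
      Dcd : Differ D x c d
      Dcd = f≢t (D-single c d (≢-sym c≢d)) xcd
      qcd : ⟦ q ⟧ c d ≡ false
      qcd = disjoint⇒differ R Q ((≢-sym a≢c , ≢-sym b≢c) , (≢-sym a≢d , ≢-sym b≢d))
      rab : ⟦ r ⟧ a b ≡ false
      rab = disjoint⇒differ Q R ((a≢c , a≢d) , (b≢c , b≢d))
      row : ∀ w → w ≢ a → w ≢ c → ⟦ r ⟧ c w ≡ ⟦ x ⟧ c w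
      row w w≢a w≢c = trans (attach-row or cd (≢-sym c≢d) w w≢c)
        (trans (oq d w (≢-sym a≢d) w≢a) (sym (attach-row o xcd (≢-sym c≢d) w w≢c)))
    unique : ∀ {q r x y} → A D q → A D r → q ≢ r → Outer A D x → A x q → A x r → Outer A D y → A y q → A y r → x ≡ y
    unique {x = x} {y} aq ar q≢r ox xq xr oy yq yr with A⇒pair aq | A⇒pair ar
    ... | a , b , Q | c , d , R = ext (λ w u → bool-≡
      (outer-minimal ox xq xr q≢r Q R y (proj₁ (outer-form oy yq Q)) (proj₁ (outer-form oy yr R)))
      (outer-minimal oy yq yr q≢r Q R x (proj₁ (outer-form ox xq Q)) (proj₁ (outer-form ox xr R))))
    second : ∀ {q x} → A D q → Outer A D x → A x q → ∃ λ r → r ≢ q × A D r × A x r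
    second {q} {x} aq ox xq with A⇒pair aq
    ... | a , b , Q with outer-form ox xq Q
    ... | xab , v , a≢v , b≢v , inj₁ (av , only) with pair a v (same⇒H x a≢v av)
    ... | r , R = r , Differ⇒≢ (t≢f (proj₂ (proj₂ R)) (Boolₚ.¬-not (λ e → b≢v (sym (pair-row Q (≢-sym a≢v) e)))))
        , pair⇒A R , Off⇒A (λ { refl → proj₂ ox (pair⇒A R) }) (pair-Off {e = b} R av only′)
      where
      swap : ∀ {w} → w ≢ b → w ≡ v ⊎ (w ≡ a ⊎ w ≡ b) → w ≡ a ⊎ w ≡ v
      swap _ (inj₁ e) = inj₂ e
      swap _ (inj₂ (inj₁ e)) = inj₁ e
      swap n (inj₂ (inj₂ e)) = ⊥-elim (n e)
      only′ : ∀ {w u} → w ≢ b → u ≢ b → w ≢ u → ⟦ x ⟧ w u ≡ true → (w ≡ a ⊎ w ≡ v) × (u ≡ a ⊎ u ≡ v)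
      only′ w≢b u≢b w≢u wu = swap w≢b (only w≢u wu) , swap u≢b (only (≢-sym w≢u) (sy x wu))
    second {q} {x} aq ox xq | a , b , Q | xab , v , a≢v , b≢v , inj₂ (z , vz , v≢z , ((_ , a≢z) , (_ , b≢z)) , only)
      with pair v z (same⇒H x v≢z vz)
    ... | r , R = r , Differ⇒≢ (t≢f (proj₂ (proj₂ R)) (Boolₚ.¬-not (λ e → either (≢-sym a≢v) (≢-sym b≢v) (pair-mem Q v≢z e))))
        , pair⇒A R , Off⇒A (λ { refl → proj₂ ox (pair⇒A R) }) (pair-Off {e = a} R vz only′)
      where
      only′ : ∀ {w u} → w ≢ a → u ≢ a → w ≢ u → ⟦ x ⟧ w u ≡ true → (w ≡ v ⊎ w ≡ z) × (u ≡ v ⊎ u ≡ z)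
      only′ w≢a u≢a w≢u wu with only w≢u wu
      ... | inj₂ m = m
      ... | inj₁ (inj₁ e , _) = ⊥-elim (w≢a e)
      ... | inj₁ (_ , inj₁ e) = ⊥-elim (u≢a e)
      ... | inj₁ (inj₂ refl , inj₂ refl) = ⊥-elim (w≢u refl)
    outclq : ∀ {q r s x} → A D q → A D r → A D s → Outer A D x → A x q → A x r → A x s → A q r → s ≢ r → ¬ A s r → ⊥
    outclq {q} {r} {s} {x} aq ar as ox xq xr xs qr s≢r ¬sr with A⇒pair aq | A⇒pair ar | A⇒pair as
    ... | a , b , Q | c , d , R | e , f , S with ¬A⇒disjoint S R s≢r ¬sr | outer-form ox xr R
    ... | (e≢c , e≢d) , (f≢c , f≢d) | _ , v , _ , _ , inj₁ (_ , only) =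
      proj₁ S (trans (at e≢c e≢d (only (proj₁ S) xef)) (sym (at f≢c f≢d (only (≢-sym (proj₁ S)) (sy x xef)))))
      where
      xef = proj₁ (outer-form ox xs S)
      at : ∀ {w} → w ≢ c → w ≢ d → w ≡ v ⊎ (w ≡ c ⊎ w ≡ d) → w ≡ v
      at _ _ (inj₁ e) = e
      at m n (inj₂ e) = ⊥-elim (either m n e)
    ... | _ | _ , v , _ , _ , inj₂ (z , _ , _ , ((c≢v , c≢z) , (d≢v , d≢z)) , only)
      with only (proj₁ Q) (proj₁ (outer-form ox xq Q))
    ...   | inj₁ (m , m′) = A⇒≢ qr (sym (pair-unique′ R Q m m′))
    ...   | inj₂ (m , m′) = A⇒¬disjoint Q R qr ((away c≢v c≢z m , away d≢v d≢z m) , (away c≢v c≢z m′ , away d≢v d≢z m′))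
      where
      away : ∀ {w y} → y ≢ v → y ≢ z → w ≡ v ⊎ w ≡ z → w ≢ y
      away yv yz (inj₁ refl) = ≢-sym yv
      away yv yz (inj₂ refl) = ≢-sym yz

  -- The witness has {a, b, c} as its only nontrivial part; splitting off one of the three vertices
  -- leaves the opposite edge.
  triangle-outer : ∀ {q r s a b c} → IsPair q a b → IsPair r a c → IsPair s b c →
    ∃ λ x → Outer A D x × A x q × A x r × A x s
  triangle-outer {q} {r} {s} {a} {b} {c} Q@(a≢b , oq , qab) R@(a≢c , or , rac) S@(b≢c , os , sbc)
    with attach-≥-2 k+2≤n q c a a≢c cl b sep
    where
    cl : ∀ z → z ≢ c → ⟦ q ⟧ a z ≡ true → adj G c z ≡ false
    cl z z≢c az with z ≟ a
    ... | yes refl = clique r (sy r rac)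
    ... | no z≢a with pair-row Q z≢a az
    ... | refl = clique s (sy s sbc)
    sep : ∀ x y → x ≢ c → x ≢ b → y ≢ c → y ≢ b → x ≢ y → ⟦ q ⟧ x y ≡ false
    sep x y _ x≢b _ y≢b x≢y = trans (sym (proj₁ (proj₂ (IsPair-sym Q)) x y x≢b y≢b)) (D-single x y (≢-sym x≢y))
  ... | x , o , xca = x , (≢-sym (Differ⇒≢ Dab) , λ e → hit-triangle (proj₂ (A⇒Off e)) Dab Dac Dbc a≢b a≢c b≢c)
      , Off⇒A (Differ⇒≢ (t≢f xca qca)) (Off-sym o)
      , Off⇒A (Differ⇒≢ (t≢f xab (Boolₚ.¬-not (λ e → b≢c (pair-row R (≢-sym a≢b) e)))))
          (pair-Off {e = b} R (sy x xca) (λ w≢b u≢b w≢u wu → ac w≢b (only w≢u wu) , ac u≢b (only (≢-sym w≢u) (sy x wu))))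
      , Off⇒A (Differ⇒≢ (t≢f xab (Boolₚ.¬-not (λ e → a≢c (pair-row S a≢b (sy s e))))))
          (pair-Off {e = a} S xbc (λ w≢a u≢a w≢u wu → bc w≢a (only w≢u wu) , bc u≢a (only (≢-sym w≢u) (sy x wu))))
    where
    xab : ⟦ x ⟧ a b ≡ true
    xab = trans (sym (o a b a≢c b≢c)) qab
    xbc : ⟦ x ⟧ b c ≡ true
    xbc = tr x (sy x xab) (sy x xca)
    qca : ⟦ q ⟧ c a ≡ false
    qca = Boolₚ.¬-not (λ e → either (≢-sym a≢c) (≢-sym b≢c) (pair-mem Q (≢-sym a≢c) e))
    Dab : Differ D x a b
    Dab = f≢t (D-single a b (≢-sym a≢b)) xab
    Dac : Differ D x a c
    Dac = f≢t (D-single a c (≢-sym a≢c)) (sy x xca)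
    Dbc : Differ D x b c
    Dbc = f≢t (D-single b c (≢-sym b≢c)) xbc
    only : ∀ {w u} → w ≢ u → ⟦ x ⟧ w u ≡ true → w ≡ a ⊎ (w ≡ b ⊎ w ≡ c)
    only {w} {u} w≢u wu with w ≟ c | u ≟ c | w ≟ a
    ... | yes e | _ | _ = inj₂ (inj₂ e)
    ... | _ | _ | yes e = inj₁ e
    ... | no w≢c | yes refl | no w≢a =
      inj₂ (inj₁ (pair-row Q w≢a (trans (sym (attach-row o xca a≢c w w≢c)) (sy x wu))))
    ... | no w≢c | no u≢c | no _ with pair-mem Q w≢u (trans (o w u w≢c u≢c) wu)
    ...   | inj₁ e = inj₁ e
    ...   | inj₂ e = inj₂ (inj₁ e)
    ac : ∀ {w} → w ≢ b → w ≡ a ⊎ (w ≡ b ⊎ w ≡ c) → w ≡ a ⊎ w ≡ c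
    ac _   (inj₁ e)        = inj₁ e
    ac w≢b (inj₂ (inj₁ e)) = ⊥-elim (w≢b e)
    ac _   (inj₂ (inj₂ e)) = inj₂ e
    bc : ∀ {w} → w ≢ a → w ≡ a ⊎ (w ≡ b ⊎ w ≡ c) → w ≡ b ⊎ w ≡ c
    bc w≢a (inj₁ e) = ⊥-elim (w≢a e)
    bc _   (inj₂ m) = m

-- Vertices that look locally like the discrete partition

module Moves {n} (G : Graph n) (k : ℕ) where
  open Bell G k
  open Basics G k

  isolate-⊆ : ∀ {p q d} → Off d p q → Single q d → ∀ {x y} → ⟦ q ⟧ x y ≡ true → ⟦ p ⟧ x y ≡ true
  isolate-⊆ {p} {q} {d} o s {x} {y} e with x ≟ d | y ≟ d
  ... | yes refl | yes refl = rfl p x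
  ... | yes refl | no b     = ⊥-elim (true≢false e (s y b))
  ... | no a     | yes refl = ⊥-elim (true≢false (sy q e) (s x a))
  ... | no a     | no b     = trans (o x y a b) e

  redirect-same : ∀ p {d t} → ⟦ p ⟧ d t ≡ true → ∀ x → ⟦ p ⟧ x (redirect d t x) ≡ true
  redirect-same p {d} {t} dt x with x ≟ d
  ... | yes refl = trans (cong (⟦ p ⟧ x) (redirect-at x t)) dt
  ... | no x≢d   = trans (cong (⟦ p ⟧ x) (redirect-off d t x≢d)) (rfl p x)

  -- Two moves lead from q to r through z, so {u, w} covers every pair on which q and r differ. The
  -- arguments below list the possible covers.
  hit₂ : ∀ {u w q r z x y} → Off u z q → Off w z r → Differ q r x y → (u ≡ x ⊎ u ≡ y) ⊎ (w ≡ x ⊎ w ≡ y)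
  hit₂ {u} {w} {x = x} {y} o o′ d with u ≟ x | u ≟ y | w ≟ x | w ≟ y
  ... | yes e | _ | _ | _ = inj₁ (inj₁ e)
  ... | _ | yes e | _ | _ = inj₁ (inj₂ e)
  ... | _ | _ | yes e | _ = inj₂ (inj₁ e)
  ... | _ | _ | _ | yes e = inj₂ (inj₂ e)
  ... | no a | no b | no c | no e = ⊥-elim (d (trans (sym (o x y (≢-sym a) (≢-sym b))) (o′ x y (≢-sym c) (≢-sym e))))

  Off-outer : ∀ {v p x} → Outer A p x → Off v p x → ⊥
  Off-outer (x≢p , ¬a) o = ¬a (Off⇒A (≢-sym x≢p) o)

-- Large parts and edges between nontrivial parts

module Crossing {n} (G : Graph n) (k : ℕ) (p : Bell.V G k) (L : Local (Bell.A G k) p) where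
  open Bell G k
  open Basics G k
  open Moves G k
  open Local L

  outer-disjoint : ∀ {x a b c d} → Differ p x a b → Differ p x c d →
    a ≢ c → a ≢ d → b ≢ c → b ≢ d → Outer A p x
  outer-disjoint d e ac ad bc bd = ≢-sym (Differ⇒≢ d) , λ a → hit-disjoint (proj₂ (A⇒Off a)) d e ac ad bc bd

  outer-triangle : ∀ {x a b c} → Differ p x a b → Differ p x a c → Differ p x b c →
    a ≢ b → a ≢ c → b ≢ c → Outer A p x
  outer-triangle d e f ab ac bc = ≢-sym (Differ⇒≢ d) , λ a → hit-triangle (proj₂ (A⇒Off a)) d e f ab ac bc

  single? : ∀ a → Single p a ⊎ ∃ λ b → b ≢ a × ⟦ p ⟧ a b ≡ true
  single? a with Finₚ.any? (λ b → ¬? (b ≟ a) ×-dec (⟦ p ⟧ a b Boolₚ.≟ true))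
  ... | yes e = inj₂ e
  ... | no ¬e = inj₁ (λ y y≢a → Boolₚ.¬-not (λ t → ¬e (y , y≢a , t)))

  single≢ : ∀ {a d e} → Single p a → e ≢ d → ⟦ p ⟧ d e ≡ true → a ≢ d
  single≢ s e≢d de refl = true≢false de (s _ e≢d)

  -- Let `T₁` and `T₂` split off d and f. Splitting off both as singletons, or both as one new part
  -- {d, f}, gives two different common outer neighbours of `T₁` and `T₂`, against `outer-unique`.
  -- The two pairs may lie in the same part of p, as in `no-four`.
  crossing : ∀ {d e f g} → ⟦ p ⟧ d e ≡ true → ⟦ p ⟧ f g ≡ true → d ≢ e → f ≢ g → d ≢ g → e ≢ f → e ≢ g → H d f → ⊥
  crossing {d} {e} {f} {g} de fg d≢e f≢g d≢g e≢f e≢g (d≢f , df)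
    with isolate p d | isolate p f
  ... | T₁ , o₁ , s₁ | T₂ , o₂ , s₂ with isolate T₁ f | attach T₁ f d d≢f cl p h h≢f sep
    where
    cl : ∀ z → z ≢ f → ⟦ T₁ ⟧ d z ≡ true → adj G f z ≡ false
    cl z _ dz with z ≟ d
    ... | yes refl = trans (Graph.sym G f d) df
    ... | no z≢d   = ⊥-elim (true≢false dz (s₁ z z≢d))
    -- The vertices e and g stand in for d and f, so every part of p keeps a representative outside
    -- {d, f}. Hence making {d, f} a part loses no parts.
    h : Fin n → Fin n
    h x = redirect f g (redirect d e x)
    hd : h d ≡ e
    hd = trans (cong (redirect f g) (redirect-at d e)) (redirect-off f g e≢f)
    hf : h f ≡ g
    hf = trans (cong (redirect f g) (redirect-off d e (≢-sym d≢f))) (redirect-at f g)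
    hx : ∀ {x} → x ≢ d → x ≢ f → h x ≡ x
    hx a b = trans (cong (redirect f g) (redirect-off d e a)) (redirect-off f g b)
    h-props : ∀ x → (h x ≢ f × h x ≢ d) × ⟦ p ⟧ x (h x) ≡ true
    h-props x with x ≟ d | x ≟ f
    ... | yes refl | _ rewrite hd = (e≢f , ≢-sym d≢e) , de
    ... | no _ | yes refl rewrite hf = (≢-sym f≢g , ≢-sym d≢g) , fg
    ... | no a | no b rewrite hx a b = (b , a) , rfl p x
    h≢f : ∀ x → h x ≢ f
    h≢f x = proj₁ (proj₁ (h-props x))
    sep : ∀ x y → ⟦ p ⟧ x y ≡ false → ⟦ T₁ ⟧ (h x) (h y) ≡ false
    sep x y xy with h-props x | h-props y
    ... | (_ , a) , xx | (_ , b) , yy = trans (sym (o₁ _ _ a b))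
      (Boolₚ.¬-not (λ t → true≢false (tr p (tr p xx t) (sy p yy)) xy))
  ... | X , oX , sX | Y , oY , fdY =
    true≢false (trans (cong (λ Z → ⟦ Z ⟧ f d) X≡Y) fdY) (sX d d≢f)
    where
    Xde : ⟦ X ⟧ d e ≡ false
    Xde = trans (sym (oX d e d≢f e≢f)) (s₁ e (≢-sym d≢e))
    Yfe : ⟦ Y ⟧ f e ≡ false
    Yfe = trans (attach-row oY fdY d≢f e e≢f) (s₁ e (≢-sym d≢e))
    Yde : ⟦ Y ⟧ d e ≡ false
    Yde = trans (sym (tr≡ Y e fdY)) Yfe
    Yfg : ⟦ Y ⟧ f g ≡ false
    Yfg = trans (attach-row oY fdY d≢f g (≢-sym f≢g)) (s₁ g (≢-sym d≢g))
    T₁fg : ⟦ T₁ ⟧ f g ≡ true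
    T₁fg = trans (sym (o₁ f g (≢-sym d≢f) (≢-sym d≢g))) fg
    T₂de : ⟦ T₂ ⟧ d e ≡ true
    T₂de = trans (sym (o₂ d e d≢f e≢f)) de
    rowX : ∀ w → w ≢ d → w ≢ f → ⟦ T₂ ⟧ f w ≡ ⟦ X ⟧ f w
    rowX w _ w≢f = trans (s₂ w w≢f) (sym (sX w w≢f))
    rowY : ∀ w → w ≢ d → w ≢ f → ⟦ T₂ ⟧ f w ≡ ⟦ Y ⟧ f w
    rowY w w≢d w≢f = trans (s₂ w w≢f) (sym (trans (attach-row oY fdY d≢f w w≢f) (s₁ w w≢d)))
    X≡Y : X ≡ Y
    X≡Y = outer-unique
      (Off⇒A (Differ⇒≢ (t≢f de (s₁ e (≢-sym d≢e)))) o₁)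
      (Off⇒A (Differ⇒≢ (t≢f fg (s₂ g (≢-sym f≢g)))) o₂)
      (Differ⇒≢ (f≢t (s₁ e (≢-sym d≢e)) T₂de))
      (outer-disjoint (t≢f de Xde) (t≢f fg (sX g (≢-sym f≢g))) d≢f d≢g e≢f e≢g)
      (Off⇒A (Differ⇒≢ (f≢t (sX g (≢-sym f≢g)) T₁fg)) (Off-sym oX))
      (Off⇒A (Differ⇒≢ (f≢t Xde T₂de)) (Off-sym (Off-square o₁ o₂ oX rowX)))
      (outer-disjoint (t≢f de Yde) (t≢f fg Yfg) d≢f d≢g e≢f e≢g)
      (Off⇒A (Differ⇒≢ (f≢t Yfg T₁fg)) (Off-sym oY))
      (Off⇒A (Differ⇒≢ (f≢t Yde T₂de)) (Off-sym (Off-square o₁ o₂ oY rowY)))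

  no-four : ∀ {a b c d} → ⟦ p ⟧ a b ≡ true → ⟦ p ⟧ a c ≡ true → ⟦ p ⟧ a d ≡ true →
    a ≢ b → a ≢ c → a ≢ d → b ≢ c → b ≢ d → c ≢ d → ⊥
  no-four ab ac ad a≢b a≢c a≢d b≢c b≢d c≢d =
    crossing ab (tr p (sy p ac) ad) a≢b c≢d a≢d b≢c b≢d (same⇒H p a≢c ac)

  -- Let q and r split off b and c. After breaking up {a, b, c}, the vertex a may be left alone or
  -- put with t; both results are common outer neighbours of q and r, against `outer-unique`.
  triple-closed : ∀ {a b c t} → ⟦ p ⟧ a b ≡ true → ⟦ p ⟧ a c ≡ true → a ≢ b → a ≢ c → b ≢ c →
    Single p t → H a t → ⊥
  triple-closed {a} {b} {c} {t} ab ac a≢b a≢c b≢c st (a≢t , at)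
    with isolate p b | isolate p c
  ... | q , oq , sq | r , or , sr with isolate q a | attach q a t (≢-sym a≢t) cl p h h≢a sep
    where
    cl : ∀ z → z ≢ a → ⟦ q ⟧ t z ≡ true → adj G a z ≡ false
    cl z _ tz with z ≟ t
    ... | yes refl = at
    ... | no z≢t   = ⊥-elim (true≢false (isolate-⊆ oq sq tz) (st z z≢t))
    h : Fin n → Fin n
    h = redirect a c
    h≢a : ∀ x → h x ≢ a
    h≢a = redirect-≢ a c (≢-sym a≢c)
    h-same : ∀ x → ⟦ p ⟧ x (h x) ≡ true
    h-same = redirect-same p ac
    sep : ∀ x y → ⟦ p ⟧ x y ≡ false → ⟦ q ⟧ (h x) (h y) ≡ false
    sep x y xy = Boolₚ.¬-not (λ e → true≢false (tr p (tr p (h-same x) (isolate-⊆ oq sq e)) (sy p (h-same y))) xy)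
  ... | z , oz , sz | y , oy , yat =
    true≢false (trans (cong (λ Z → ⟦ Z ⟧ a t) z≡y) yat) (sz t (≢-sym a≢t))
    where
    t≢b : t ≢ b
    t≢b = single≢ st a≢b (sy p ab)
    t≢c : t ≢ c
    t≢c = single≢ st a≢c (sy p ac)
    bc : ⟦ p ⟧ b c ≡ true
    bc = tr p (sy p ab) ac
    row-b : ∀ w → w ≢ a → w ≢ b → ⟦ q ⟧ b w ≡ ⟦ r ⟧ b w
    row-b w w≢a w≢b = trans (sq w w≢b) (sym (Boolₚ.¬-not go))
      where
      go : ⟦ r ⟧ b w ≡ true → ⊥
      go e with w ≟ c
      ... | yes refl = true≢false (sy r e) (sr b b≢c)
      ... | no w≢c   = no-four ab ac (tr p ab (isolate-⊆ or sr e)) a≢b a≢c (≢-sym w≢a) b≢c (≢-sym w≢b) (≢-sym w≢c)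
    row-c : ∀ w → w ≢ a → w ≢ c → ⟦ q ⟧ c w ≡ ⟦ r ⟧ c w
    row-c w w≢a w≢c = trans (Boolₚ.¬-not go) (sym (sr w w≢c))
      where
      go : ⟦ q ⟧ c w ≡ true → ⊥
      go e with w ≟ b
      ... | yes refl = true≢false (sy q e) (sq c (≢-sym b≢c))
      ... | no w≢b   = no-four ab ac (tr p ac (isolate-⊆ oq sq e)) a≢b a≢c (≢-sym w≢a) b≢c (≢-sym w≢b) (≢-sym w≢c)
    qr : Off a q r
    qr u w u≢a w≢a = go (u ≟ b) (w ≟ b) (u ≟ c) (w ≟ c)
      where
      go : Dec (u ≡ b) → Dec (w ≡ b) → Dec (u ≡ c) → Dec (w ≡ c) → ⟦ q ⟧ u w ≡ ⟦ r ⟧ u w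
      go (yes refl) (yes refl) _ _ = trans (rfl q u) (sym (rfl r u))
      go (yes refl) (no w≢b) _ _ = row-b w w≢a w≢b
      go (no u≢b) (yes refl) _ _ = trans (sy≡ q u w) (trans (row-b u u≢a u≢b) (sy≡ r w u))
      go _ _ (yes refl) (yes refl) = trans (rfl q u) (sym (rfl r u))
      go _ _ (yes refl) (no w≢c) = row-c w w≢a w≢c
      go _ _ (no u≢c) (yes refl) = trans (sy≡ q u w) (trans (row-c u u≢a u≢c) (sy≡ r w u))
      go (no u≢b) (no w≢b) (no u≢c) (no w≢c) = trans (sym (oq u w u≢b w≢b)) (or u w u≢c w≢c)
    qbc : ⟦ q ⟧ b c ≡ false
    qbc = sq c (≢-sym b≢c)
    rab : ⟦ r ⟧ a b ≡ true
    rab = trans (sym (or a b a≢c b≢c)) ab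
    qab : ⟦ q ⟧ a b ≡ false
    qab = Single-sym sq a≢b
    yab : ⟦ y ⟧ a b ≡ false
    yab = trans (attach-row oy yat (≢-sym a≢t) b (≢-sym a≢b)) (Single-sym sq t≢b)
    yac : ⟦ y ⟧ a c ≡ false
    yac = trans (attach-row oy yat (≢-sym a≢t) c (≢-sym a≢c)) (trans (sym (oq t c t≢b (≢-sym b≢c))) (st c (≢-sym t≢c)))
    qat : ⟦ q ⟧ a t ≡ false
    qat = trans (sym (oq a t a≢b t≢b)) (Single-sym st a≢t)
    z≡y : z ≡ y
    z≡y = outer-unique
      (Off⇒A (Differ⇒≢ (t≢f ab qab)) oq)
      (Off⇒A (Differ⇒≢ (t≢f ac (Single-sym sr a≢c))) or)
      (Differ⇒≢ (f≢t qab rab))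
      (outer-triangle (t≢f ab (sz b (≢-sym a≢b))) (t≢f ac (sz c (≢-sym a≢c)))
        (t≢f bc (trans (sym (oz b c (≢-sym a≢b) (≢-sym a≢c))) qbc)) a≢b a≢c b≢c)
      (Off⇒A (Differ⇒≢ (f≢t (sz c (≢-sym a≢c)) (trans (sym (oq a c a≢b (≢-sym b≢c))) ac))) (Off-sym oz))
      (Off⇒A (Differ⇒≢ (f≢t (sz b (≢-sym a≢b)) rab)) (Off-trans (Off-sym oz) qr))
      (outer-triangle (t≢f ab yab) (t≢f ac yac)
        (t≢f bc (trans (sym (oy b c (≢-sym a≢b) (≢-sym a≢c))) qbc)) a≢b a≢c b≢c)
      (Off⇒A (Differ⇒≢ (t≢f yat qat)) (Off-sym oy))
      (Off⇒A (Differ⇒≢ (f≢t yab rab)) (Off-trans (Off-sym oy) qr))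

-- Merging singletons near p

module Merging {n} (G : Graph n) (k : ℕ) (k+2≤n : k + 2 ≤ n) (p : Bell.V G k) (L : Local (Bell.A G k) p) where
  open Bell G k
  open Basics G k
  open Moves G k
  open Crossing G k p L
  open Local L

  Only : Fin n → Fin n → Set
  Only a b = ∀ {z} → ⟦ p ⟧ a z ≡ true → z ≡ a ⊎ z ≡ b

  -- Let q move v onto s. Then q and r are nonadjacent, so `outer-exists` gives z between them, and
  -- the two moves through z must cover the pairs vc, vs, xx′ and xs. Covers moving v next to q, or
  -- x next to r, put z within one move of p.
  no-transfer : ∀ {v c s x x′ r} → ⟦ p ⟧ v c ≡ true → v ≢ c → Single p s → H v s →
    ⟦ p ⟧ x x′ ≡ true → x ≢ x′ → ⟦ p ⟧ x v ≡ false → Off x p r → ⟦ r ⟧ x s ≡ true → ⊥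
  no-transfer {v} {c} {s} {x} {x′} {r} vc v≢c ss (v≢s , vs) xx′ x≢x′ xv or xs
    with attach p v s (≢-sym v≢s) cl p (redirect v c) (redirect-≢ v c (≢-sym v≢c)) sep
    where
    cl : ∀ z → z ≢ v → ⟦ p ⟧ s z ≡ true → adj G v z ≡ false
    cl z _ sz with z ≟ s
    ... | yes refl = vs
    ... | no z≢s   = ⊥-elim (true≢false sz (ss z z≢s))
    sep : ∀ x y → ⟦ p ⟧ x y ≡ false → ⟦ p ⟧ (redirect v c x) (redirect v c y) ≡ false
    sep x y xy = Boolₚ.¬-not (λ e → true≢false (tr p (tr p (redirect-same p vc x) e) (sy p (redirect-same p vc y))) xy)
  ... | q , oq , qvs = conclude (outer-exists
      (Off⇒A (Differ⇒≢ (t≢f vc qvc)) oq)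
      (Off⇒A (Differ⇒≢ (t≢f xx′ rxx′)) or)
      (Differ⇒≢ D₁) (λ a → hit-disjoint (proj₂ (A⇒Off a)) D₁ D₃ v≢x v≢x′ c≢x c≢x′))
    where
    s≢x : s ≢ x
    s≢x = single≢ ss (≢-sym x≢x′) xx′
    s≢x′ : s ≢ x′
    s≢x′ = single≢ ss x≢x′ (sy p xx′)
    s≢c : s ≢ c
    s≢c = single≢ ss v≢c (sy p vc)
    v≢x : v ≢ x
    v≢x = ≢-sym (irreflexive p xv)
    v≢x′ : v ≢ x′
    v≢x′ refl = true≢false xx′ xv
    c≢x : c ≢ x
    c≢x refl = true≢false (sy p vc) xv
    c≢x′ : c ≢ x′
    c≢x′ refl = true≢false (tr p xx′ (sy p vc)) xv
    qvc : ⟦ q ⟧ v c ≡ false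
    qvc = trans (attach-row oq qvs (≢-sym v≢s) c (≢-sym v≢c)) (ss c (≢-sym s≢c))
    rxx′ : ⟦ r ⟧ x x′ ≡ false
    rxx′ = trans (tr≡ r x′ xs) (trans (sym (or s x′ s≢x (≢-sym x≢x′))) (ss x′ (≢-sym s≢x′)))
    D₁ : Differ q r v c
    D₁ = f≢t qvc (trans (sym (or v c v≢x c≢x)) vc)
    D₂ : Differ q r v s
    D₂ = t≢f qvs (trans (sym (or v s v≢x s≢x)) (Single-sym ss v≢s))
    D₃ : Differ q r x x′
    D₃ = t≢f (trans (sym (oq x x′ (≢-sym v≢x) (≢-sym v≢x′))) xx′) rxx′
    D₄ : Differ q r x s
    D₄ = f≢t (trans (sym (oq x s (≢-sym v≢x) (≢-sym v≢s))) (Single-sym ss (≢-sym s≢x))) xs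
    conclude : (∃ λ z → Outer A p z × A z q × A z r) → ⊥
    conclude (z , oz , zq , zr) with A⇒Off zq | A⇒Off zr
    ... | u , ou | w , ow with hit₂ ou ow D₁ | hit₂ ou ow D₂ | hit₂ ou ow D₃ | hit₂ ou ow D₄
    ... | inj₁ (inj₁ refl) | _ | _ | _ = Off-outer oz (Off-trans oq (Off-sym ou))
    ... | _ | inj₁ (inj₁ refl) | _ | _ = Off-outer oz (Off-trans oq (Off-sym ou))
    ... | _ | _ | inj₂ (inj₁ refl) | _ = Off-outer oz (Off-trans or (Off-sym ow))
    ... | _ | _ | _ | inj₂ (inj₁ refl) = Off-outer oz (Off-trans or (Off-sym ow))
    ... | inj₁ (inj₂ refl) | _ | inj₁ (inj₁ e) | _ = c≢x e
    ... | inj₁ (inj₂ refl) | _ | inj₁ (inj₂ e) | _ = c≢x′ e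
    ... | inj₁ (inj₂ refl) | inj₁ (inj₂ e) | inj₂ (inj₂ _) | _ = s≢c (sym e)
    ... | inj₁ (inj₂ refl) | inj₂ (inj₁ e) | inj₂ (inj₂ f) | _ = v≢x′ (trans (sym e) f)
    ... | inj₁ (inj₂ refl) | inj₂ (inj₂ e) | inj₂ (inj₂ f) | _ = s≢x′ (trans (sym e) f)
    ... | inj₂ (inj₁ refl) | _ | inj₂ (inj₂ e) | _ = v≢x′ e
    ... | inj₂ (inj₂ refl) | _ | inj₂ (inj₂ e) | _ = c≢x′ e
    ... | inj₂ (inj₁ refl) | _ | inj₁ (inj₂ refl) | inj₁ (inj₁ e) = x≢x′ (sym e)
    ... | inj₂ (inj₁ refl) | _ | inj₁ (inj₂ refl) | inj₁ (inj₂ e) = s≢x′ (sym e)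
    ... | inj₂ (inj₁ refl) | _ | inj₁ (inj₂ refl) | inj₂ (inj₂ e) = v≢s e
    ... | inj₂ (inj₂ refl) | inj₁ (inj₂ e) | inj₁ (inj₁ f) | _ = s≢x (trans (sym e) f)
    ... | inj₂ (inj₂ refl) | inj₁ (inj₂ e) | inj₁ (inj₂ f) | _ = s≢x′ (trans (sym e) f)
    ... | inj₂ (inj₂ refl) | inj₂ (inj₁ e) | _ | _ = v≢c (sym e)
    ... | inj₂ (inj₂ refl) | inj₂ (inj₂ e) | _ | _ = s≢c (sym e)
    -- The only surviving cover: z contains both v and x in the part of s, so v and x are joined in
    -- H, which `crossing` forbids.
    ... | inj₂ (inj₁ refl) | _ | inj₁ (inj₁ refl) | _ =
      crossing vc xx′ v≢c x≢x′ v≢x′ c≢x c≢x′ (same⇒H z v≢x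
        (tr z (trans (ou v s v≢x s≢x) qvs) (sy z (trans (ow x s (≢-sym v≢x) (≢-sym v≢s)) xs))))

  -- The merged partition might have fewer than k parts. Then k ≤ n - 2 gives a part other than {v, c}
  -- with two elements d, e. Splitting d off makes room for the merge, at a vertex Y at distance two
  -- from p, and outer-second at Y yields the merged partition or a move excluded by no-transfer.
  merge : ∀ {a v c b} → Single p a → ⟦ p ⟧ v c ≡ true → v ≢ c → Only v c →
    b ≡ v ⊎ (Single p b × H v b) → a ≢ b → (∀ z → z ≢ a → ⟦ p ⟧ b z ≡ true → adj G a z ≡ false) → H v a →
    ∃ λ q → Off a p q × ⟦ q ⟧ a b ≡ true
  merge {a} {v} {c} {b} sa vc v≢c only bv a≢b cl va
    with Finₚ.any? (λ d → Finₚ.any? (λ e → ¬? (d ≟ e) ×-dec ((⟦ p ⟧ d e Boolₚ.≟ true) ×-dec (⟦ p ⟧ d v Boolₚ.≟ false))))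
  -- Every nontrivial part is {v, c}, so the vertices other than a and c are pairwise separated, and
  -- n - 2 parts are guaranteed.
  ... | no none = attach-≥-2 k+2≤n p a b (≢-sym a≢b) cl c sep
    where
    sep : ∀ x y → x ≢ a → x ≢ c → y ≢ a → y ≢ c → x ≢ y → ⟦ p ⟧ x y ≡ false
    sep x y _ x≢c _ y≢c x≢y = Boolₚ.¬-not go
      where
      at : ∀ {z} → z ≢ c → ⟦ p ⟧ z v ≡ true → z ≡ v
      at z≢c zv with only (sy p zv)
      ... | inj₁ e = e
      ... | inj₂ e = ⊥-elim (z≢c e)
      toV : ∀ {z w} → z ≢ w → ⟦ p ⟧ z w ≡ true → ⟦ p ⟧ z v ≡ true
      toV {z} {w} z≢w zw = Boolₚ.¬-not (λ f → none (z , w , z≢w , zw , f))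
      go : ⟦ p ⟧ x y ≡ true → ⊥
      go xy = x≢y (trans (at x≢c (toV x≢y xy)) (sym (at y≢c (toV (≢-sym x≢y) (sy p xy)))))
  ... | yes (d , e , d≢e , de , dv) with isolate p d
  ... | t , ot , st = found (outer-second (Off⇒A (Differ⇒≢ (t≢f de (st e (≢-sym d≢e)))) ot) oY Yt)
    where
    a≢d : a ≢ d
    a≢d = single≢ sa (≢-sym d≢e) de
    a≢e : a ≢ e
    a≢e = single≢ sa d≢e (sy p de)
    a≢c : a ≢ c
    a≢c = single≢ sa v≢c (sy p vc)
    off-de : ∀ {z} → ⟦ p ⟧ v z ≡ true → z ≢ d × z ≢ e
    off-de vz = (λ { refl → true≢false (sy p vz) dv }) , (λ { refl → true≢false (tr p de (sy p vz)) dv })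
    b≢de : b ≢ d × b ≢ e
    b≢de = go bv
      where
      go : b ≡ v ⊎ (Single p b × H v b) → b ≢ d × b ≢ e
      go (inj₁ refl)     = off-de (rfl p v)
      go (inj₂ (sb , _)) = single≢ sb (≢-sym d≢e) de , single≢ sb d≢e (sy p de)
    b≢d : b ≢ d
    b≢d = proj₁ b≢de
    -- The part lost with a is made up for by the new singleton d: d represents the part of a, and e
    -- the old part of d.
    h : Fin n → Fin n
    h x = redirect a d (redirect d e x)
    ha : h a ≡ d
    ha = trans (cong (redirect a d) (redirect-off d e a≢d)) (redirect-at a d)
    hd : h d ≡ e
    hd = trans (cong (redirect a d) (redirect-at d e)) (redirect-off a d (≢-sym a≢e))
    hx : ∀ {x} → x ≢ a → x ≢ d → h x ≡ x
    hx m m′ = trans (cong (redirect a d) (redirect-off d e m′)) (redirect-off a d m)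
    h-props : ∀ x → h x ≢ a × (x ≡ a ⊎ (x ≢ a × h x ≢ d × ⟦ p ⟧ x (h x) ≡ true))
    h-props x with x ≟ a | x ≟ d
    ... | yes refl | _ rewrite ha = ≢-sym a≢d , inj₁ refl
    ... | no m | yes refl rewrite hd = ≢-sym a≢e , inj₂ (m , ≢-sym d≢e , de)
    ... | no m | no m′ rewrite hx m m′ = m , inj₂ (m , m′ , rfl p x)
    sep : ∀ x y → ⟦ p ⟧ x y ≡ false → ⟦ t ⟧ (h x) (h y) ≡ false
    sep x y xy with proj₂ (h-props x) | proj₂ (h-props y)
    ... | inj₁ refl | inj₁ refl = ⊥-elim (irreflexive p xy refl)
    ... | inj₁ refl | inj₂ (_ , m , _) rewrite ha = st (h y) m
    ... | inj₂ (_ , m , _) | inj₁ refl rewrite ha = Single-sym st m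
    ... | inj₂ (_ , m , xx) | inj₂ (_ , m′ , yy) = trans (sym (ot _ _ m m′))
      (Boolₚ.¬-not (λ f → true≢false (tr p (tr p xx f) (sy p yy)) xy))
    attached : ∃ λ Y → Off a t Y × ⟦ Y ⟧ a b ≡ true
    attached = attach t a b (≢-sym a≢b) (λ z z≢a f → cl z z≢a (isolate-⊆ ot st f)) p h (λ x → proj₁ (h-props x)) sep
    Y : V
    Y = proj₁ attached
    offY : Off a t Y
    offY = proj₁ (proj₂ attached)
    Yab : ⟦ Y ⟧ a b ≡ true
    Yab = proj₂ (proj₂ attached)
    Yde : ⟦ Y ⟧ d e ≡ false
    Yde = trans (sym (offY d e (≢-sym a≢d) (≢-sym a≢e))) (st e (≢-sym d≢e))
    Dab : Differ p Y a b
    Dab = f≢t (sa b (≢-sym a≢b)) Yab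
    Dde : Differ p Y d e
    Dde = t≢f de Yde
    oY : Outer A p Y
    oY = outer-disjoint Dab Dde a≢d a≢e b≢d (proj₂ b≢de)
    ta : Single t a
    ta = Single-Off sa ot (Single-sym st a≢d) a≢d
    Yt : A Y t
    Yt = Off⇒A (Differ⇒≢ (t≢f Yab (ta b (≢-sym a≢b)))) (Off-sym offY)
    Yvc : b ≡ v → ⟦ Y ⟧ a c ≡ true
    Yvc refl = trans (attach-row offY Yab (≢-sym a≢b) c (≢-sym a≢c))
      (trans (sym (ot b c b≢d (proj₁ (off-de vc)))) vc)
    pac : ⟦ p ⟧ a c ≡ false
    pac = sa c (≢-sym a≢c)
    found : (∃ λ r → r ≢ t × A p r × A Y r) → ∃ λ q → Off a p q × ⟦ q ⟧ a b ≡ true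
    found (r , r≢t , pr , Yr) with A⇒Off pr | A⇒Off Yr
    ... | w , ow | u , ou = go (hit₂ (Off-sym ow) (Off-sym ou) Dab) (hit₂ (Off-sym ow) (Off-sym ou) Dde) bv
      where
      toY : ∀ {x y} → u ≡ d ⊎ u ≡ e → x ≢ d → x ≢ e → y ≢ d → y ≢ e → ⟦ Y ⟧ x y ≡ ⟦ r ⟧ x y
      toY (inj₁ refl) x≢d _ y≢d _ = ou _ _ x≢d y≢d
      toY (inj₂ refl) _ x≢e _ y≢e = ou _ _ x≢e y≢e
      rab : u ≡ d ⊎ u ≡ e → ⟦ r ⟧ a b ≡ true
      rab m = trans (sym (toY m a≢d a≢e b≢d (proj₂ b≢de))) Yab
      c≢d = proj₁ (off-de vc)
      c≢e = proj₂ (off-de vc)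
      -- Here d or e moves from p to r while s moves from Y to r. If r puts the moved vertex with s,
      -- `no-transfer` applies; otherwise s is alone in both r and t, and r is t again.
      transfer : ∀ {s} → Single p s → H v s → Off s Y r → Off s t Y → Single t s → w ≡ d ⊎ w ≡ e → ⊥
      transfer {s} ss vs oY′ otY sts m with ⟦ r ⟧ w s in ws
      ... | true = moved m
        where
        moved : w ≡ d ⊎ w ≡ e → ⊥
        moved (inj₁ refl) = no-transfer vc v≢c ss vs de d≢e dv ow ws
        moved (inj₂ refl) = no-transfer vc v≢c ss vs (sy p de) (≢-sym d≢e)
          (Boolₚ.¬-not (λ f → true≢false (tr p de f) dv)) ow ws
      ... | false = r≢t (sym (Off-ext (Off-trans otY oY′) (λ y y≢s → trans (sts y y≢s) (sym (rs y y≢s)))))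
        where
        s≢w : w ≡ d ⊎ w ≡ e → s ≢ w
        s≢w (inj₁ refl) = single≢ ss (≢-sym d≢e) de
        s≢w (inj₂ refl) = single≢ ss d≢e (sy p de)
        rs : Single r s
        rs = Single-Off ss ow (trans (sy≡ r s w) ws) (s≢w m)
      go : (w ≡ a ⊎ w ≡ b) ⊎ (u ≡ a ⊎ u ≡ b) → (w ≡ d ⊎ w ≡ e) ⊎ (u ≡ d ⊎ u ≡ e) →
        b ≡ v ⊎ (Single p b × H v b) → ∃ λ q → Off a p q × ⟦ q ⟧ a b ≡ true
      go (inj₁ (inj₁ refl)) (inj₁ (inj₁ m)) _ = ⊥-elim (a≢d m)
      go (inj₁ (inj₁ refl)) (inj₁ (inj₂ m)) _ = ⊥-elim (a≢e m)
      go (inj₁ (inj₂ refl)) (inj₁ (inj₁ m)) _ = ⊥-elim (b≢d m)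
      go (inj₁ (inj₂ refl)) (inj₁ (inj₂ m)) _ = ⊥-elim (proj₂ b≢de m)
      -- Moving a leads from p to r, which joins a and b as Y does: this is the merged partition.
      go (inj₁ (inj₁ refl)) (inj₂ m) _ = r , ow , rab m
      go (inj₁ (inj₂ refl)) (inj₂ m) (inj₂ (sb , _)) = r , Off-flip (≢-sym a≢b) ow (sy r (rab m)) sb sa , rab m
      -- When b is v, Y joins a to c as well, and a move of v cannot have changed that pair.
      go (inj₁ (inj₂ refl)) (inj₂ m) (inj₁ refl) = ⊥-elim (true≢false (Yvc refl)
        (trans (toY m a≢d a≢e c≢d c≢e) (trans (sym (ow a c a≢b (≢-sym v≢c))) pac)))
      go (inj₂ (inj₁ refl)) (inj₂ (inj₁ m)) _ = ⊥-elim (a≢d m)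
      go (inj₂ (inj₁ refl)) (inj₂ (inj₂ m)) _ = ⊥-elim (a≢e m)
      go (inj₂ (inj₂ refl)) (inj₂ (inj₁ m)) _ = ⊥-elim (b≢d m)
      go (inj₂ (inj₂ refl)) (inj₂ (inj₂ m)) _ = ⊥-elim (proj₂ b≢de m)
      go (inj₂ (inj₁ refl)) (inj₁ m) _ = ⊥-elim (transfer sa va ou offY ta m)
      go (inj₂ (inj₂ refl)) (inj₁ m) (inj₂ (sb , vb)) =
        ⊥-elim (transfer sb vb ou (Off-flip a≢b offY Yab ta tb) tb m)
        where tb = Single-Off sb ot (Single-sym st b≢d) b≢d
      go (inj₂ (inj₂ refl)) (inj₁ m) (inj₁ refl) = ⊥-elim (true≢false (Yvc refl)
        (trans (ou a c a≢b (≢-sym v≢c)) (trans (sym (w-off m)) pac)))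
        where
        w-off : w ≡ d ⊎ w ≡ e → ⟦ p ⟧ a c ≡ ⟦ r ⟧ a c
        w-off (inj₁ refl) = ow a c a≢d c≢d
        w-off (inj₂ refl) = ow a c a≢e c≢e

  -- Let q split {b, c} and let r merge a into it. They differ on all three sides of abc, so they
  -- are nonadjacent and `outer-exists` gives some z between them; every way for two moves to cover
  -- the three sides puts z within one move of p.
  no-cone : ∀ {a b c} → Single p a → ⟦ p ⟧ b c ≡ true → b ≢ c → Only b c → H a b → H a c → ⊥
  no-cone {a} {b} {c} sa bc b≢c only ab@(a≢b , adj-ab) (a≢c , adj-ac)
    with isolate p b | merge sa bc b≢c only (inj₁ refl) a≢b cl (H-sym ab)
    where
    cl : ∀ z → z ≢ a → ⟦ p ⟧ b z ≡ true → adj G a z ≡ false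
    cl z _ bz with only bz
    ... | inj₁ refl = adj-ab
    ... | inj₂ refl = adj-ac
  ... | q , oq , sq | r , or , rab = conclude (outer-exists
      (Off⇒A (Differ⇒≢ (t≢f bc (sq c (≢-sym b≢c)))) oq)
      (Off⇒A (Differ⇒≢ (f≢t (sa b (≢-sym a≢b)) rab)) or)
      (Differ⇒≢ Dab) (λ e → hit-triangle (proj₂ (A⇒Off e)) Dab Dac Dbc a≢b a≢c b≢c))
    where
    rac : ⟦ r ⟧ a c ≡ true
    rac = trans (attach-row or rab (≢-sym a≢b) c (≢-sym a≢c)) bc
    qa : ∀ {w} → w ≢ a → ⟦ q ⟧ a w ≡ false
    qa w≢a = Boolₚ.¬-not (λ e → true≢false (isolate-⊆ oq sq e) (sa _ w≢a))
    Dab : Differ q r a b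
    Dab = f≢t (qa (≢-sym a≢b)) rab
    Dac : Differ q r a c
    Dac = f≢t (qa (≢-sym a≢c)) rac
    Dbc : Differ q r b c
    Dbc = f≢t (sq c (≢-sym b≢c)) (tr r (sy r rab) rac)
    q-single-c : Single q c
    q-single-c w w≢c = Boolₚ.¬-not go
      where
      go : ⟦ q ⟧ c w ≡ true → ⊥
      go e with only (tr p bc (isolate-⊆ oq sq e))
      ... | inj₁ refl = true≢false (sy q e) (sq c (≢-sym b≢c))
      ... | inj₂ refl = w≢c refl
    oq-c : Off c p q
    oq-c = Off-sym (Off-flip b≢c (Off-sym oq) bc sq q-single-c)
    shift : ∀ {x y z} → Off y p q → ⟦ q ⟧ x y ≡ false → Off a z q → Off x z r → ⟦ r ⟧ a y ≡ true →
      a ≢ x → a ≢ y → x ≢ y → (∀ {w} → ⟦ p ⟧ x w ≡ true → w ≡ x ⊎ w ≡ y) → ⟦ r ⟧ a x ≡ true → Off y p z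
    shift {x} {y} {z} oy xy oa ox ay a≢x a≢y x≢y onl rax u w u≢y w≢y = go (u ≟ a) (w ≟ a)
      where
      zay : ⟦ z ⟧ a y ≡ true
      zay = trans (ox a y a≢x (≢-sym x≢y)) ay
      row : ∀ w → w ≢ a → w ≢ y → ⟦ p ⟧ a w ≡ ⟦ z ⟧ a w
      row w w≢a w≢y = trans (sa w w≢a) (sym (Boolₚ.¬-not bad))
        where
        bad : ⟦ z ⟧ a w ≡ true → ⊥
        bad e with w ≟ x
        ... | yes refl = true≢false (trans (sym (oa x y (≢-sym a≢x) (≢-sym a≢y))) (tr z (sy z e) zay)) xy
        ... | no w≢x with onl (trans (or x w (≢-sym a≢x) w≢a) (tr r (sy r rax) (trans (sym (ox a w a≢x w≢x)) e)))
        ...   | inj₁ f = w≢x f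
        ...   | inj₂ f = w≢y f
      go : Dec (u ≡ a) → Dec (w ≡ a) → ⟦ p ⟧ u w ≡ ⟦ z ⟧ u w
      go (yes refl) (yes refl) = trans (rfl p u) (sym (rfl z u))
      go (yes refl) (no w≢a) = row w w≢a w≢y
      go (no u≢a) (yes refl) = trans (sy≡ p u w) (trans (row u u≢a u≢y) (sy≡ z w u))
      go (no u≢a) (no w≢a) = trans (oy u w u≢y w≢y) (sym (oa u w u≢a w≢a))
    conclude : (∃ λ z → Outer A p z × A z q × A z r) → ⊥
    conclude (z , oz , zq , zr) with A⇒Off zq | A⇒Off zr
    ... | u , ou | w , ow with hit₂ ou ow Dbc | hit₂ ou ow Dab | hit₂ ou ow Dac
    ... | inj₁ (inj₁ refl) | _ | _ = Off-outer oz (Off-trans oq (Off-sym ou))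
    ... | inj₁ (inj₂ refl) | _ | _ = Off-outer oz (Off-trans oq-c (Off-sym ou))
    ... | _ | inj₂ (inj₁ refl) | _ = Off-outer oz (Off-trans or (Off-sym ow))
    ... | _ | _ | inj₂ (inj₁ refl) = Off-outer oz (Off-trans or (Off-sym ow))
    ... | _ | inj₁ (inj₂ refl) | _ = Off-outer oz (Off-trans oq (Off-sym ou))
    ... | _ | _ | inj₁ (inj₂ refl) = Off-outer oz (Off-trans oq-c (Off-sym ou))
    -- Now z joins a to c and leaves b alone, so moving c suffices to get from p to z. The next case
    -- is the same with b and c exchanged.
    ... | inj₂ (inj₁ refl) | _ | inj₁ (inj₁ refl) =
      Off-outer oz (shift oq-c (sq c (≢-sym b≢c)) ou ow rac a≢b a≢c b≢c only rab)
    ... | inj₂ (inj₂ refl) | inj₁ (inj₁ refl) | _ =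
      Off-outer oz (shift oq (q-single-c b b≢c) ou ow rab a≢c a≢b (≢-sym b≢c) only-c rac)
      where
      only-c : ∀ {w} → ⟦ p ⟧ c w ≡ true → w ≡ c ⊎ w ≡ b
      only-c cw with only (tr p bc cw)
      ... | inj₁ e = inj₂ e
      ... | inj₂ e = inj₁ e
    ... | inj₂ (inj₁ refl) | _ | inj₂ (inj₂ e) = b≢c e
    ... | inj₂ (inj₂ refl) | inj₂ (inj₂ e) | _ = b≢c (sym e)

-- Moves from p and the vertices that perform them

module Realising {n} (G : Graph n) (k : ℕ) (k+2≤n : k + 2 ≤ n) (p : Bell.V G k) (L : Local (Bell.A G k) p) where
  open Bell G k
  open Basics G k
  open Moves G k
  open Crossing G k p L
  open Merging G k k+2≤n p L
  open Local L

  InTriple : Fin n → Set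
  InTriple a = ∃₂ λ b c → (⟦ p ⟧ a b ≡ true × ⟦ p ⟧ a c ≡ true) × (a ≢ b × a ≢ c × b ≢ c)

  only-or-triple : ∀ {a b} → a ≢ b → ⟦ p ⟧ a b ≡ true → Only a b ⊎ InTriple a
  only-or-triple {a} {b} a≢b ab with Finₚ.any? (λ c → (⟦ p ⟧ a c Boolₚ.≟ true) ×-dec (¬? (a ≟ c) ×-dec ¬? (b ≟ c)))
  ... | yes (c , ac , a≢c , b≢c) = inj₂ (b , c , (ab , ac) , (a≢b , a≢c , b≢c))
  ... | no none = inj₁ only
    where
    only : Only a b
    only {z} az with z ≟ a | z ≟ b
    ... | yes e | _ = inj₁ e
    ... | _ | yes e = inj₂ e
    ... | no z≢a | no z≢b = ⊥-elim (none (z , az , ≢-sym z≢a , ≢-sym z≢b))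

  InTriple-closed : ∀ {a t} → InTriple a → Single p t → H a t → ⊥
  InTriple-closed (_ , _ , (ab , ac) , (a≢b , a≢c , b≢c)) = triple-closed ab ac a≢b a≢c b≢c

  cone-free : ∀ {a b c} → Single p a → ⟦ p ⟧ b c ≡ true → b ≢ c → H a b → H a c → ⊥
  cone-free sa bc b≢c ab ac with only-or-triple b≢c bc
  ... | inj₁ only = no-cone sa bc b≢c only ab ac
  ... | inj₂ t    = InTriple-closed t sa (H-sym ab)

  -- Suppose u has a partner in p. If w has one too, `crossing` excludes the new pair; if w is a
  -- singleton, it would be joined in H to u and to its partner, against `cone-free`.
  target-single : ∀ {w u r} → Off w p r → ⟦ p ⟧ w u ≡ false → ⟦ r ⟧ w u ≡ true → Single p u
  target-single {w} {u} {r} o pwu rwu with single? u | single? w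
  ... | inj₁ s | _ = s
  ... | inj₂ (u′ , u′≢u , uu′) | inj₂ (w′ , w′≢w , ww′) =
    ⊥-elim (crossing ww′ uu′ (≢-sym w′≢w) (≢-sym u′≢u)
      (λ { refl → true≢false (sy p uu′) pwu })
      (λ { refl → true≢false ww′ pwu })
      (λ { refl → true≢false (tr p ww′ (sy p uu′)) pwu })
      (same⇒H r (irreflexive p pwu) rwu))
  ... | inj₂ (u′ , u′≢u , uu′) | inj₁ sw = ⊥-elim (cone-free sw uu′ (≢-sym u′≢u)
      (same⇒H r w≢u rwu) (same⇒H r w≢u′ (tr r rwu (trans (sym (o u u′ (≢-sym w≢u) (≢-sym w≢u′))) uu′))))
    where
    w≢u = irreflexive p pwu
    w≢u′ : w ≢ u′
    w≢u′ refl = true≢false (sy p uu′) pwu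

  -- If v, w and u are distinct, p and q can differ only on vw and vu, and p and r only on vw and
  -- wu. The statuses of these pairs decide which vertex serves for both moves; two splits from a
  -- part containing v, w and u are the exception.
  common-mover : ∀ {v w u q r} → Off v p q → Off w p r → Off u q r →
    (∃ λ m → Off m p q × Off m p r) ⊎ ((⟦ p ⟧ v w ≡ true × ⟦ p ⟧ v u ≡ true) × (v ≢ w × v ≢ u × w ≢ u))
  common-mover {v} {w} {u} {q} {r} oq or ou with v ≟ w | u ≟ v | u ≟ w
  ... | yes refl | _ | _ = inj₁ (v , oq , or)
  ... | no _ | yes refl | _ = inj₁ (v , oq , Off-trans oq ou)
  ... | no _ | no _ | yes refl = inj₁ (w , Off-trans or (Off-sym ou) , or)
  ... | no v≢w | no u≢v | no u≢w = go (⟦ p ⟧ v w) (⟦ q ⟧ v w) (⟦ p ⟧ v u) (⟦ q ⟧ v u) (⟦ r ⟧ w u) refl refl refl refl refl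
    where
    Res = (∃ λ m → Off m p q × Off m p r) ⊎ ((⟦ p ⟧ v w ≡ true × ⟦ p ⟧ v u ≡ true) × (v ≢ w × v ≢ u × w ≢ u))
    qr : ⟦ q ⟧ v w ≡ ⟦ r ⟧ v w
    qr = ou v w (≢-sym u≢v) (≢-sym u≢w)
    rowq : ∀ y → y ≢ v → y ≢ w → y ≢ u → ⟦ p ⟧ v y ≡ ⟦ q ⟧ v y
    rowq y y≢v y≢w y≢u = trans (or v y v≢w y≢w) (sym (ou v y (≢-sym u≢v) y≢u))
    rowr : ∀ y → y ≢ v → y ≢ w → y ≢ u → ⟦ p ⟧ w y ≡ ⟦ r ⟧ w y
    rowr y y≢v y≢w y≢u = trans (oq w y (≢-sym v≢w) y≢v) (ou w y (≢-sym u≢w) y≢u)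
    unmoved : ⟦ p ⟧ v w ≡ ⟦ q ⟧ v w → Res
    unmoved e = inj₁ (u , o , Off-trans o ou)
      where
      row : ∀ y → y ≢ v → y ≢ u → ⟦ p ⟧ v y ≡ ⟦ q ⟧ v y
      row y y≢v y≢u with y ≟ w
      ... | yes refl = e
      ... | no y≢w   = rowq y y≢v y≢w y≢u
      o : Off u p q
      o = Off-row oq row
    go : ∀ a b c d e → ⟦ p ⟧ v w ≡ a → ⟦ q ⟧ v w ≡ b → ⟦ p ⟧ v u ≡ c → ⟦ q ⟧ v u ≡ d → ⟦ r ⟧ w u ≡ e → Res
    go true true _ _ _ f g _ _ _ = unmoved (trans f (sym g))
    go false false _ _ _ f g _ _ _ = unmoved (trans f (sym g))
    go false true _ _ _ f g _ _ _ = inj₁ (w , Off-flip v≢w oq g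
        (target-single or (trans (sy≡ p w v) f) (sy r (trans (sym qr) g))) (target-single oq f g) , or)
    go true false true _ _ f _ h _ _ = inj₂ ((f , h) , (v≢w , ≢-sym u≢v , ≢-sym u≢w))
    go true false false false _ f _ h i _ = inj₁ (w , Off-row oq row , or)
      where
      row : ∀ y → y ≢ v → y ≢ w → ⟦ p ⟧ v y ≡ ⟦ q ⟧ v y
      row y y≢v y≢w with y ≟ u
      ... | yes refl = trans h (sym i)
      ... | no y≢u   = rowq y y≢v y≢w y≢u
    go true false false true false f _ h _ j = inj₁ (v , oq , Off-row or row)
      where
      row : ∀ y → y ≢ w → y ≢ v → ⟦ p ⟧ w y ≡ ⟦ r ⟧ w y
      row y y≢w y≢v with y ≟ u
      ... | yes refl = trans (sym (tr≡ p u f)) (trans h (sym j))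
      ... | no y≢u   = rowr y y≢v y≢w y≢u
    -- Here u is a singleton of p joined in H to both v and w, which lie in one part.
    go true false false true true f _ h i j = ⊥-elim (cone-free (target-single oq h i) f v≢w
      (same⇒H q u≢v (sy q i)) (same⇒H r u≢w (sy r j)))

  not-Off : ∀ {v q r} → ¬ Off v q r → ∃₂ λ y z → y ≢ v × z ≢ v × Differ q r y z
  not-Off {v} {q} {r} ¬o with Finₚ.any? (λ y → Finₚ.any? (λ z →
      ¬? (y ≟ v) ×-dec (¬? (z ≟ v) ×-dec ¬? (⟦ q ⟧ y z Boolₚ.≟ ⟦ r ⟧ y z))))
  ... | yes e = e
  ... | no none = ⊥-elim (¬o o)
    where
    o : Off v q r
    o x y x≢v y≢v with ⟦ q ⟧ x y Boolₚ.≟ ⟦ r ⟧ x y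
    ... | yes e = e
    ... | no ¬e = ⊥-elim (none (x , y , x≢v , y≢v , ¬e))

  module _ {v : Fin n} {x : V} (ox : Outer A p x) where

    private
      record Mv (q : V) : Set where
        constructor mv
        field
          pq : A p q
          xq : A x q
          oq : Off v p q
      open Mv

      -- Both q and r agree with x off y, so their rows at v can differ only in the entry y.
      same-row : ∀ {y q r} → v ≢ y → Mv q → Mv r → Off y x q → Off y x r → ⟦ q ⟧ v y ≡ ⟦ r ⟧ v y → q ≡ r
      same-row {y} {q} {r} v≢y Q R yq yr e = Off-ext (Off-trans (Off-sym (oq Q)) (oq R)) row
        where
        row : ∀ w → w ≢ v → ⟦ q ⟧ v w ≡ ⟦ r ⟧ v w
        row w w≢v with w ≟ y
        ... | yes refl = e
        ... | no w≢y   = trans (sym (yq v w v≢y w≢y)) (yr v w v≢y w≢y)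

      -- If p separates y and z, then r leaves v alone, q and s put it with the singletons y and z,
      -- and x joins y to z. The merge J of y and z in p is then adjacent to x but not to r, whereas
      -- q and r are adjacent, against `outer-clique`.
      core : ∀ {y z q r s} → Mv q → Mv r → Mv s → r ≢ s → y ≢ v → z ≢ v → y ≢ z → Differ p x y z →
        Off y x q → Off y x r → Off z x s → ⟦ q ⟧ v y ≡ true → ⟦ r ⟧ v y ≡ false → ⊥
      core {y} {z} {q} {r} {s} Q R S r≢s y≢v z≢v y≢z d yq yr zs qvy rvy with ⟦ p ⟧ y z in pyz
      ... | true = true≢false (tr r rvz (sy r (trans (sym (oq R y z y≢v z≢v)) pyz))) rvy
        where
        qvz : ⟦ q ⟧ v z ≡ true
        qvz = tr q qvy (trans (sym (oq Q y z y≢v z≢v)) pyz)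
        rvz : ⟦ r ⟧ v z ≡ true
        rvz = trans (sym (yr v z (≢-sym y≢v) (≢-sym y≢z))) (trans (yq v z (≢-sym y≢v) (≢-sym y≢z)) qvz)
      ... | false = outer-clique (pq Q) (pq R) pJ ox (xq Q) (xq R) xJ
            (Off⇒A (Differ⇒≢ (t≢f qvy rvy)) (Off-trans (Off-sym (oq Q)) (oq R)))
            (Differ⇒≢ D₁) (λ a → hit-disjoint (proj₂ (A⇒Off a)) D₁ D₂ y≢v y≢c z≢v z≢c)
        where
        xyz : ⟦ x ⟧ y z ≡ true
        xyz = Boolₚ.¬-not (λ e → d (sym e))
        qvz : ⟦ q ⟧ v z ≡ false
        qvz = Boolₚ.¬-not (λ e → true≢false (trans (oq Q y z y≢v z≢v) (tr q (sy q qvy) e)) pyz)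
        xvz : ⟦ x ⟧ v z ≡ false
        xvz = trans (yq v z (≢-sym y≢v) (≢-sym y≢z)) qvz
        xvy : ⟦ x ⟧ v y ≡ false
        xvy = Boolₚ.¬-not (λ e → true≢false (tr x e xyz) xvz)
        svy : ⟦ s ⟧ v y ≡ false
        svy = trans (sym (zs v y (≢-sym z≢v) y≢z)) xvy
        rvz : ⟦ r ⟧ v z ≡ false
        rvz = trans (sym (yr v z (≢-sym y≢v) (≢-sym y≢z))) xvz
        svz : ⟦ s ⟧ v z ≡ true
        svz = Boolₚ.¬-not (λ e → r≢s (Off-ext (Off-trans (Off-sym (oq R)) (oq S)) (row e)))
          where
          row : ⟦ s ⟧ v z ≡ false → ∀ w → w ≢ v → ⟦ r ⟧ v w ≡ ⟦ s ⟧ v w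
          row e w w≢v with w ≟ y | w ≟ z
          ... | yes refl | _ = trans rvy (sym svy)
          ... | _ | yes refl = trans rvz (sym e)
          ... | no w≢y | no w≢z = trans (sym (yr v w (≢-sym y≢v) w≢y)) (zs v w (≢-sym z≢v) w≢z)
        r-single : Single r v
        r-single w w≢v = Boolₚ.¬-not bad
          where
          bad : ⟦ r ⟧ v w ≡ true → ⊥
          bad e = true≢false (tr p (sy p wy) wz) pyz
            where
            w≢y : w ≢ y
            w≢y refl = true≢false e rvy
            w≢z : w ≢ z
            w≢z refl = true≢false e rvz
            xvw : ⟦ x ⟧ v w ≡ true
            xvw = trans (yr v w (≢-sym y≢v) w≢y) e
            wy : ⟦ p ⟧ w y ≡ true
            wy = trans (oq Q w y w≢v y≢v) (tr q (sy q (trans (sym (yq v w (≢-sym y≢v) w≢y)) xvw)) qvy)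
            wz : ⟦ p ⟧ w z ≡ true
            wz = trans (oq S w z w≢v z≢v) (tr s (sy s (trans (sym (zs v w (≢-sym z≢v) w≢z)) xvw)) svz)
        old : ∃ λ c → c ≢ v × ⟦ p ⟧ v c ≡ true
        old with Off-differ (A⇒≢ (pq R)) (oq R)
        ... | c , c≢v , d′ = c , c≢v , Boolₚ.¬-not (λ e → d′ (trans e (sym (r-single c c≢v))))
        c : Fin n
        c = proj₁ old
        c≢v : c ≢ v
        c≢v = proj₁ (proj₂ old)
        vc : ⟦ p ⟧ v c ≡ true
        vc = proj₂ (proj₂ old)
        moved : ∀ {t y} → Mv t → y ≢ v → ⟦ t ⟧ v y ≡ true → ⟦ p ⟧ v y ≡ false
        moved {t} {y} T y≢v tvy = Boolₚ.¬-not (λ e → A⇒≢ (pq T) (Off-ext (oq T)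
          (λ w w≢v → trans (tr≡ p w e) (sym (attach-row (oq T) tvy y≢v w w≢v)))))
        pvy : ⟦ p ⟧ v y ≡ false
        pvy = moved Q y≢v qvy
        pvz : ⟦ p ⟧ v z ≡ false
        pvz = moved S z≢v svz
        y≢c : y ≢ c
        y≢c refl = true≢false vc pvy
        z≢c : z ≢ c
        z≢c refl = true≢false vc pvz
        y-single : Single p y
        y-single = target-single (oq Q) pvy qvy
        z-single : Single p z
        z-single = target-single (oq S) pvz svz
        vy : H v y
        vy = same⇒H q (≢-sym y≢v) qvy
        vz : H v z
        vz = same⇒H s (≢-sym z≢v) svz
        only : Only v c
        only with only-or-triple (≢-sym c≢v) vc
        ... | inj₁ o = o
        ... | inj₂ t = ⊥-elim (InTriple-closed t y-single vy)
        cl : ∀ w → w ≢ y → ⟦ p ⟧ z w ≡ true → adj G y w ≡ false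
        cl w _ zw with w ≟ z
        ... | yes refl = clique x xyz
        ... | no w≢z   = ⊥-elim (true≢false zw (z-single w w≢z))
        merged : ∃ λ J → Off y p J × ⟦ J ⟧ y z ≡ true
        merged = merge y-single vc (≢-sym c≢v) only (inj₂ (z-single , vz)) y≢z cl vy
        J : V
        J = proj₁ merged
        oJ : Off y p J
        oJ = proj₁ (proj₂ merged)
        Jyz : ⟦ J ⟧ y z ≡ true
        Jyz = proj₂ (proj₂ merged)
        pJ : A p J
        pJ = Off⇒A (Differ⇒≢ (f≢t pyz Jyz)) oJ
        D₁ : Differ J r y z
        D₁ = t≢f Jyz (trans (sym (oq R y z y≢v z≢v)) pyz)
        Jvc : ⟦ J ⟧ v c ≡ true
        Jvc = trans (sym (oJ v c (≢-sym y≢v) (≢-sym y≢c))) vc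
        D₂ : Differ J r v c
        D₂ = t≢f Jvc (r-single c c≢v)
        xJ : A x J
        xJ = Off⇒A (Differ⇒≢ (f≢t xvc Jvc)) off
          where
          xvc : ⟦ x ⟧ v c ≡ false
          xvc = trans (yr v c (≢-sym y≢v) (≢-sym y≢c)) (r-single c c≢v)
          rowy : ∀ w → w ≢ v → w ≢ y → ⟦ x ⟧ y w ≡ ⟦ J ⟧ y w
          rowy w w≢v w≢y with w ≟ z
          ... | yes refl = trans xyz (sym Jyz)
          ... | no w≢z = trans (Boolₚ.¬-not (λ e → true≢false
                (trans (oq Q z w z≢v w≢v) (trans (sym (yq z w (≢-sym y≢z) w≢y)) (tr x (sy x xyz) e))) (z-single w w≢z)))
              (sym (trans (attach-row oJ Jyz (≢-sym y≢z) w w≢y) (z-single w w≢z)))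
          off : Off v x J
          off u w u≢v w≢v = go (u ≟ y) (w ≟ y)
            where
            go : Dec (u ≡ y) → Dec (w ≡ y) → ⟦ x ⟧ u w ≡ ⟦ J ⟧ u w
            go (yes refl) (yes refl) = trans (rfl x u) (sym (rfl J u))
            go (yes refl) (no w≢y) = rowy w w≢v w≢y
            go (no u≢y) (yes refl) = trans (sy≡ x u w) (trans (rowy u u≢v u≢y) (sy≡ J w u))
            go (no u≢y) (no w≢y) = trans (yq u w u≢y w≢y) (trans (sym (oq Q u w u≢v w≢v)) (oJ u w u≢y w≢y))

      two-one : ∀ {y z q r s} → Mv q → Mv r → Mv s → q ≢ r → q ≢ s → r ≢ s → y ≢ v → z ≢ v → y ≢ z → Differ p x y z →
        Off y x q → Off y x r → Off z x s → ⊥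
      two-one {y} {z} {q} {r} Q R S q≢r q≢s r≢s y≢v z≢v y≢z d yq yr zs with ⟦ q ⟧ v y in e | ⟦ r ⟧ v y in f
      ... | true  | false = core Q R S r≢s y≢v z≢v y≢z d yq yr zs e f
      ... | false | true  = core R Q S q≢s y≢v z≢v y≢z d yr yq zs f e
      ... | true  | true  = q≢r (same-row (≢-sym y≢v) Q R yq yr (trans e (sym f)))
      ... | false | false = q≢r (same-row (≢-sym y≢v) Q R yq yr (trans e (sym f)))

      three : ∀ {y q r s} → Mv q → Mv r → Mv s → q ≢ r → q ≢ s → r ≢ s → y ≢ v →
        Off y x q → Off y x r → Off y x s → ⊥
      three {y} {q} {r} {s} Q R S q≢r q≢s r≢s y≢v yq yr ys with ⟦ q ⟧ v y in e | ⟦ r ⟧ v y in f | ⟦ s ⟧ v y in g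
      ... | true  | true  | _     = q≢r (same-row (≢-sym y≢v) Q R yq yr (trans e (sym f)))
      ... | false | false | _     = q≢r (same-row (≢-sym y≢v) Q R yq yr (trans e (sym f)))
      ... | true  | _     | true  = q≢s (same-row (≢-sym y≢v) Q S yq ys (trans e (sym g)))
      ... | false | _     | false = q≢s (same-row (≢-sym y≢v) Q S yq ys (trans e (sym g)))
      ... | _     | true  | true  = r≢s (same-row (≢-sym y≢v) R S yr ys (trans f (sym g)))
      ... | _     | false | false = r≢s (same-row (≢-sym y≢v) R S yr ys (trans f (sym g)))

    -- As x is not a move of v away from p, it differs from p on some pair {y, z} avoiding v. Since
    -- q, r and s agree with p there, each reaches x by moving y or z. Three through one vertex
    -- would need three different values of one Boolean entry; two and one is `core`.
    star-free : ∀ {q r s} → A p q → A p r → A p s → A x q → A x r → A x s → q ≢ r → q ≢ s → r ≢ s →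
      Off v p q → Off v p r → Off v p s → ⊥
    star-free {q} {r} {s} pq pr ps xq xr xs q≢r q≢s r≢s oq or os
      with not-Off (Off-outer ox) | A⇒Off xq | A⇒Off xr | A⇒Off xs
    ... | y , z , y≢v , z≢v , d | a , aq | b , br | c , cs = go (at oq aq) (at or br) (at os cs)
      where
      Q = mv pq xq oq
      R = mv pr xr or
      S = mv ps xs os
      y≢z : y ≢ z
      y≢z refl = d (trans (rfl p y) (sym (rfl x y)))
      d′ : Differ p x z y
      d′ e = d (trans (sy≡ p y z) (trans e (sy≡ x z y)))
      at : ∀ {u t} → Off v p t → Off u x t → u ≡ y ⊎ u ≡ z
      at o o′ = hit o′ (λ e → d (trans (o y z y≢v z≢v) (sym e)))
      go : a ≡ y ⊎ a ≡ z → b ≡ y ⊎ b ≡ z → c ≡ y ⊎ c ≡ z → ⊥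
      go (inj₁ refl) (inj₁ refl) (inj₁ refl) = three Q R S q≢r q≢s r≢s y≢v aq br cs
      go (inj₂ refl) (inj₂ refl) (inj₂ refl) = three Q R S q≢r q≢s r≢s z≢v aq br cs
      go (inj₁ refl) (inj₁ refl) (inj₂ refl) = two-one Q R S q≢r q≢s r≢s y≢v z≢v y≢z d aq br cs
      go (inj₁ refl) (inj₂ refl) (inj₁ refl) = two-one Q S R q≢s q≢r (≢-sym r≢s) y≢v z≢v y≢z d aq cs br
      go (inj₂ refl) (inj₁ refl) (inj₁ refl) = two-one R S Q r≢s (≢-sym q≢r) (≢-sym q≢s) y≢v z≢v y≢z d br cs aq
      go (inj₂ refl) (inj₂ refl) (inj₁ refl) = two-one Q R S q≢r q≢s r≢s z≢v y≢v (≢-sym y≢z) d′ aq br cs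
      go (inj₂ refl) (inj₁ refl) (inj₂ refl) = two-one Q S R q≢s q≢r (≢-sym r≢s) z≢v y≢v (≢-sym y≢z) d′ aq cs br
      go (inj₁ refl) (inj₂ refl) (inj₂ refl) = two-one R S Q r≢s (≢-sym q≢r) (≢-sym q≢s) z≢v y≢v (≢-sym y≢z) d′ br cs aq

-- The edge realised by a neighbour

module EdgeOf {n} (G : Graph n) (k : ℕ) (k+2≤n : k + 2 ≤ n) (p : Bell.V G k) (L : Local (Bell.A G k) p) where
  open Bell G k
  open Basics G k
  open Moves G k
  open Crossing G k p L
  open Merging G k k+2≤n p L
  open Realising G k k+2≤n p L

  -- The edge of the complement that a neighbour q of p stands for: the new pair if a vertex is moved to
  -- another part, and the broken pair if a part of size two is split. A vertex split off a part of size
  -- three stands for the other two, in the way the vertex of a triangle stands for the opposite edge.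
  data Real (q : V) (x y : Fin n) : Set where
    join  : ⟦ p ⟧ x y ≡ false → ⟦ q ⟧ x y ≡ true → Off x p q → Single p y → Real q x y
    split : ⟦ p ⟧ x y ≡ true → x ≢ y → Only x y → Off x p q → Single q x → Real q x y
    trip  : ∀ {z} → ⟦ p ⟧ z x ≡ true → ⟦ p ⟧ z y ≡ true → z ≢ x → z ≢ y → x ≢ y →
            Off z p q → Single q z → Real q x y

  Real⇒H : ∀ {q x y} → Real q x y → H x y
  Real⇒H {q} (join pxy qxy _ _)         = same⇒H q (irreflexive p pxy) qxy
  Real⇒H     (split pxy x≢y _ _ _)      = same⇒H p x≢y pxy
  Real⇒H     (trip zx zy _ _ x≢y _ _)   = same⇒H p x≢y (tr p (sy p zx) zy)

  -- A moved vertex with a new companion gives a join. Otherwise it has become a singleton, and its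
  -- old part supplies a broken pair or a triple.
  real : ∀ {q} → A p q → ∃₂ (Real q)
  real {q} pq with A⇒Off pq
  ... | w , o with Finₚ.any? (λ u → (⟦ p ⟧ w u Boolₚ.≟ false) ×-dec (⟦ q ⟧ w u Boolₚ.≟ true))
  ... | yes (u , f , t) = w , u , join f t o (target-single o f t)
  ... | no none = old (Off-differ (A⇒≢ pq) o)
    where
    sub : ∀ {u} → ⟦ q ⟧ w u ≡ true → ⟦ p ⟧ w u ≡ true
    sub {u} t = Boolₚ.¬-not (λ f → none (u , f , t))
    -- Any companion of w in q is an old one and fixes the row of w in both partitions, which would
    -- then be equal.
    q-single : Single q w
    q-single u u≢w = Boolₚ.¬-not (λ t → A⇒≢ pq (Off-ext o
      (λ y y≢w → trans (tr≡ p y (sub t)) (sym (attach-row o t u≢w y y≢w)))))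
    old : (∃ λ y → y ≢ w × Differ p q w y) → ∃₂ (Real q)
    old (y , y≢w , d) with only-or-triple (≢-sym y≢w) wy
      where
      wy : ⟦ p ⟧ w y ≡ true
      wy = Boolₚ.¬-not (λ e → d (trans e (sym (q-single y y≢w))))
    ... | inj₁ only = w , y , split (Boolₚ.¬-not (λ e → d (trans e (sym (q-single y y≢w))))) (≢-sym y≢w) only o q-single
    ... | inj₂ (b , c , (wb , wc) , (w≢b , w≢c , b≢c)) = b , c , trip wb wc w≢b w≢c b≢c o q-single

  isolated-unique : ∀ {v q r} → Off v p q → Off v p r → Single q v → Single r v → q ≡ r
  isolated-unique o o′ s s′ = Off-ext (Off-trans (Off-sym o) o′) (λ y y≢v → trans (s y y≢v) (sym (s′ y y≢v)))

  third : ∀ {z z′ x y} → ⟦ p ⟧ z x ≡ true → ⟦ p ⟧ z y ≡ true → ⟦ p ⟧ z z′ ≡ true → z ≢ x → z ≢ y → x ≢ y →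
    z′ ≢ x → z′ ≢ y → z′ ≡ z
  third {z} {z′} zx zy zz z≢x z≢y x≢y z′≢x z′≢y with z′ ≟ z
  ... | yes e = e
  ... | no z′≢z = ⊥-elim (no-four zx zy zz z≢x z≢y (≢-sym z′≢z) x≢y (≢-sym z′≢x) (≢-sym z′≢y))

  -- The three kinds are told apart by p alone: whether x and y share a part, and whether that part
  -- has a third element. Within each kind the edge determines the move.
  Real-unique : ∀ {q r x y} → Real q x y → Real r x y → q ≡ r
  Real-unique (join f t o _) (join _ t′ o′ _) = Off-ext (Off-trans (Off-sym o) o′)
    (λ w w≢x → trans (attach-row o t (≢-sym (irreflexive p f)) w w≢x) (sym (attach-row o′ t′ (≢-sym (irreflexive p f)) w w≢x)))
  Real-unique (join f _ _ _) (split t _ _ _ _) = ⊥-elim (true≢false t f)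
  Real-unique (join f _ _ _) (trip zx zy _ _ _ _ _) = ⊥-elim (true≢false (tr p (sy p zx) zy) f)
  Real-unique (split t _ _ _ _) (join f _ _ _) = ⊥-elim (true≢false t f)
  Real-unique (split _ _ _ o s) (split _ _ _ o′ s′) = isolated-unique o o′ s s′
  Real-unique (split _ _ only _ _) (trip zx zy z≢x z≢y _ _ _) with only (sy p zx)
  ... | inj₁ e = ⊥-elim (z≢x e)
  ... | inj₂ e = ⊥-elim (z≢y e)
  Real-unique (trip zx zy _ _ _ _ _) (join f _ _ _) = ⊥-elim (true≢false (tr p (sy p zx) zy) f)
  Real-unique (trip zx zy z≢x z≢y _ _ _) (split _ _ only _ _) with only (sy p zx)
  ... | inj₁ e = ⊥-elim (z≢x e)
  ... | inj₂ e = ⊥-elim (z≢y e)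
  Real-unique (trip zx zy z≢x z≢y x≢y o s) (trip zx′ zy′ z≢x′ z≢y′ _ o′ s′)
    with third zx zy (tr p zx (sy p zx′)) z≢x z≢y x≢y z≢x′ z≢y′
  ... | refl = isolated-unique o o′ s s′

  Realises : V → Fin n → Fin n → Set
  Realises q x y = Real q x y ⊎ Real q y x

  Realises-unique : ∀ {q r x y} → Realises q x y → Realises r x y → q ≡ r
  Realises-unique (inj₁ a) (inj₁ b) = Real-unique a b
  Realises-unique (inj₂ a) (inj₂ b) = Real-unique a b
  Realises-unique (inj₂ a) (inj₁ b) = sym (Realises-unique (inj₁ b) (inj₂ a))
  Realises-unique {x = x} {y} (inj₁ a) (inj₂ b) = Real-unique (flip a b) b
    where
    -- For a join, the reversed realisation supplies that x is a singleton too, so the merge can be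
    -- read from either end.
    flip : ∀ {q r} → Real q x y → Real r y x → Real q y x
    flip {q} (join f t o s) (join f′ _ _ s′) =
      join f′ (sy q t) (Off-flip (irreflexive p f) o t s′ s) s′
    flip (join f _ _ _) (split t _ _ _ _) = ⊥-elim (true≢false (sy p t) f)
    flip (join f _ _ _) (trip zy zx _ _ _ _ _) = ⊥-elim (true≢false (tr p (sy p zx) zy) f)
    flip {q} (split t x≢y only o s) _ = split (sy p t) (≢-sym x≢y) only′ (Off-row o row) single
      where
      only′ : Only y x
      only′ yz with only (tr p t yz)
      ... | inj₁ e = inj₂ e
      ... | inj₂ e = inj₁ e
      row : ∀ w → w ≢ x → w ≢ y → ⟦ p ⟧ x w ≡ ⟦ q ⟧ x w
      row w w≢x w≢y = trans (Boolₚ.¬-not bad) (sym (s w w≢x))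
        where
        bad : ⟦ p ⟧ x w ≡ true → ⊥
        bad e with only e
        ... | inj₁ f = w≢x f
        ... | inj₂ f = w≢y f
      single : Single q y
      single w w≢y = Boolₚ.¬-not bad
        where
        bad : ⟦ q ⟧ y w ≡ true → ⊥
        bad e with only (tr p t (isolate-⊆ o s e))
        ... | inj₁ refl = true≢false (sy q e) (s y (≢-sym x≢y))
        ... | inj₂ f = w≢y f
    flip (trip zx zy z≢x z≢y x≢y o s) _ = trip zy zx z≢y z≢x (≢-sym x≢y) o s

  -- The one situation in which a moved vertex is not an endpoint of the realised edge.
  record Third (q : V) (m x y : Fin n) : Set where
    field
      tx     : ⟦ p ⟧ m x ≡ true
      ty     : ⟦ p ⟧ m y ≡ true
      m≢x    : m ≢ x
      m≢y    : m ≢ y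
      x≢y    : x ≢ y
      single : Single q m

  Third-sym : ∀ {q m x y} → Third q m x y → Third q m y x
  Third-sym T = record { tx = ty ; ty = tx ; m≢x = m≢y ; m≢y = m≢x ; x≢y = ≢-sym x≢y ; single = single }
    where open Third T

  Third-InTriple : ∀ {q m x y c} → Third q m x y → c ≡ x ⊎ c ≡ y → InTriple c
  Third-InTriple T (inj₁ refl) = _ , _ , (sy p tx , tr p (sy p tx) ty) , (≢-sym m≢x , x≢y , m≢y)
    where open Third T
  Third-InTriple T (inj₂ refl) = _ , _ , (sy p ty , tr p (sy p ty) tx) , (≢-sym m≢y , ≢-sym x≢y , m≢x)
    where open Third T

  mover′ : ∀ {q x y m} → Real q x y → Off m p q → (m ≡ x ⊎ m ≡ y) ⊎ Third q m x y
  mover′ (join f t _ _) o = inj₁ (hit o (f≢t f t))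
  mover′ (split t x≢y _ _ s) o = inj₁ (hit o (t≢f t (s _ (≢-sym x≢y))))
  mover′ (trip zx zy z≢x z≢y x≢y o s) o′ with hit-star o′ (t≢f zx (s _ (≢-sym z≢x))) (t≢f zy (s _ (≢-sym z≢y))) x≢y
  ... | refl = inj₂ (record { tx = zx ; ty = zy ; m≢x = z≢x ; m≢y = z≢y ; x≢y = x≢y ; single = s })

  mover : ∀ {q x y m} → Realises q x y → Off m p q → (m ≡ x ⊎ m ≡ y) ⊎ Third q m x y
  mover (inj₁ R) o = mover′ R o
  mover (inj₂ R) o with mover′ R o
  ... | inj₁ (inj₁ e) = inj₁ (inj₂ e)
  ... | inj₁ (inj₂ e) = inj₁ (inj₁ e)
  ... | inj₂ T = inj₂ (Third-sym T)

  -- A join at m would leave a part closed in H, or make m itself a singleton of p; a split would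
  -- make its part a pair.
  in-triple : ∀ {q x y m} → InTriple m → Real q x y → Off m p q → Third q m x y
  in-triple T@(b , c , (mb , mc) , (m≢b , m≢c , b≢c)) R o with mover′ R o
  ... | inj₂ t = t
  in-triple T@(b , c , (mb , mc) , (m≢b , m≢c , b≢c)) (join f t _ s) o | inj₁ (inj₁ refl) =
    ⊥-elim (InTriple-closed T s (Real⇒H (join f t o s)))
  in-triple T@(b , c , (mb , mc) , (m≢b , m≢c , b≢c)) (join f t _ s) o | inj₁ (inj₂ refl) =
    ⊥-elim (true≢false mb (s b (≢-sym m≢b)))
  in-triple T@(b , c , (mb , mc) , (m≢b , m≢c , b≢c)) (split t x≢y only _ _) o | inj₁ (inj₁ refl)
    with only mb | only mc
  ... | inj₁ e    | _         = ⊥-elim (m≢b (sym e))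
  ... | _         | inj₁ e    = ⊥-elim (m≢c (sym e))
  ... | inj₂ refl | inj₂ refl = ⊥-elim (b≢c refl)
  in-triple T@(b , c , (mb , mc) , (m≢b , m≢c , b≢c)) (split t x≢y only _ _) o | inj₁ (inj₂ refl)
    with only (tr p t mb) | only (tr p t mc)
  ... | inj₂ e    | _         = ⊥-elim (m≢b (sym e))
  ... | _         | inj₂ e    = ⊥-elim (m≢c (sym e))
  ... | inj₁ refl | inj₁ refl = ⊥-elim (b≢c refl)
  in-triple T (trip zx zy z≢x z≢y x≢y _ s) o | inj₁ m
    with hit-star o (t≢f zx (s _ (≢-sym z≢x))) (t≢f zy (s _ (≢-sym z≢y))) x≢y
  ... | refl with m
  ...   | inj₁ e = ⊥-elim (z≢x e)
  ...   | inj₂ e = ⊥-elim (z≢y e)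

  in-triple′ : ∀ {q x y m} → InTriple m → Realises q x y → Off m p q → Third q m x y
  in-triple′ t (inj₁ R) o = in-triple t R o
  in-triple′ t (inj₂ R) o = Third-sym (in-triple t R o)

  Third-mem : ∀ {q m x y u} → Third q m x y → ⟦ p ⟧ m u ≡ true → m ≢ u → u ≡ x ⊎ u ≡ y
  Third-mem {x = x} {y} {u} T mu m≢u with u ≟ x | u ≟ y
  ... | yes e | _ = inj₁ e
  ... | _ | yes e = inj₂ e
  ... | no u≢x | no u≢y = ⊥-elim (no-four tx ty mu m≢x m≢y m≢u x≢y (≢-sym u≢x) (≢-sym u≢y))
    where open Third T

  Third-base : ∀ {q m x y} → Third q m x y → InTriple m
  Third-base T = _ , _ , (tx , ty) , (m≢x , m≢y , x≢y)
    where open Third T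

  -- If m missed one of the edges, its part would be a triple from which both q and r split m off,
  -- and q would be r.
  movers : ∀ {q r x y x′ y′ m} → q ≢ r → Realises q x y → Realises r x′ y′ → Off m p q → Off m p r →
    (m ≡ x ⊎ m ≡ y) × (m ≡ x′ ⊎ m ≡ y′)
  movers q≢r Q R oq or with mover Q oq | mover R or
  ... | inj₁ e | inj₁ f = e , f
  ... | inj₂ T | _ = ⊥-elim (q≢r (isolated-unique oq or (Third.single T)
                       (Third.single (in-triple′ (Third-base T) R or))))
  ... | _ | inj₂ T = ⊥-elim (q≢r (isolated-unique oq or (Third.single (in-triple′ (Third-base T) Q oq))
                       (Third.single T)))

  -- In the triple case q and r split off two of its elements and stand for the opposite edges,
  -- which meet in the third.
  meet : ∀ {q r x y x′ y′} → A p q → A p r → A q r → Realises q x y → Realises r x′ y′ →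
    ∃ λ z → (z ≡ x ⊎ z ≡ y) × (z ≡ x′ ⊎ z ≡ y′)
  meet pq pr qr Q R with A⇒Off pq | A⇒Off pr | A⇒Off qr
  ... | v , oq | w , or | u , ou with common-mover oq or ou
  ... | inj₁ (m , oq′ , or′) = m , movers (A⇒≢ qr) Q R oq′ or′
  ... | inj₂ ((vw , vu) , (v≢w , v≢u , w≢u)) = u
      , Third-mem (in-triple′ (w , u , (vw , vu) , (v≢w , v≢u , w≢u)) Q oq) vu v≢u
      , Third-mem (in-triple′ (v , u , (sy p vw , wu) , (≢-sym v≢w , w≢u , v≢u)) R or) wu w≢u
    where wu = tr p (sy p vw) vu

  triple-neighbour : ∀ {q c y} → InTriple c → Realises q c y → ⟦ p ⟧ c y ≡ true
  triple-neighbour T (inj₁ R@(join _ _ _ s))         = ⊥-elim (InTriple-closed T s (Real⇒H R))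
  triple-neighbour (_ , _ , (cb , _) , (c≢b , _)) (inj₂ (join _ _ _ s)) = ⊥-elim (true≢false cb (s _ (≢-sym c≢b)))
  triple-neighbour T (inj₁ (split t _ _ _ _))        = t
  triple-neighbour T (inj₂ (split t _ _ _ _))        = sy p t
  triple-neighbour T (inj₁ (trip zx zy _ _ _ _ _))   = tr p (sy p zx) zy
  triple-neighbour T (inj₂ (trip zx zy _ _ _ _ _))   = tr p (sy p zy) zx

  Realises⇒≢ : ∀ {q x y} → Realises q x y → x ≢ y
  Realises⇒≢ (inj₁ R) = proj₁ (Real⇒H R)
  Realises⇒≢ (inj₂ R) = ≢-sym (proj₁ (Real⇒H R))

  Realises-≢ : ∀ {q r c y z} → q ≢ r → Realises q c y → Realises r c z → y ≢ z
  Realises-≢ q≢r Q R refl = q≢r (Realises-unique Q R)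

  centre-mover : ∀ {q r c y z} → A p q → A p r → A q r → Realises q c y → Realises r c z →
    InTriple c ⊎ (Off c p q × Off c p r)
  centre-mover pq pr qr Q R with A⇒Off pq | A⇒Off pr | A⇒Off qr
  ... | v , oq | w , or | u , ou with common-mover oq or ou
  ... | inj₂ ((vw , vu) , (v≢w , v≢u , w≢u)) =
    inj₁ (Third-InTriple (in-triple′ (w , u , (vw , vu) , (v≢w , v≢u , w≢u)) Q oq) (inj₁ refl))
  ... | inj₁ (m , oq′ , or′) with movers (A⇒≢ qr) Q R oq′ or′
  ... | inj₁ refl , _         = inj₂ (oq′ , or′)
  ... | inj₂ refl , inj₁ refl = inj₂ (oq′ , or′)
  ... | inj₂ refl , inj₂ e    = ⊥-elim (Realises-≢ (A⇒≢ qr) Q R e)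

  -- If c lies in a triple, three edges at c would need three further elements in its part.
  -- Otherwise c itself moves p to q, r and s, and `star-free` applies.
  no-centre : ∀ {q r s x c y z w} → Outer A p x → A p q → A p r → A p s → A x q → A x r → A x s →
    A q r → A q s → A r s → Realises q c y → Realises r c z → Realises s c w → ⊥
  no-centre {q} {r} {s} {c = c} ox pq pr ps xq xr xs qr qs rs Q R S =
    go (centre-mover pq pr qr Q R) (centre-mover pq ps qs Q S)
    where
    crowded : InTriple c → ⊥
    crowded T = no-four (triple-neighbour T Q) (triple-neighbour T R) (triple-neighbour T S)
      (Realises⇒≢ Q) (Realises⇒≢ R) (Realises⇒≢ S)
      (Realises-≢ (A⇒≢ qr) Q R) (Realises-≢ (A⇒≢ qs) Q S) (Realises-≢ (A⇒≢ rs) R S)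
    go : InTriple c ⊎ (Off c p q × Off c p r) → InTriple c ⊎ (Off c p q × Off c p s) → ⊥
    go (inj₂ (oq , or)) (inj₂ (_ , os)) = star-free ox pq pr ps xq xr xs (A⇒≢ qr) (A⇒≢ qs) (A⇒≢ rs) oq or os
    go (inj₁ T) _        = crowded T
    go _        (inj₁ T) = crowded T

-- The induced map on edges

-- Ordering the endpoints gives each edge of the complement one representative, so edges can be
-- compared and encoded by their endpoints.
record Edge {n} (G : Graph n) : Set where
  constructor edge
  field
    src     : Fin n
    tgt     : Fin n
    src<tgt : src Fin.< tgt
    nonadj  : adj G src tgt ≡ false
open Edge public

infix 4 _∈ᴱ_

_∈ᴱ_ : ∀ {n} {G : Graph n} → Fin n → Edge G → Set
x ∈ᴱ e = x ≡ src e ⊎ x ≡ tgt e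

module _ {n} {G : Graph n} where

  src≢tgt : (e : Edge G) → src e ≢ tgt e
  src≢tgt e = Finₚ.<⇒≢ (src<tgt e)

  edge-cong : {e e′ : Edge G} → src e ≡ src e′ → tgt e ≡ tgt e′ → e ≡ e′
  edge-cong {edge s t l a} {edge s t l′ a′} refl refl =
    cong₂ (edge s t) (ℕₚ.<-irrelevant l l′) (Decidable⇒UIP.≡-irrelevant Boolₚ._≟_ a a′)

  _≟ᴱ_ : (e e′ : Edge G) → Dec (e ≡ e′)
  e ≟ᴱ e′ with src e ≟ src e′ | tgt e ≟ tgt e′
  ... | yes p | yes q = yes (edge-cong p q)
  ... | no ¬p | _     = no (λ { refl → ¬p refl })
  ... | _     | no ¬q = no (λ { refl → ¬q refl })

  _∈ᴱ?_ : ∀ x (e : Edge G) → Dec (x ∈ᴱ e)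
  x ∈ᴱ? e with x ≟ src e | x ≟ tgt e
  ... | yes p | _     = yes (inj₁ p)
  ... | _     | yes q = yes (inj₂ q)
  ... | no ¬p | no ¬q = no (λ { (inj₁ p) → ¬p p ; (inj₂ q) → ¬q q })

  edge-≡ : ∀ {x y} {e e′ : Edge G} → x ≢ y → x ∈ᴱ e → y ∈ᴱ e → x ∈ᴱ e′ → y ∈ᴱ e′ → e ≡ e′
  edge-≡ x≢y (inj₁ a) (inj₁ b) _ _ = ⊥-elim (x≢y (trans a (sym b)))
  edge-≡ x≢y (inj₂ a) (inj₂ b) _ _ = ⊥-elim (x≢y (trans a (sym b)))
  edge-≡ x≢y _ _ (inj₁ a) (inj₁ b) = ⊥-elim (x≢y (trans a (sym b)))
  edge-≡ x≢y _ _ (inj₂ a) (inj₂ b) = ⊥-elim (x≢y (trans a (sym b)))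
  edge-≡ x≢y (inj₁ a) (inj₂ b) (inj₁ c) (inj₂ d) = edge-cong (trans (sym a) c) (trans (sym b) d)
  edge-≡ x≢y (inj₂ a) (inj₁ b) (inj₂ c) (inj₁ d) = edge-cong (trans (sym b) d) (trans (sym a) c)
  edge-≡ {e = e} {e′} x≢y (inj₁ refl) (inj₂ refl) (inj₂ refl) (inj₁ refl) = ⊥-elim (ℕₚ.<-asym (src<tgt e) (src<tgt e′))
  edge-≡ {e = e} {e′} x≢y (inj₂ refl) (inj₁ refl) (inj₁ refl) (inj₂ refl) = ⊥-elim (ℕₚ.<-asym (src<tgt e) (src<tgt e′))

  toEdge : ∀ x y → x ≢ y → adj G x y ≡ false → ∃ λ (e : Edge G) → x ∈ᴱ e × y ∈ᴱ e
  toEdge x y x≢y a with ℕₚ.<-cmp (toℕ x) (toℕ y)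
  ... | tri< l _ _ = edge x y l a , inj₁ refl , inj₂ refl
  ... | tri≈ _ e _ = ⊥-elim (x≢y (Finₚ.toℕ-injective e))
  ... | tri> _ _ l = edge y x l (trans (Graph.sym G y x) a) , inj₂ refl , inj₁ refl

  other : ∀ {x} (e : Edge G) → x ∈ᴱ e → ∃ λ y → y ∈ᴱ e × x ≢ y × adj G x y ≡ false
  other e (inj₁ refl) = tgt e , inj₂ refl , src≢tgt e , nonadj e
  other e (inj₂ refl) = src e , inj₁ refl , ≢-sym (src≢tgt e) , trans (Graph.sym G _ _) (nonadj e)

  ∈ᴱ-third : ∀ {x y z} {e : Edge G} → x ≢ y → x ∈ᴱ e → y ∈ᴱ e → z ∈ᴱ e → z ≡ x ⊎ z ≡ y
  ∈ᴱ-third x≢y (inj₁ a) (inj₁ b) _ = ⊥-elim (x≢y (trans a (sym b)))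
  ∈ᴱ-third x≢y (inj₂ a) (inj₂ b) _ = ⊥-elim (x≢y (trans a (sym b)))
  ∈ᴱ-third x≢y (inj₁ a) _ (inj₁ c) = inj₁ (trans c (sym a))
  ∈ᴱ-third x≢y (inj₂ a) _ (inj₂ c) = inj₁ (trans c (sym a))
  ∈ᴱ-third x≢y _ (inj₁ b) (inj₁ c) = inj₂ (trans c (sym b))
  ∈ᴱ-third x≢y _ (inj₂ b) (inj₂ c) = inj₂ (trans c (sym b))

  nonadj-∈ᴱ : ∀ {x y} (e : Edge G) → x ≢ y → x ∈ᴱ e → y ∈ᴱ e → adj G x y ≡ false
  nonadj-∈ᴱ e x≢y (inj₁ refl) (inj₁ refl) = ⊥-elim (x≢y refl)
  nonadj-∈ᴱ e x≢y (inj₂ refl) (inj₂ refl) = ⊥-elim (x≢y refl)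
  nonadj-∈ᴱ e x≢y (inj₁ refl) (inj₂ refl) = nonadj e
  nonadj-∈ᴱ e x≢y (inj₂ refl) (inj₁ refl) = trans (Graph.sym G _ _) (nonadj e)

  edgeCode : Edge G → Fin (n * n)
  edgeCode e = combine (src e) (tgt e)

  edgeCode-injective : ∀ {e e′} → edgeCode e ≡ edgeCode e′ → e ≡ e′
  edgeCode-injective {e} {e′} eq with Finₚ.combine-injective (src e) (tgt e) (src e′) (tgt e′) eq
  ... | a , b = edge-cong a b

  Share : Edge G → Edge G → Set
  Share e e′ = ∃ λ x → x ∈ᴱ e × x ∈ᴱ e′

  Common : Edge G → Edge G → Edge G → Set
  Common e e′ e″ = ∃ λ x → x ∈ᴱ e × x ∈ᴱ e′ × x ∈ᴱ e″

  -- Repeated edges are excluded by `noCommon`: a repetition would make some shared endpoint common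
  -- to all three.
  record Tri (e e′ e″ : Edge G) : Set where
    constructor tri
    field
      share₁₂  : Share e e′
      share₁₃  : Share e e″
      share₂₃  : Share e′ e″
      noCommon : ¬ Common e e′ e″

-- Preservation is required in one direction only; `Reflect` recovers the converse from a pair of
-- such maps.
record EdgeMap {n₁ n₂} (G₁ : Graph n₁) (G₂ : Graph n₂) : Set where
  field
    map       : Edge G₁ → Edge G₂
    injective : ∀ {e e′} → map e ≡ map e′ → e ≡ e′
    share     : ∀ {e e′} → Share e e′ → Share (map e) (map e′)
    triangle  : ∀ {e e′ e″} → Tri e e′ e″ → Tri (map e) (map e′) (map e″)

module Transfer {n₁ n₂} (G₁ : Graph n₁) (G₂ : Graph n₂) (k₁ k₂ : ℕ) (k₁+2≤n₁ : k₁ + 2 ≤ n₁) (k₂+2≤n₂ : k₂ + 2 ≤ n₂)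
  (φ : Bell.V G₁ k₁ → Bell.V G₂ k₂) (φ-injective : ∀ {x y} → φ x ≡ φ y → x ≡ y)
  (push : ∀ {x y} → Bell.A G₁ k₁ x y → Bell.A G₂ k₂ (φ x) (φ y))
  (p : Bell.V G₂ k₂) (L : Local (Bell.A G₂ k₂) p)
  (push-D : ∀ {x} → Bell.A G₁ k₁ (AtDiscrete.D G₁ k₁ k₁+2≤n₁) x → Bell.A G₂ k₂ p (φ x))
  (push-Outer : ∀ {x} → Outer (Bell.A G₁ k₁) (AtDiscrete.D G₁ k₁ k₁+2≤n₁) x → Outer (Bell.A G₂ k₂) p (φ x)) where
  private
    module B₁ = Bell G₁ k₁
    module B₂ = Bell G₂ k₂
    module D = AtDiscrete G₁ k₁ k₁+2≤n₁
    module P = EdgeOf G₂ k₂ k₂+2≤n₂ p L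

    opaque
      pairOf : (e : Edge G₁) → ∃ λ q → D.IsPair q (src e) (tgt e)
      pairOf e = D.pair (src e) (tgt e) (src≢tgt e , nonadj e)

    J : Edge G₁ → B₁.V
    J e = proj₁ (pairOf e)

    J-pair : ∀ {x} e → x ∈ᴱ e → ∃ λ y → y ∈ᴱ e × D.IsPair (J e) x y
    J-pair e (inj₁ refl) = tgt e , inj₂ refl , proj₂ (pairOf e)
    J-pair e (inj₂ refl) = src e , inj₁ refl , D.IsPair-sym (proj₂ (pairOf e))

    J-injective : ∀ {e e′} → J e ≡ J e′ → e ≡ e′
    J-injective {e} {e′} eq = edge-≡ (src≢tgt e) (inj₁ refl) (inj₂ refl)
      (mem (src≢tgt e) e-same) (mem (≢-sym (src≢tgt e)) (B₁.sy (J e′) e-same))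
      where
      e-same : B₁.⟦ J e′ ⟧ (src e) (tgt e) ≡ true
      e-same = subst (λ q → B₁.⟦ q ⟧ (src e) (tgt e) ≡ true) eq (proj₂ (proj₂ (proj₂ (pairOf e))))
      mem : ∀ {x y} → x ≢ y → B₁.⟦ J e′ ⟧ x y ≡ true → x ∈ᴱ e′
      mem = D.pair-mem (proj₂ (pairOf e′))

    J-A : ∀ e → B₂.A p (φ (J e))
    J-A e = push-D (D.pair⇒A (proj₂ (pairOf e)))

    J-share : ∀ {e e′} → e ≢ e′ → Share e e′ → B₁.A (J e) (J e′)
    J-share {e} {e′} e≢e′ (z , m , m′) with J-pair e m | J-pair e′ m′
    ... | _ , _ , Q | _ , _ , R = D.shared⇒A (λ eq → e≢e′ (J-injective eq)) Q R

    opaque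
      image : (e : Edge G₁) → ∃ λ (e′ : Edge G₂) → ∃₂ λ x y → x ∈ᴱ e′ × y ∈ᴱ e′ × P.Realises (φ (J e)) x y
      image e with P.real (J-A e)
      ... | x , y , R with P.Real⇒H R
      ... | x≢y , a with toEdge x y x≢y a
      ... | e′ , m , m′ = e′ , x , y , m , m′ , inj₁ R

    f : Edge G₁ → Edge G₂
    f e = proj₁ (image e)

    swap : ∀ {q x y} → P.Realises q x y → P.Realises q y x
    swap (inj₁ R) = inj₂ R
    swap (inj₂ R) = inj₁ R

    realised : ∀ e {z} → z ∈ᴱ f e → ∃ λ w → P.Realises (φ (J e)) z w × w ∈ᴱ f e
    realised e m with proj₂ (image e)
    ... | x , y , mx , my , R with ∈ᴱ-third {e = f e} (P.Realises⇒≢ R) mx my m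
    ... | inj₁ refl = y , R , my
    ... | inj₂ refl = x , swap R , mx

    f-injective : ∀ {e e′} → f e ≡ f e′ → e ≡ e′
    f-injective {e} {e′} eq with realised e (inj₁ refl) | realised e′ (inj₁ refl)
    ... | w , R , m | w′ , R′ , m′ = J-injective (φ-injective (P.Realises-unique R (subst₂ (P.Realises _) (cong src (sym eq)) w≡ R′)))
      where
      w≡ : w′ ≡ w
      w≡ = trans (is-tgt (f e′) m′ (P.Realises⇒≢ R′)) (trans (cong tgt (sym eq)) (sym (is-tgt (f e) m (P.Realises⇒≢ R))))
        where
        is-tgt : ∀ (e : Edge G₂) {w} → w ∈ᴱ e → src e ≢ w → w ≡ tgt e
        is-tgt e (inj₁ a) b = ⊥-elim (b (sym a))
        is-tgt e (inj₂ a) b = a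

    f-share : ∀ {e e′} → Share e e′ → Share (f e) (f e′)
    f-share {e} {e′} s with e ≟ᴱ e′
    ... | yes refl = src (f e) , inj₁ refl , inj₁ refl
    ... | no e≢e′ with proj₂ (image e) | proj₂ (image e′)
    ... | x , y , mx , my , R | x′ , y′ , mx′ , my′ , R′ with P.meet (J-A e) (J-A e′) (push (J-share e≢e′ s)) R R′
    ... | z , a , b = z , among (f e) mx my a , among (f e′) mx′ my′ b
      where
      among : ∀ (e : Edge G₂) {x y z} → x ∈ᴱ e → y ∈ᴱ e → z ≡ x ⊎ z ≡ y → z ∈ᴱ e
      among _ m _ (inj₁ refl) = m
      among _ _ m (inj₂ refl) = m

    f-triangle : ∀ {e e′ e″} → Tri e e′ e″ → Tri (f e) (f e′) (f e″)
    f-triangle {e} {e′} {e″} (tri s₁₂ s₁₃ s₂₃ none) = tri (f-share s₁₂) (f-share s₁₃) (f-share s₂₃) none′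
      where
      e≢e′ : e ≢ e′
      e≢e′ refl = none (proj₁ s₁₃ , proj₁ (proj₂ s₁₃) , proj₁ (proj₂ s₁₃) , proj₂ (proj₂ s₁₃))
      e≢e″ : e ≢ e″
      e≢e″ refl = none (proj₁ s₁₂ , proj₁ (proj₂ s₁₂) , proj₂ (proj₂ s₁₂) , proj₁ (proj₂ s₁₂))
      e′≢e″ : e′ ≢ e″
      e′≢e″ refl = none (proj₁ s₁₂ , proj₁ (proj₂ s₁₂) , proj₂ (proj₂ s₁₂) , proj₂ (proj₂ s₁₂))
      outer : ∃ λ x → Outer B₁.A D.D x × B₁.A x (J e) × B₁.A x (J e′) × B₁.A x (J e″)
      outer = D.triangle-outer (pairAt e a≢b a∈e b∈e) (pairAt e′ a≢c a∈e′ c∈e′) (pairAt e″ b≢c b∈e″ c∈e″)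
        where
        a = proj₁ s₁₂
        b = proj₁ s₁₃
        c = proj₁ s₂₃
        a∈e = proj₁ (proj₂ s₁₂)
        a∈e′ = proj₂ (proj₂ s₁₂)
        b∈e = proj₁ (proj₂ s₁₃)
        b∈e″ = proj₂ (proj₂ s₁₃)
        c∈e′ = proj₁ (proj₂ s₂₃)
        c∈e″ = proj₂ (proj₂ s₂₃)
        a≢b : a ≢ b
        a≢b eq = none (a , a∈e , a∈e′ , subst (_∈ᴱ e″) (sym eq) b∈e″)
        a≢c : a ≢ c
        a≢c eq = none (a , a∈e , a∈e′ , subst (_∈ᴱ e″) (sym eq) c∈e″)
        b≢c : b ≢ c
        b≢c eq = none (b , b∈e , subst (_∈ᴱ e′) (sym eq) c∈e′ , b∈e″)
        pairAt : ∀ e {x y} → x ≢ y → x ∈ᴱ e → y ∈ᴱ e → D.IsPair (J e) x y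
        pairAt e x≢y m m′ with J-pair e m
        ... | y′ , m″ , Q with ∈ᴱ-third {e = e} (proj₁ Q) m m″ m′
        ... | inj₁ eq   = ⊥-elim (x≢y (sym eq))
        ... | inj₂ refl = Q
      -- The triple on the three endpoints is an outer vertex adjacent to all three pairs, and so is
      -- its image next to p; `no-centre` excludes this for a star.
      none′ : ¬ Common (f e) (f e′) (f e″)
      none′ (z , m , m′ , m″) with outer | realised e m | realised e′ m′ | realised e″ m″
      ... | x , ox , a , b , c | _ , R , _ | _ , R′ , _ | _ , R″ , _ =
        P.no-centre (push-Outer ox) (J-A e) (J-A e′) (J-A e″) (push a) (push b) (push c)
          (push (J-share e≢e′ s₁₂)) (push (J-share e≢e″ s₁₃)) (push (J-share e′≢e″ s₂₃)) R R′ R″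

  edges : EdgeMap G₁ G₂
  edges = record { map = f ; injective = f-injective ; share = f-share ; triangle = f-triangle }

edgeMap : ∀ {n₁ n₂ k₁ k₂} {G₁ : Graph n₁} {G₂ : Graph n₂} → k₁ + 2 ≤ n₁ → k₂ + 2 ≤ n₂ →
  UpperBellAdj G₁ k₁ ≅ᴳ UpperBellAdj G₂ k₂ → EdgeMap G₁ G₂
edgeMap {k₁ = k₁} {k₂} {G₁} {G₂} l₁ l₂ I =
  Transfer.edges G₁ G₂ k₁ k₂ l₁ l₂ φ φ-injective push (φ D) (Local-transport I′ D-local) push push-Outer
  where
  open AtDiscrete G₁ k₁ l₁ using (D; D-local)
  module B₁ = Bell G₁ k₁
  module B₂ = Bell G₂ k₂
  φ : B₁.V → B₂.V
  φ = Inverse.to (_≅ᴳ_.bij I)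
  φ-injective : ∀ {x y} → φ x ≡ φ y → x ≡ y
  φ-injective {x} {y} e = trans (sym (ψφ x)) (trans (cong (Inverse.from (_≅ᴳ_.bij I)) e) (ψφ y))
    where ψφ = Inverse.strictlyInverseʳ (_≅ᴳ_.bij I)
  I′ : B₁.A ≅ᴳ B₂.A
  I′ = record { bij = _≅ᴳ_.bij I ; adj-pres = λ x y → mk⇔
    (λ a → B₂.A-intro (to (_≅ᴳ_.adj-pres I x y) (B₁.A-elim a)))
    (λ a → B₁.A-intro (from (_≅ᴳ_.adj-pres I x y) (B₂.A-elim a))) }
  push : ∀ {x y} → B₁.A x y → B₂.A (φ x) (φ y)
  push {x} {y} = to (_≅ᴳ_.adj-pres I′ x y)
  push-Outer : ∀ {x} → Outer B₁.A D x → Outer B₂.A (φ D) (φ x)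
  push-Outer (x≢D , ¬a) = (λ e → x≢D (φ-injective e)) , (λ a → ¬a (from (_≅ᴳ_.adj-pres I′ _ _) a))

-- Recovering the vertices from the edges

invert : ∀ {V W} {A : V → V → Set} {B : W → W → Set} → A ≅ᴳ B → B ≅ᴳ A
invert {A = A} {B} I = record
  { bij      = mk↔ₛ′ (Inverse.from bij) (Inverse.to bij) (Inverse.strictlyInverseʳ bij) (Inverse.strictlyInverseˡ bij)
  ; adj-pres = λ x y → mk⇔
      (λ b → from (adj-pres _ _) (subst₂ B (sym (Inverse.strictlyInverseˡ bij x)) (sym (Inverse.strictlyInverseˡ bij y)) b))
      (λ a → subst₂ B (Inverse.strictlyInverseˡ bij x) (Inverse.strictlyInverseˡ bij y) (to (adj-pres _ _) a)) }
  where open _≅ᴳ_ I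

iterate-suc : {A : Set} (s : A → A) (m : ℕ) (x : A) → iterate s m (s x) ≡ iterate s (suc m) x
iterate-suc s zero    x = refl
iterate-suc s (suc m) x = cong s (iterate-suc s m x)

-- Injections of finite sets both ways that preserve a relation also reflect it: some power of their
-- composition fixes any given triple of edges.
module Reflect {n₁ n₂} {G₁ : Graph n₁} {G₂ : Graph n₂} (F : EdgeMap G₁ G₂) (B : EdgeMap G₂ G₁) where
  open EdgeMap F
  private
    module B = EdgeMap B

    h : Edge G₁ → Edge G₁
    h e = B.map (map e)

    Edge³ : Set
    Edge³ = Edge G₁ × Edge G₁ × Edge G₁

    h³ : Edge³ → Edge³
    h³ (a , b , c) = h a , h b , h c

    code : Edge³ → Fin ((n₁ * n₁) * ((n₁ * n₁) * (n₁ * n₁)))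
    code (a , b , c) = combine (edgeCode a) (combine (edgeCode b) (edgeCode c))

    code-injective : ∀ {x y} → code x ≡ code y → x ≡ y
    code-injective {a , b , c} {a′ , b′ , c′} eq
      with Finₚ.combine-injective (edgeCode a) _ (edgeCode a′) _ eq
    ... | p , q with Finₚ.combine-injective (edgeCode b) (edgeCode c) (edgeCode b′) (edgeCode c′) q
    ... | r , s = cong₂ _,_ (edgeCode-injective p) (cong₂ _,_ (edgeCode-injective r) (edgeCode-injective s))

    h³-injective : ∀ {x y} → h³ x ≡ h³ y → x ≡ y
    h³-injective eq = cong₂ _,_ (inj (cong proj₁ eq))
      (cong₂ _,_ (inj (cong (proj₁ ∘ proj₂) eq)) (inj (cong (proj₂ ∘ proj₂) eq)))
      where
      inj : ∀ {a b} → h a ≡ h b → a ≡ b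
      inj e = injective (B.injective e)

    iterate-h³ : ∀ m a b c → iterate h³ m (a , b , c) ≡ (iterate h m a , iterate h m b , iterate h m c)
    iterate-h³ zero    a b c = refl
    iterate-h³ (suc m) a b c = cong h³ (iterate-h³ m a b c)

    undo : ∀ a b c → ∃ λ m → iterate h m (h a) ≡ a × iterate h m (h b) ≡ b × iterate h m (h c) ≡ c
    undo a b c with periodic code code-injective h³ h³-injective (a , b , c)
    ... | m , eq = m , at proj₁ , at (proj₁ ∘ proj₂) , at (proj₂ ∘ proj₂)
      where
      eq′ : (iterate h m (h a) , iterate h m (h b) , iterate h m (h c)) ≡ (a , b , c)
      eq′ = trans (cong₂ _,_ (iterate-suc h m a) (cong₂ _,_ (iterate-suc h m b) (iterate-suc h m c)))
        (trans (sym (iterate-h³ (suc m) a b c)) eq)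
      at : (π : Edge³ → Edge G₁) → π (iterate h m (h a) , iterate h m (h b) , iterate h m (h c)) ≡ π (a , b , c)
      at π = cong π eq′

    iterate-share : ∀ m {a b} → Share a b → Share (iterate h m a) (iterate h m b)
    iterate-share zero    s = s
    iterate-share (suc m) s = B.share (share (iterate-share m s))

    iterate-triangle : ∀ m {a b c} → Tri a b c → Tri (iterate h m a) (iterate h m b) (iterate h m c)
    iterate-triangle zero    t = t
    iterate-triangle (suc m) t = B.triangle (triangle (iterate-triangle m t))

  share⁻ : ∀ {a b} → Share (map a) (map b) → Share a b
  share⁻ {a} {b} s with undo a b b
  ... | m , p , q , _ = subst₂ Share p q (iterate-share m (B.share s))

  triangle⁻ : ∀ {a b c} → Tri (map a) (map b) (map c) → Tri a b c
  triangle⁻ {a} {b} {c} t with undo a b c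
  ... | m , p , q , r = subst (λ z → Tri a b z) r (subst₂ (λ x y → Tri x y _) p q (iterate-triangle m (B.triangle t)))

  backward-surjective : ∀ a → ∃ λ e → B.map e ≡ a
  backward-surjective a with undo a a a
  ... | zero  , p , _ = map a , p
  ... | suc m , p , _ = map (iterate h m (h a)) , p

-- Matching the endpoints of edges

module Whitney {n₁ n₂} {G₁ : Graph n₁} {G₂ : Graph n₂} (F : EdgeMap G₁ G₂) (B : EdgeMap G₂ G₁)
  (full₁ : ∀ x → ∃ λ y → x ≢ y × adj G₁ x y ≡ false) (full₂ : ∀ x → ∃ λ y → x ≢ y × adj G₂ x y ≡ false) where
  open EdgeMap F
  open Reflect F B using (share⁻; triangle⁻)

  surjective : ∀ e → ∃ λ e′ → map e′ ≡ e
  surjective = Reflect.backward-surjective B F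

  common? : ∀ (a b c : Edge G₂) → Dec (Common a b c)
  common? a b c = Finₚ.any? (λ x → (x ∈ᴱ? a) ×-dec ((x ∈ᴱ? b) ×-dec (x ∈ᴱ? c)))

  -- If the images, which pairwise meet, had no common vertex, they would form a triangle, and so
  -- would the original edges.
  star : ∀ {a b c z} → z ∈ᴱ a → z ∈ᴱ b → z ∈ᴱ c → Common (map a) (map b) (map c)
  star {a} {b} {c} {z} za zb zc with common? (map a) (map b) (map c)
  ... | yes e = e
  ... | no ¬e = ⊥-elim (Tri.noCommon (triangle⁻ (tri (share (z , za , zb)) (share (z , za , zc)) (share (z , zb , zc)) ¬e))
                  (z , za , zb , zc))

  meet-unique : ∀ {e e′ x y} → e ≢ e′ → x ∈ᴱ map e → x ∈ᴱ map e′ → y ∈ᴱ map e → y ∈ᴱ map e′ → x ≡ y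
  meet-unique {e} {e′} {x} {y} e≢e′ a b c d with x ≟ y
  ... | yes p = p
  ... | no ¬p = ⊥-elim (e≢e′ (injective (edge-≡ ¬p a c b d)))

  -- Says that x plays at `map e` the role of z at e. If no other edge contains z, either endpoint
  -- of `map e` qualifies.
  record End (e : Edge G₁) (z : Fin n₁) (x : Fin n₂) : Set where
    constructor end
    field
      own    : x ∈ᴱ map e
      others : ∀ e′ → e′ ≢ e → z ∈ᴱ e′ → x ∈ᴱ map e′
  open End

  another? : ∀ (e : Edge G₁) {z} → z ∈ᴱ e → (∃ λ e′ → e′ ≢ e × z ∈ᴱ e′) ⊎ (∀ e′ → e′ ≢ e → z ∈ᴱ e′ → ⊥)
  another? e {z} z∈e with Finₚ.any? (λ w → ¬? (w ∈ᴱ? e) ×-dec (¬? (z ≟ w) ×-dec (adj G₁ z w Boolₚ.≟ false)))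
  ... | yes (w , w∉e , z≢w , a) with toEdge z w z≢w a
  ...   | e′ , m , m′ = inj₁ (e′ , (λ { refl → w∉e m′ }) , m)
  another? e {z} z∈e | no none = inj₂ go
    where
    go : ∀ e′ → e′ ≢ e → z ∈ᴱ e′ → ⊥
    go e′ e′≢e m with other e′ m
    ... | w , m′ , z≢w , a with w ∈ᴱ? e
    ... | no w∉e  = none (w , w∉e , z≢w , a)
    ... | yes w∈e = e′≢e (edge-≡ z≢w m m′ z∈e w∈e)

  Ends : Edge G₁ → Fin n₁ → Fin n₁ → Set
  Ends e u v = ∃₂ λ x y → End e u x × End e v y × x ≢ y

  -- Take for x the vertex shared with the image of `e′`. By `star`, x lies on the image of every
  -- edge at u. An edge `e″` at v whose image met `map e` in x would form a triangle with e and
  -- `e′`, while the three images had x in common; so its image passes through y.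
  ends-from : ∀ {e u v e′} → u ≢ v → u ∈ᴱ e → v ∈ᴱ e → e′ ≢ e → u ∈ᴱ e′ → Ends e u v
  ends-from {e} {u} {v} {e′} u≢v u∈e v∈e e′≢e u∈e′ with share (u , u∈e , u∈e′)
  ... | x , x∈ , x∈′ with other (map e) x∈
  ... | y , y∈ , x≢y , _ = x , y , end x∈ at-u , end y∈ at-v , x≢y
    where
    at-u : ∀ e″ → e″ ≢ e → u ∈ᴱ e″ → x ∈ᴱ map e″
    at-u e″ e″≢e u∈e″ with star u∈e u∈e′ u∈e″
    ... | z , z∈ , z∈′ , z∈″ with meet-unique (≢-sym e′≢e) z∈ z∈′ x∈ x∈′
    ... | refl = z∈″
    at-v : ∀ e″ → e″ ≢ e → v ∈ᴱ e″ → y ∈ᴱ map e″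
    at-v e″ e″≢e v∈e″ with share (v , v∈e , v∈e″)
    ... | z , z∈ , z∈″ with ∈ᴱ-third {e = map e} x≢y x∈ y∈ z∈
    ... | inj₂ refl = z∈″
    ... | inj₁ refl = ⊥-elim (Tri.noCommon (triangle (tri (u , u∈e , u∈e′) (v , v∈e , v∈e″) (share⁻ (z , x∈′ , z∈″)) none))
                        (z , x∈ , x∈′ , z∈″))
      where
      none : ¬ Common e e′ e″
      none (w , w∈ , w∈′ , w∈″) with ∈ᴱ-third {e = e} u≢v u∈e v∈e w∈
      ... | inj₁ refl = e″≢e (edge-≡ u≢v w∈″ v∈e″ u∈e v∈e)
      ... | inj₂ refl = e′≢e (edge-≡ u≢v u∈e′ w∈′ u∈e v∈e)

  ends : ∀ e → Ends e (src e) (tgt e)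
  ends e with another? e (inj₁ refl) | another? e (inj₂ refl)
  ... | inj₁ (e′ , e′≢e , m) | _ = ends-from (src≢tgt e) (inj₁ refl) (inj₂ refl) e′≢e m
  ... | inj₂ _ | inj₁ (e′ , e′≢e , m) with ends-from (≢-sym (src≢tgt e)) (inj₂ refl) (inj₁ refl) e′≢e m
  ...   | x , y , a , b , x≢y = y , x , b , a , ≢-sym x≢y
  -- The edge is a component of its own, and either orientation is correct.
  ends e | inj₂ none | inj₂ none′ = src (map e) , tgt (map e)
    , end (inj₁ refl) (λ e′ a b → ⊥-elim (none e′ a b)) , end (inj₂ refl) (λ e′ a b → ⊥-elim (none′ e′ a b))
    , src≢tgt (map e)

  endOf : Edge G₁ → Fin n₁ → Fin n₂
  endOf e z with z ≟ src e
  ... | yes _ = proj₁ (ends e)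
  ... | no _  = proj₁ (proj₂ (ends e))

  endOf-End : ∀ {e z} → z ∈ᴱ e → End e z (endOf e z)
  endOf-End {e} {z} m with z ≟ src e
  ... | yes refl = proj₁ (proj₂ (proj₂ (ends e)))
  endOf-End {e} {z} (inj₁ p) | no q = ⊥-elim (q p)
  endOf-End {e} {z} (inj₂ refl) | no q = proj₁ (proj₂ (proj₂ (proj₂ (ends e))))

  endOf-≢ : ∀ {e z w} → z ≢ w → z ∈ᴱ e → w ∈ᴱ e → endOf e z ≢ endOf e w
  endOf-≢ {e} {z} {w} z≢w m m′ with z ≟ src e | w ≟ src e
  ... | yes p | yes q = ⊥-elim (z≢w (trans p (sym q)))
  ... | yes _ | no _ = proj₂ (proj₂ (proj₂ (proj₂ (ends e))))
  ... | no _ | yes _ = ≢-sym (proj₂ (proj₂ (proj₂ (proj₂ (ends e)))))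
  endOf-≢ {e} {z} {w} z≢w (inj₁ p) _ | no a | no b = ⊥-elim (a p)
  endOf-≢ {e} {z} {w} z≢w _ (inj₁ q) | no a | no b = ⊥-elim (b q)
  endOf-≢ {e} {z} {w} z≢w (inj₂ p) (inj₂ q) | no a | no b = ⊥-elim (z≢w (trans p (sym q)))

  -- Both candidates lie on both images, and the images of distinct edges meet in at most one
  -- vertex.
  endOf-coherent : ∀ {e e′ z} → z ∈ᴱ e → z ∈ᴱ e′ → endOf e z ≡ endOf e′ z
  endOf-coherent {e} {e′} m m′ with e ≟ᴱ e′
  ... | yes refl = refl
  ... | no e≢e′ = meet-unique e≢e′ (own a) (others a e′ (≢-sym e≢e′) m′) (others b e e≢e′ m) (own b)
    where
    a = endOf-End {e} m
    b = endOf-End {e′} m′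

  edgeAt : ∀ v → ∃ λ (e : Edge G₁) → v ∈ᴱ e
  edgeAt v with full₁ v
  ... | w , v≢w , a with toEdge v w v≢w a
  ... | e , m , _ = e , m

  opaque
    θ : Fin n₁ → Fin n₂
    θ v = endOf (proj₁ (edgeAt v)) v

    θ-endOf : ∀ {e v} → v ∈ᴱ e → θ v ≡ endOf e v
    θ-endOf {e} {v} m = endOf-coherent (proj₂ (edgeAt v)) m

  θ-∈ : ∀ {e v} → v ∈ᴱ e → θ v ∈ᴱ map e
  θ-∈ {e} {v} m = subst (_∈ᴱ map e) (sym (θ-endOf {e} m)) (own (endOf-End {e} m))

  θ-≢ : ∀ {e v w} → v ≢ w → v ∈ᴱ e → w ∈ᴱ e → θ v ≢ θ w
  θ-≢ {e} v≢w m m′ eq = endOf-≢ {e} v≢w m m′ (trans (sym (θ-endOf {e} m)) (trans eq (θ-endOf {e} m′)))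

  -- Edges at v and w have images sharing `θ v`, so they share some z. If z is v or w, one edge
  -- contains both, and its endpoints have different images. Otherwise both images contain `θ z` and
  -- `θ v`, so the edges coincide.
  θ-injective : ∀ {v w} → θ v ≡ θ w → v ≡ w
  θ-injective {v} {w} eq with v ≟ w
  ... | yes p = p
  ... | no v≢w with edgeAt v | edgeAt w
  ... | e , v∈e | e′ , w∈e′ with share⁻ {e} {e′} (θ v , θ-∈ {e} v∈e , subst (_∈ᴱ map e′) (sym eq) (θ-∈ {e′} w∈e′))
  ... | z , z∈e , z∈e′ with z ≟ v | z ≟ w
  ... | yes refl | _ = ⊥-elim (θ-≢ {e′} v≢w z∈e′ w∈e′ eq)
  ... | _ | yes refl = ⊥-elim (θ-≢ {e} v≢w v∈e z∈e eq)
  ... | no z≢v | no _ = ⊥-elim (θ-≢ {e′} v≢w (subst (v ∈ᴱ_) e≡e′ v∈e) w∈e′ eq)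
    where
    e≡e′ : e ≡ e′
    e≡e′ = injective (edge-≡ (θ-≢ {e} z≢v z∈e v∈e) (θ-∈ {e} z∈e) (θ-∈ {e} v∈e) (θ-∈ {e′} z∈e′)
      (subst (_∈ᴱ map e′) (sym eq) (θ-∈ {e′} w∈e′)))

  θ-surjective : ∀ x → ∃ λ v → θ v ≡ x
  θ-surjective x with full₂ x
  ... | y , x≢y , a with toEdge x y x≢y a
  ... | e₂ , m , _ with surjective e₂
  ... | e , refl with ∈ᴱ-third {e = map e} (θ-≢ {e} (src≢tgt e) (inj₁ refl) (inj₂ refl)) (θ-∈ {e} (inj₁ refl)) (θ-∈ {e} (inj₂ refl)) m
  ... | inj₁ p = src e , sym p
  ... | inj₂ p = tgt e , sym p

  θ-nonadj : ∀ {v w} → v ≢ w → adj G₁ v w ≡ false → adj G₂ (θ v) (θ w) ≡ false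
  θ-nonadj {v} {w} v≢w a with toEdge v w v≢w a
  ... | e , m , m′ = nonadj-∈ᴱ (map e) (θ-≢ {e} v≢w m m′) (θ-∈ {e} m) (θ-∈ {e} m′)

  θ-nonadj⁻ : ∀ {v w} → v ≢ w → adj G₂ (θ v) (θ w) ≡ false → adj G₁ v w ≡ false
  θ-nonadj⁻ {v} {w} v≢w a with toEdge (θ v) (θ w) (λ e → v≢w (θ-injective e)) a
  ... | e₂ , m , m′ with surjective e₂
  ... | e , refl = nonadj-∈ᴱ e v≢w (back m) (back m′)
    where
    back : ∀ {z} → θ z ∈ᴱ map e → z ∈ᴱ e
    back m with ∈ᴱ-third {e = map e} (θ-≢ {e} (src≢tgt e) (inj₁ refl) (inj₂ refl)) (θ-∈ {e} (inj₁ refl)) (θ-∈ {e} (inj₂ refl)) m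
    ... | inj₁ p = inj₁ (θ-injective p)
    ... | inj₂ p = inj₂ (θ-injective p)

  isomorphism : G₁ ≅ G₂
  isomorphism = record
    { bij = mk↔ₛ′ θ (λ x → proj₁ (θ-surjective x)) (λ x → proj₂ (θ-surjective x))
        (λ v → θ-injective (proj₂ (θ-surjective (θ v))))
    ; adj-pres = λ v w → mk⇔
        (λ a → Boolₚ.¬-not (λ b → true≢false a (θ-nonadj⁻ (λ { refl → true≢false a (irr G₁ v) }) b)))
        (λ a → Boolₚ.¬-not (λ b → true≢false a (θ-nonadj (λ { refl → true≢false a (irr G₂ (θ v)) }) b))) }

theorem1p3 : (n₁ n₂ : ℕ) (G₁ : Graph n₁) (G₂ : Graph n₂) (k₁ k₂ : ℕ) →
    NoUniversalVertex G₁ → NoUniversalVertex G₂ →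
    k₁ + 2 ≤ n₁ → k₂ + 2 ≤ n₂ →
    UpperBellAdj G₁ k₁ ≅ᴳ UpperBellAdj G₂ k₂ →
    G₁ ≅ G₂
theorem1p3 n₁ n₂ G₁ G₂ k₁ k₂ u₁ u₂ l₁ l₂ I = Whitney.isomorphism
  (edgeMap {G₁ = G₁} {G₂ = G₂} l₁ l₂ I)
  (edgeMap {G₁ = G₂} {G₂ = G₁} l₂ l₁ (invert {A = UpperBellAdj G₁ k₁} {B = UpperBellAdj G₂ k₂} I))
  (nonNeighbour G₁ u₁) (nonNeighbour G₂ u₂)
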